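{- For every real number $\varepsilon$ with $0<\varepsilon\le 1$, we have $b_\varepsilon\le \frac{1}{2\varepsilon}-\frac{1}{2}$.
   Context: Graphs are finite and simple. For an $n$-vertex graph $G$, a set $X\subseteq V(G)$ is a balanced separator if each component of $G-X$ has at most $2n/3$ vertices; $s(G)$ denotes the minimum size of a balanced separator in $G$. For a class $\mathcal{G}$ of graphs, $s_{\mathcal{G}}:\mathbb{N}\to\mathbb{N}$ is defined by $s_{\mathcal{G}}(n)=\max\{s(G):G\in\mathcal{G},\ |V(G)|\le n\}$. A class of graphs is hereditary if it is closed under taking induced subgraphs. For a graph $G$ and an integer $r\ge 0$, an $r$-shallow minor of $G$ is any graph obtained from a subgraph of $G$ by contracting pairwise vertex-disjoint subgraphs, each of radius at most $r$ (in particular, each connected). The density of a graph $H$ is $|E(H)|/|V(H)|$. Let $\nabla_r(G)$ be the maximum density of an $r$-shallow minor of $G$, and for a class $\mathcal{G}$ of graphs let $\nabla_{\mathcal{G}}:\mathbb{N}\to\mathbb{R}\cup\{\infty\}$ be defined by $\nabla_{\mathcal{G}}(r)=\sup\{\nabla_r(G):G\in\mathcal{G}\}$. For $0<\varepsilon\le 1$, $b_\varepsilon$ denotes the supremum of real numbers $b$ for which every hereditary class $\mathcal{G}$ of graphs such that $s_{\mathcal{G}}(n)=\Theta(n^{1-\varepsilon})$ satisfies $\nabla_{\mathcal{G}}(r)=\Omega(r^b)$. Asymptotic notation is with respect to $n\to\infty$ and $r\to\infty$; the implied constants may depend on the class and on $\varepsilon$. -}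

module Defs where

open import Level using (Level; 0ℓ; _⊔_) renaming (suc to lsuc)
open import Data.Bool using (Bool; true; false)
open import Data.Bool.Properties using () renaming (_≟_ to _≟ᵇ_)
open import Data.Nat as ℕ using (ℕ; suc; NonZero)
open import Data.Nat.Properties using (m^n≢0)
open import Data.Integer as ℤ using (ℤ; +_; -[1+_])
open import Data.Rational as ℚ
  using (ℚ; 0ℚ; 1ℚ; _<_; _+_; _*_; -_; _/_; ↥_; ↧ₙ_)
open import Data.Rational.Base using (+-*-rawSemiring)
open import Algebra.Definitions.RawSemiring +-*-rawSemiring using (_^_)
open import Data.Fin as Fin using (Fin)
open import Data.Fin.Subset using (Subset; _∈_; _∉_; ∣_∣)
open import Data.List using (length; filter; cartesianProduct; allFin)
open import Data.Product using (Σ; ∃; ∃₂; Σ-syntax; ∃-syntax; _×_; _,_)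
open import Data.Sum using (_⊎_)
open import Function.Bundles using (_⇔_)
open import Function.Definitions using (Injective; Surjective)
open import Relation.Nullary using (¬_)
open import Relation.Nullary.Decidable using (_×-dec_)
open import Relation.Binary.Core using (Rel)
open import Relation.Binary.Construct.Closure.ReflexiveTransitive using (Star)
open import Relation.Binary.PropositionalEquality using (_≡_; _≢_)

------------------------------------------------------------------------
-- Real numbers

-- Dedekind cuts.  The operations below act on bare pairs of predicates;
-- on arguments satisfying IsReal (and the stated side conditions) they
-- compute the lower and upper cut of the usual real operation.

record Cut : Set₁ where
  constructor cut
  field
    lower : ℚ → Set
    upper : ℚ → Set

open Cut public

record IsReal (x : Cut) : Set where
  field
    lower-inhabited : ∃ (lower x)
    upper-inhabited : ∃ (upper x)
    lower-rounded   : ∀ q → lower x q ⇔ (∃[ r ] q < r × lower x r)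
    upper-rounded   : ∀ q → upper x q ⇔ (∃[ r ] r < q × upper x r)
    disjoint        : ∀ q → ¬ (lower x q × upper x q)
    located         : ∀ q r → q < r → lower x q ⊎ upper x r

record ℝ : Set₁ where
  constructor real
  field
    ⌊_⌋    : Cut
    isReal : IsReal ⌊_⌋

open ℝ public

fromℚ : ℚ → Cut
fromℚ p = cut (λ q → q < p) (λ q → p < q)

fromℕ : ℕ → Cut
fromℕ n = fromℚ (+ n / 1)

infixl 6 _⊖_
infixl 7 _⊛_

_⊖_ : Cut → Cut → Cut
x ⊖ y = cut
  (λ q → ∃₂ λ a b → lower x a × upper y b × q < a + - b)
  (λ q → ∃₂ λ a b → upper x a × lower y b × a + - b < q)

-- Interval multiplication: if a < x < b and c < y < d, then x y lies
-- between the least and the greatest of ac, ad, bc, bd.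
_⊛_ : Cut → Cut → Cut
x ⊛ y = cut
  (λ q → ∃₂ λ a b → ∃₂ λ c d →
    (lower x a × upper x b × lower y c × upper y d) ×
    (q < a * c × q < a * d × q < b * c × q < b * d))
  (λ q → ∃₂ λ a b → ∃₂ λ c d →
    (lower x a × upper x b × lower y c × upper y d) ×
    (a * c < q × a * d < q × b * c < q × b * d < q))

-- 1 / x, for x > 0 (so that every element of the upper cut is positive).
recip : Cut → Cut
recip x = cut
  (λ q → ∃[ u ] upper x u × q * u < 1ℚ)
  (λ q → ∃[ l ] 0ℚ < l × lower x l × 1ℚ < q * l)

_^ℤ_ : (n : ℕ) .{{_ : NonZero n}} → ℤ → ℚ
n ^ℤ (+ k)    = + (n ℕ.^ k) / 1
n ^ℤ -[1+ k ] = _/_ (+ 1) (n ℕ.^ suc k) {{m^n≢0 n (suc k)}}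

-- n ^ x for real x and n ≥ 1, by monotone approximation with rational
-- exponents p = a / d: for q ≥ 0, q < n ^ (a / d) means q ^ d < n ^ a.
_^ᴿ_ : (n : ℕ) .{{_ : NonZero n}} → Cut → Cut
n ^ᴿ x = cut
  (λ q → ∃[ p ] lower x p ×
           (q < 0ℚ ⊎ q ^ (↧ₙ p) < n ^ℤ (↥ p)))
  (λ q → ∃[ p ] upper x p ×
           (0ℚ < q × n ^ℤ (↥ p) < q ^ (↧ₙ p)))

Positive : ℝ → Set
Positive x = lower ⌊ x ⌋ 0ℚ

-- Lower cuts alone represent elements of ℝ ∪ {-∞, +∞} (the empty cut is
-- -∞, the full one +∞).  The order is inclusion, so the supremum of any
-- family is its union.

Lower : (ℓ : Level) → Set (lsuc ℓ)
Lower ℓ = ℚ → Set ℓ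

infix 4 _≼_

_≼_ : ∀ {a b} → Lower a → Lower b → Set (a ⊔ b)
x ≼ y = ∀ q → x q → y q

sup : ∀ {a ℓ} {I : Set a} → (I → Lower ℓ) → Lower (a ⊔ ℓ)
sup {I = I} f q = Σ[ i ∈ I ] f i q

------------------------------------------------------------------------
-- Graphs

record Graph : Set where
  field
    ∣V∣    : ℕ
    adj    : Fin ∣V∣ → Fin ∣V∣ → Bool
    symm   : ∀ u v → adj u v ≡ adj v u
    irrefl : ∀ v → adj v v ≡ false

  V : Set
  V = Fin ∣V∣

  Adj : Rel V 0ℓ
  Adj u v = adj u v ≡ true

  ∣E∣ : ℕ
  ∣E∣ = length (filter (λ (u , v) → (u Fin.<? v) ×-dec (adj u v ≟ᵇ true))
                       (cartesianProduct (allFin ∣V∣) (allFin ∣V∣)))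

open Graph public

IsInducedSubgraph : Graph → Graph → Set
IsInducedSubgraph H G =
  Σ[ f ∈ (V H → V G) ] Injective _≡_ _≡_ f × (∀ u v → adj H u v ≡ adj G (f u) (f v))

IsSubgraph : Graph → Graph → Set
IsSubgraph H G =
  Σ[ f ∈ (V H → V G) ] Injective _≡_ _≡_ f × (∀ u v → Adj H u v → Adj G (f u) (f v))

GraphClass : Set₁
GraphClass = Graph → Set

Hereditary : GraphClass → Set
Hereditary 𝒢 = ∀ G H → 𝒢 G → IsInducedSubgraph H G → 𝒢 H

------------------------------------------------------------------------
-- Balanced separators

module _ (G : Graph) where

  AdjAvoiding : Subset (∣V∣ G) → Rel (V G) 0ℓ
  AdjAvoiding X u v = u ∉ X × v ∉ X × Adj G u v

  -- C is the vertex set of a component of G - X.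
  IsComponent : Subset (∣V∣ G) → Subset (∣V∣ G) → Set
  IsComponent X C = ∃[ u ] u ∉ X × (∀ v → v ∈ C ⇔ Star (AdjAvoiding X) u v)

  IsBalancedSeparator : Subset (∣V∣ G) → Set
  IsBalancedSeparator X = ∀ C → IsComponent X C → 3 ℕ.* ∣ C ∣ ℕ.≤ 2 ℕ.* ∣V∣ G

  -- s(G) = k
  HasSeparationNumber : ℕ → Set
  HasSeparationNumber k =
    (∃[ X ] IsBalancedSeparator X × ∣ X ∣ ≡ k) ×
    (∀ X → IsBalancedSeparator X → k ℕ.≤ ∣ X ∣)

-- s is the function s_𝒢.  It exists only for nonempty 𝒢.
IsSeparationFunction : GraphClass → (ℕ → ℕ) → Set
IsSeparationFunction 𝒢 s = ∀ n →
  (∃[ G ] 𝒢 G × ∣V∣ G ℕ.≤ n × HasSeparationNumber G (s n)) ×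
  (∀ G k → 𝒢 G → ∣V∣ G ℕ.≤ n → HasSeparationNumber G k → k ℕ.≤ s n)

------------------------------------------------------------------------
-- Shallow minors

data WalkAtMost {A : Set} (R : Rel A 0ℓ) : ℕ → A → A → Set where
  here : ∀ {k u} → WalkAtMost R k u u
  step : ∀ {k u v w} → R u v → WalkAtMost R k v w → WalkAtMost R (suc k) u w

-- H arises from G by contracting the fibres of φ, each of which induces a
-- subgraph of radius at most r.  Vertices that are not contracted are
-- one-element fibres; passing from a contracted subgraph to the induced
-- one on the same vertices does not change the result or increase the
-- radius.
module _ (r : ℕ) (G H : Graph) (φ : V G → V H) where

  AdjInFibre : V H → Rel (V G) 0ℓ
  AdjInFibre x u v = φ u ≡ x × φ v ≡ x × Adj G u v

  FibreRadiusAtMost : V H → Set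
  FibreRadiusAtMost x =
    ∃[ c ] φ c ≡ x × (∀ v → φ v ≡ x → WalkAtMost (AdjInFibre x) r c v)

  IsContraction : Set
  IsContraction =
    Surjective _≡_ _≡_ φ ×
    (∀ x → FibreRadiusAtMost x) ×
    (∀ x y → Adj H x y ⇔
      (x ≢ y × (∃₂ λ u v → φ u ≡ x × φ v ≡ y × Adj G u v)))

IsShallowMinor : ℕ → Graph → Graph → Set
IsShallowMinor r H G =
  ∃[ G′ ] IsSubgraph G′ G × (∃[ φ ] IsContraction r G′ H φ)

density : (H : Graph) .{{_ : NonZero (∣V∣ H)}} → ℚ
density H = + ∣E∣ H / ∣V∣ H

-- The supremum over the r-shallow minors of G with at least one vertex is
-- a maximum, since up to isomorphism there are finitely many of them.
∇ : ℕ → Graph → Lower 0ℓ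
∇ r G = sup {I = Σ[ H ∈ Graph ] NonZero (∣V∣ H) × IsShallowMinor r H G}
            (λ (H , nz , _) → lower (fromℚ (density H {{nz}})))

∇ᶜ : GraphClass → ℕ → Lower 0ℓ
∇ᶜ 𝒢 r = sup {I = ∃ 𝒢} (λ (G , _) → ∇ r G)

------------------------------------------------------------------------
-- Asymptotics

-- f(n) = Θ(n ^ x)
IsΘPow : (ℕ → ℕ) → Cut → Set₁
IsΘPow f x =
  Σ[ c ∈ ℝ ] Σ[ C ∈ ℝ ] Positive c × Positive C ×
    (∃[ N ] ∀ n .{{_ : NonZero n}} → N ℕ.≤ n →
      (lower (⌊ c ⌋ ⊛ n ^ᴿ x) ≼ lower (fromℕ (f n))) ×
      (lower (fromℕ (f n)) ≼ lower (⌊ C ⌋ ⊛ n ^ᴿ x)))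

-- f(r) = Ω(r ^ x)
IsΩPow : (ℕ → Lower 0ℓ) → Cut → Set₁
IsΩPow f x =
  Σ[ c ∈ ℝ ] Positive c ×
    (∃[ N ] ∀ r .{{_ : NonZero r}} → N ℕ.≤ r → lower (⌊ c ⌋ ⊛ r ^ᴿ x) ≼ f r)

------------------------------------------------------------------------
-- The exponent b_ε

ForcesDensity : ℝ → ℝ → Set₁
ForcesDensity ε b =
  ∀ (𝒢 : GraphClass) → Hereditary 𝒢 →
  ∀ s → IsSeparationFunction 𝒢 s → IsΘPow s (fromℚ 1ℚ ⊖ ⌊ ε ⌋) →
  IsΩPow (∇ᶜ 𝒢) ⌊ b ⌋

bSup : ℝ → Lower (lsuc 0ℓ)
bSup ε = sup {I = Σ[ b ∈ ℝ ] ForcesDensity ε b} (λ (b , _) → lower ⌊ b ⌋)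

{-# OPTIONS --safe #-}
module Submission where

-- Suppose that b forces density and that b > q = P / Q, although
-- ε > Q / (2P + Q), that is, q > 1 / (2ε) - 1/2.  Take the grid [L]^d with
-- every edge subdivided k times, for k = 2^j and L = 2^(g j).  Its balanced
-- separators have order at least L^(d-1) up to a constant, while a subgraph on
-- n vertices is separated by about (n / k)^(1 - 1/d) + O(1) vertices on equally
-- spaced hyperplanes.  For L^d ≈ k^λ with λ = d(1 - ε) / (dε - 1), the induced
-- subgraphs thus have separation function Θ(n^(1-ε)).  An r-shallow minor H has
-- bounded density if r is below k/4.  Otherwise it has at most
-- min(|V(H)|², 4|V(H)| + 2d L^d) edges, hence density O(L^(d/2)), which is of
-- order r^(λ/2) or less.  Since λ/2 tends to 1/(2ε) - 1/2 as d grows, it is less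
-- than q for large d.

-- One class has to serve all scales at once, and three obstacles shape it. First, `Γ j` for large j
-- also has small induced subgraphs. Those with at most about k vertices are cut by slabs narrower
-- than a subdivided edge, at constant cost, so late grids do not disturb small n. Second, the
-- Θ-estimate is required for every n and not only for the orders of the `Γ j`. This is why L at
-- most doubles whenever k does: consecutive orders then differ by a bounded factor. Third, all
-- reals are Dedekind cuts and the argument is constructive. The comparison of ε with a single
-- rational is not decidable, so the exponents g j are chosen by locatedness between two overlapping
-- cases, with a bounded error, instead of by rounding a real number. Every use of ε and of b passes
-- through rational bounds. The dimension is tied to the strict inequality that is assumed: for a
-- rational A / B that lies below ε and still above Q / (2P + Q), the choice d = 2PB + 1 suffices to
-- push λ / 2 below q.

open import Defs
open import Data.Product using (_,_)
open import Data.Rational using (1ℚ; ½)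

-- Finite sums of natural numbers and counting by indicators.

module Counting where

  open import Data.Bool using (Bool; true; false; not)
  open import Data.Nat
  open import Data.Nat.Properties
  open import Data.Fin as Fin using (Fin; zero; suc; toℕ; combine; _↑ˡ_; _↑ʳ_)
  import Data.Fin.Properties as Finₚ
  open import Data.Fin.Subset using (Subset; _∈_; ∣_∣)
  open import Data.Vec as Vec using (Vec; []; _∷_; lookup; tabulate)
  import Data.Vec.Properties as Vecₚ
  open import Data.Product using (∃-syntax; _,_)
  open import Function using (_∘_)
  open import Function.Definitions using (Injective)
  open import Relation.Nullary using (Dec; yes; no; does; contradiction)
  open import Relation.Nullary.Decidable using (dec-true; dec-false)
  open import Relation.Binary.PropositionalEquality
  open import Algebra.Properties.CommutativeMonoid.Sum +-0-commutativeMonoid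
    using (sum; sum-cong-≗; ∑-comm; sum-replicate-zero)
  open import Algebra.Properties.Semiring.Sum +-*-semiring using (*-distribˡ-sum)
  open ≤-Reasoning

  sum-mono-≤ : ∀ {n} {f g : Fin n → ℕ} → (∀ i → f i ≤ g i) → sum f ≤ sum g
  sum-mono-≤ {zero}  f≤g = z≤n
  sum-mono-≤ {suc n} f≤g = +-mono-≤ (f≤g zero) (sum-mono-≤ (f≤g ∘ suc))

  sum-const : ∀ n c → sum {n} (λ _ → c) ≡ n * c
  sum-const zero    c = refl
  sum-const (suc n) c = cong (c +_) (sum-const n c)

  sum-zero : ∀ n {f : Fin n → ℕ} → (∀ i → f i ≡ 0) → sum f ≡ 0
  sum-zero n f≡0 = trans (sum-cong-≗ f≡0) (sum-replicate-zero n)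

  term≤sum : ∀ {n} (f : Fin n → ℕ) i → f i ≤ sum f
  term≤sum f zero    = m≤m+n _ _
  term≤sum f (suc i) = ≤-trans (term≤sum (f ∘ suc) i) (m≤n+m _ _)

  sum<⇒term< : ∀ {n} (f g : Fin n → ℕ) → sum f < sum g → ∃[ i ] f i < g i
  sum<⇒term< {suc n} f g lt with f zero <? g zero
  ... | yes p = zero , p
  ... | no ¬p with i , q ← sum<⇒term< (f ∘ suc) (g ∘ suc)
                      (+-cancelˡ-< (g zero) _ _ (≤-<-trans (+-monoˡ-≤ _ (≮⇒≥ ¬p)) lt)) = suc i , q

  sum-positive : ∀ {n} (f : Fin n → ℕ) → 0 < sum f → ∃[ i ] 0 < f i
  sum-positive {n} f p = sum<⇒term< (λ _ → 0) f (subst (_< sum f) (sym (sum-zero n λ _ → refl)) p)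

  -- Pigeonhole. It selects the best offset for a family of parallel hyperplanes.
  average : ∀ {n} (f : Fin n → ℕ) → 0 < n → ∃[ i ] n * f i ≤ sum f
  average {n} f 0<n with Finₚ.any? (λ i → n * f i ≤? sum f)
  ... | yes p = p
  ... | no ¬p = contradiction (begin-strict
          sum f * 1  ≡⟨ *-identityʳ _ ⟩
          sum f  <⟨ n<1+n _ ⟩
          suc (sum f)  ≤⟨ *-cancelˡ-≤ n {{>-nonZero 0<n}} (begin
            n * suc (sum f)  ≡⟨ sum-const n _ ⟨
            sum {n} (λ _ → suc (sum f)) ≤⟨ sum-mono-≤ (λ i → ≰⇒> (¬p ∘ (i ,_))) ⟩
            sum (λ i → n * f i)  ≡⟨ *-distribˡ-sum n f ⟨
            n * sum f  ∎) ⟩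
          sum f  ≡⟨ *-identityʳ _ ⟨
          sum f * 1  ∎) (<-irrefl refl)

  sum-++ : ∀ m {n} (f : Fin (m + n) → ℕ) → sum f ≡ sum (f ∘ (_↑ˡ n)) + sum (f ∘ (m ↑ʳ_))
  sum-++ zero    f = refl
  sum-++ (suc m) f = trans (cong (f zero +_) (sum-++ m (f ∘ suc))) (sym (+-assoc (f zero) _ _))

  sum-combine : ∀ m {n} (f : Fin (m * n) → ℕ) →
    sum f ≡ sum {m} (λ i → sum {n} (λ j → f (combine i j)))
  sum-combine zero        f = refl
  sum-combine (suc m) {n} f = trans (sum-++ n f) (cong (sum (f ∘ (_↑ˡ (m * n))) +_) (sum-combine m (f ∘ (n ↑ʳ_))))

  𝟙 : Bool → ℕ
  𝟙 true  = 1
  𝟙 false = 0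

  𝟙≤1 : ∀ b → 𝟙 b ≤ 1
  𝟙≤1 true  = ≤-refl
  𝟙≤1 false = z≤n

  𝟙-mono : ∀ {a b} → (a ≡ true → b ≡ true) → 𝟙 a ≤ 𝟙 b
  𝟙-mono {false} a⇒b = z≤n
  𝟙-mono {true}  a⇒b rewrite a⇒b refl = ≤-refl

  𝟙-positive : ∀ {b} → 0 < 𝟙 b → b ≡ true
  𝟙-positive {true} _ = refl

  𝟙-not : ∀ b → 𝟙 b + 𝟙 (not b) ≡ 1
  𝟙-not true  = refl
  𝟙-not false = refl

  𝟙-<-≤ : ∀ n → 𝟙 (does (0 <? n)) ≤ n
  𝟙-<-≤ zero    = z≤n
  𝟙-<-≤ (suc n) = s≤s z≤n

  𝟙-<-false : ∀ n → does (0 <? n) ≡ false → n ≡ 0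
  𝟙-<-false zero _ = refl

  -- Lets a sum be charged to its nonzero terms only, so that it is bounded by their number times a
  -- common bound.
  ≤-𝟙-< : ∀ n {b} → n ≤ b → n ≤ 𝟙 (does (0 <? n)) * b
  ≤-𝟙-< zero    _   = z≤n
  ≤-𝟙-< (suc n) n≤b = ≤-trans n≤b (≤-reflexive (sym (+-identityʳ _)))

  does⇒ : ∀ {A : Set} (A? : Dec A) → does A? ≡ true → A
  does⇒ (yes a) _ = a

  ∈-tabulate⁺ : ∀ {n} (P : Fin n → Bool) {v} → P v ≡ true → v ∈ tabulate P
  ∈-tabulate⁺ P {v} eq = Vecₚ.lookup⇒[]= v _ (trans (Vecₚ.lookup∘tabulate P v) eq)

  ∈-tabulate⁻ : ∀ {n} (P : Fin n → Bool) {v} → v ∈ tabulate P → P v ≡ true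
  ∈-tabulate⁻ P {v} v∈ = trans (sym (Vecₚ.lookup∘tabulate P v)) (Vecₚ.[]=⇒lookup v∈)

  ♯ : ∀ {n} → (Fin n → Bool) → ℕ
  ♯ P = sum (𝟙 ∘ P)

  ♯-mono : ∀ {n} {P Q : Fin n → Bool} → (∀ i → P i ≡ true → Q i ≡ true) → ♯ P ≤ ♯ Q
  ♯-mono P⇒Q = sum-mono-≤ (λ i → 𝟙-mono (P⇒Q i))

  ♯≤n : ∀ {n} (P : Fin n → Bool) → ♯ P ≤ n
  ♯≤n {n} P = ≤-trans (sum-mono-≤ (𝟙≤1 ∘ P)) (≤-reflexive (trans (sum-const n 1) (*-identityʳ n)))

  ∣∣≡♯ : ∀ {n} (p : Subset n) → ∣ p ∣ ≡ ♯ (lookup p)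
  ∣∣≡♯ []          = refl
  ∣∣≡♯ (true ∷ p)  = cong suc (∣∣≡♯ p)
  ∣∣≡♯ (false ∷ p) = ∣∣≡♯ p

  ∣tabulate∣ : ∀ {n} (P : Fin n → Bool) → ∣ tabulate P ∣ ≡ ♯ P
  ∣tabulate∣ P = trans (∣∣≡♯ (tabulate P)) (sum-cong-≗ (λ i → cong 𝟙 (Vecₚ.lookup∘tabulate P i)))

  ♯-< : ∀ {n} t → ♯ {n} (λ i → does (toℕ i <? t)) ≤ t
  ♯-< {n}     zero    = ≤-reflexive (sum-zero n (λ i → cong 𝟙 (dec-false (toℕ i <? 0) λ ())))
  ♯-< {zero}  (suc t) = z≤n
  ♯-< {suc n} (suc t) = s≤s (♯-< {n} t)

  -- By induction on n the least index satisfying P can be taken to be 0; all the others are then at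
  -- most t.
  ♯-window : ∀ {n} t (P : Fin n → Bool) →
    (∀ i j → P i ≡ true → P j ≡ true → toℕ i ≤ toℕ j + t) → ♯ P ≤ suc t
  ♯-window {zero}  t P near = z≤n
  ♯-window {suc n} t P near with P zero in eq
  ... | false = ♯-window t (P ∘ suc) (λ i j Pi Pj → s≤s⁻¹ (near (suc i) (suc j) Pi Pj))
  ... | true  = ≤-trans (≤-reflexive (cong (λ b → 𝟙 b + ♯ (P ∘ suc)) (sym eq)))
                  (≤-trans (♯-mono (λ i Pi → dec-true (toℕ i <? suc t) (s≤s (near i zero Pi eq)))) (♯-< {suc n} (suc t)))

  ♯-unique : ∀ {n} (P : Fin n → Bool) →
    (∀ i j → P i ≡ true → P j ≡ true → i ≡ j) → ♯ P ≤ 1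
  ♯-unique P uniq = ♯-window 0 P (λ i j Pi Pj →
    ≤-reflexive (trans (cong toℕ (uniq i j Pi Pj)) (sym (+-identityʳ _))))

  -- Double counting of the pairs (i, f i): every value y has at most one preimage.
  ♯-injective : ∀ {m n} (f : Fin m → Fin n) → Injective _≡_ _≡_ f → (P : Fin n → Bool) →
    ♯ (P ∘ f) ≤ ♯ P
  ♯-injective {m} {n} f inj P = begin
    ♯ (P ∘ f)  ≤⟨ sum-mono-≤ pick ⟩
    sum (λ i → sum (λ y → 𝟙 (P y) * hits i y))  ≡⟨ ∑-comm (λ i y → 𝟙 (P y) * hits i y) ⟩
    sum (λ y → sum (λ i → 𝟙 (P y) * hits i y))  ≤⟨ sum-mono-≤ once ⟩
    ♯ P  ∎
    where
    hits : Fin m → Fin n → ℕ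
    hits i y = 𝟙 (does (f i Finₚ.≟ y))
    pick : ∀ i → 𝟙 (P (f i)) ≤ sum (λ y → 𝟙 (P y) * hits i y)
    pick i = begin
      𝟙 (P (f i))  ≡⟨ *-identityʳ _ ⟨
      𝟙 (P (f i)) * 1  ≡⟨ cong (λ b → 𝟙 (P (f i)) * 𝟙 b) (dec-true (f i Finₚ.≟ f i) refl) ⟨
      𝟙 (P (f i)) * hits i (f i)  ≤⟨ term≤sum (λ y → 𝟙 (P y) * hits i y) (f i) ⟩
      sum (λ y → 𝟙 (P y) * hits i y) ∎
    once : ∀ y → sum (λ i → 𝟙 (P y) * hits i y) ≤ 𝟙 (P y)
    once y = begin
      sum (λ i → 𝟙 (P y) * hits i y) ≡⟨ *-distribˡ-sum (𝟙 (P y)) (λ i → hits i y) ⟨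
      𝟙 (P y) * sum (λ i → hits i y) ≤⟨ *-monoʳ-≤ (𝟙 (P y)) (♯-unique (λ i → does (f i Finₚ.≟ y)) (λ i j p q →
         inj (trans (does⇒ (f i Finₚ.≟ y) p) (sym (does⇒ (f j Finₚ.≟ y) q))))) ⟩
      𝟙 (P y) * 1  ≡⟨ *-identityʳ _ ⟩
      𝟙 (P y)  ∎

-- Decidability of separation numbers, and the separation function of a class of induced subgraphs.

module Separation where

  open Counting
  open import Level using (0ℓ)
  open import Data.Bool using (Bool; true; false; not)
  open import Data.Bool.Properties using () renaming (_≟_ to _≟ᵇ_)
  open import Data.Nat
  open import Data.Nat.Properties
  open import Data.Nat.DivMod using (_/_; m<n*o⇒m/o<n; m≡m%n+[m/n]*n; m%n<n)
  open import Data.Nat.Tactic.RingSolver using (solve-∀)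
  open import Data.Fin as Fin using (Fin; zero; suc; toℕ; fromℕ<)
  import Data.Fin.Properties as Finₚ
  open import Data.Fin.Subset using (Subset; _∈_; _∉_; ∣_∣; ⊤)
  import Data.Fin.Subset.Properties as Subₚ
  open import Data.Vec as Vec using (Vec; []; _∷_; lookup; tabulate)
  import Data.Vec.Properties as Vecₚ
  open import Data.Product using (∃; ∃-syntax; Σ-syntax; _×_; _,_; proj₁; proj₂)
  open import Data.Sum using (_⊎_; inj₁; inj₂)
  open import Function using (_∘_)
  open import Function.Bundles using (mk⇔; Equivalence)
  open import Relation.Nullary using (Dec; yes; no; does; contradiction)
  open import Relation.Nullary.Decidable
    using (dec-true; dec-false; _⊎-dec_; _×-dec_; _→-dec_; ¬?; map′)
  open import Relation.Binary using (Rel; Decidable)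
  open import Relation.Binary.PropositionalEquality
  open import Relation.Binary.Construct.Closure.ReflexiveTransitive as Star
    using (Star; ε; _◅_; _◅◅_)
  open import Algebra.Properties.CommutativeMonoid.Sum +-0-commutativeMonoid
    using (sum; sum-cong-≗; ∑-distrib-+)
  open ≤-Reasoning

  -- Floyd–Warshall: the vertices strictly between u and v are below k.
  module _ {n : ℕ} (R : Rel (Fin n) 0ℓ) where

    Via : ℕ → Rel (Fin n) 0ℓ
    Via zero    u v = u ≡ v ⊎ R u v
    Via (suc k) u v = Via k u v ⊎ (∃[ w ] toℕ w ≡ k × Via k u w × Via k w v)

    via? : Decidable R → ∀ k → Decidable (Via k)
    via? R? zero    u v = (u Finₚ.≟ v) ⊎-dec R? u v
    via? R? (suc k) u v = via? R? k u v ⊎-dec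
      Finₚ.any? (λ w → (toℕ w ≟ k) ×-dec (via? R? k u w ×-dec via? R? k w v))

    via⇒star : ∀ k {u v} → Via k u v → Star R u v
    via⇒star zero    (inj₁ refl)          = ε
    via⇒star zero    (inj₂ r)             = r ◅ ε
    via⇒star (suc k) (inj₁ p)             = via⇒star k p
    via⇒star (suc k) (inj₂ (_ , _ , p , q)) = via⇒star k p ◅◅ via⇒star k q

    via-base : ∀ k {u v} → Via 0 u v → Via k u v
    via-base zero    p = p
    via-base (suc k) p = inj₁ (via-base k p)

    -- If w is the largest admissible pivot, it splits the path itself. Otherwise the two halves are
    -- joined at w one level below; if both visit the largest pivot, the detour between the two
    -- visits is dropped.
    via-trans : ∀ k {u w v} → toℕ w < k → Via k u w → Via k w v → Via k u v
    via-trans (suc k) {u} {w} {v} (s≤s w≤k) p q with m≤n⇒m<n∨m≡n w≤k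
    ... | inj₂ w≡k = inj₂ (w , w≡k , into p , out q)
      where
      into : Via (suc k) u w → Via k u w
      into (inj₁ p) = p
      into (inj₂ (x , x≡k , p , _)) = subst (Via k u) (Finₚ.toℕ-injective (trans x≡k (sym w≡k))) p
      out : Via (suc k) w v → Via k w v
      out (inj₁ q) = q
      out (inj₂ (x , x≡k , _ , q)) = subst (λ y → Via k y v) (Finₚ.toℕ-injective (trans x≡k (sym w≡k))) q
    ... | inj₁ w<k with p | q
    ...   | inj₁ p                | inj₁ q                = inj₁ (via-trans k w<k p q)
    ...   | inj₁ p                | inj₂ (x , e , q , q′) = inj₂ (x , e , via-trans k w<k p q , q′)
    ...   | inj₂ (x , e , p , p′) | inj₁ q                = inj₂ (x , e , p , via-trans k w<k p′ q)
    ...   | inj₂ (x , e , p , p′) | inj₂ (y , e′ , q , q′) =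
      inj₂ (x , e , p , subst (λ z → Via k z v) (Finₚ.toℕ-injective (trans e′ (sym e))) q′)

    star⇒via : ∀ {u v} → Star R u v → Via n u v
    star⇒via ε            = via-base n (inj₁ refl)
    star⇒via (_◅_ {j = w} r s) = via-trans n (Finₚ.toℕ<n w) (via-base n (inj₂ r)) (star⇒via s)

    star? : Decidable R → Decidable (Star R)
    star? R? u v = map′ (via⇒star n) star⇒via (via? R? n u v)

  least : ∀ {P : ℕ → Set} → (∀ k → Dec (P k)) → ∀ m → P m →
    ∃[ k ] P k × (∀ i → P i → k ≤ i)
  least P? zero    p = 0 , p , λ _ _ → z≤n
  least {P} P? (suc m) p with P? 0
  ... | yes p₀ = 0 , p₀ , λ _ _ → z≤n
  ... | no ¬p₀ with k , pk , min ← least (P? ∘ suc) m p =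
    suc k , pk , λ { zero p₀ → contradiction p₀ ¬p₀ ; (suc i) pi → s≤s (min i pi) }

  greatest : ∀ {P : ℕ → Set} → (∀ k → Dec (P k)) → ∀ n → ∃ P → (∀ k → P k → k ≤ n) →
    ∃[ k ] P k × (∀ i → P i → i ≤ k)
  greatest P? zero    (k , p) bound = k , p , λ i pi → ≤-trans (bound i pi) z≤n
  greatest {P} P? (suc n) w bound with P? (suc n)
  ... | yes p = suc n , p , bound
  ... | no ¬p = greatest P? n w (λ k pk →
    s≤s⁻¹ (≤∧≢⇒< (bound k pk) (λ { refl → ¬p pk })))

  module _ (G : Graph) where

    reach? : (X : Subset (∣V∣ G)) → Decidable (Star (AdjAvoiding G X))
    reach? X = star? _ λ u v → ¬? (u Subₚ.∈? X) ×-dec (¬? (v Subₚ.∈? X) ×-dec (adj G u v ≟ᵇ true))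

    componentSize : Subset (∣V∣ G) → V G → ℕ
    componentSize X u = ♯ (λ v → does (reach? X u v))

    componentSize-≤ : ∀ X u (P : V G → Bool) →
      (∀ v → Star (AdjAvoiding G X) u v → P v ≡ true) → componentSize X u ≤ ♯ P
    componentSize-≤ X u P h = ♯-mono (λ v r → h v (does⇒ (reach? X u v) r))

    componentSize-≥ : ∀ X u (P : V G → Bool) →
      (∀ v → P v ≡ true → Star (AdjAvoiding G X) u v) → ♯ P ≤ componentSize X u
    componentSize-≥ X u P h = ♯-mono (λ v p → dec-true (reach? X u v) (h v p))

    balanced⇒ : ∀ {X} → IsBalancedSeparator G X →
      ∀ u → u ∉ X → 3 * componentSize X u ≤ 2 * ∣V∣ G
    balanced⇒ {X} bal u u∉X = subst (λ c → 3 * c ≤ 2 * ∣V∣ G) (∣tabulate∣ P)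
      (bal (tabulate P) (u , u∉X , λ v → mk⇔ (does⇒ (reach? X u v) ∘ ∈-tabulate⁻ P)
                                             (∈-tabulate⁺ P ∘ dec-true (reach? X u v))))
      where P = λ v → does (reach? X u v)

    balanced⇐ : ∀ {X} → (∀ u → u ∉ X → 3 * componentSize X u ≤ 2 * ∣V∣ G) →
      IsBalancedSeparator G X
    balanced⇐ {X} h C (u , u∉X , C⇔) = begin
      3 * ∣ C ∣  ≡⟨ cong (3 *_) (∣∣≡♯ C) ⟩
      3 * ♯ (lookup C)  ≤⟨ *-monoʳ-≤ 3 (componentSize-≥ X u (lookup C)
                                    (λ v e → Equivalence.to (C⇔ v) (Vecₚ.lookup⇒[]= v C e))) ⟩
      3 * componentSize X u  ≤⟨ h u u∉X ⟩
      2 * ∣V∣ G  ∎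

    balanced? : ∀ X → Dec (IsBalancedSeparator G X)
    balanced? X = map′ balanced⇐ balanced⇒
      (Finₚ.all? λ u → ¬? (u Subₚ.∈? X) →-dec (3 * componentSize X u ≤? 2 * ∣V∣ G))

    full-balanced : IsBalancedSeparator G ⊤
    full-balanced = balanced⇐ (λ u u∉ → contradiction Subₚ.∈⊤ u∉)

    separationNumber : ∃ (HasSeparationNumber G)
    separationNumber with least (λ k → Subₚ.anySubset? (λ X → balanced? X ×-dec (∣ X ∣ ≟ k)))
                           ∣ ⊤ {n = ∣V∣ G} ∣ (⊤ , full-balanced , refl)
    ... | k , ex , min = k , ex , λ X bal → min ∣ X ∣ (X , bal , refl)

    separationNumber-unique : ∀ {k l} → HasSeparationNumber G k → HasSeparationNumber G l → k ≡ l
    separationNumber-unique ((X , bX , refl) , minX) ((Y , bY , refl) , minY) =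
      ≤-antisym (minX Y bY) (minY X bX)

    hasSeparationNumber? : ∀ k → Dec (HasSeparationNumber G k)
    hasSeparationNumber? k with l , has ← separationNumber with k ≟ l
    ... | yes refl = yes has
    ... | no k≢l   = no (λ has′ → k≢l (separationNumber-unique has′ has))

    -- A component of size c misses X, so 3c ≤ 3n - 3|X| ≤ 2n.
    large-balanced : ∀ X → ∣V∣ G ≤ 3 * ∣ X ∣ → IsBalancedSeparator G X
    large-balanced X big = balanced⇐ λ u u∉X → let c = componentSize X u in
      +-cancelˡ-≤ (∣V∣ G) _ _ (begin
        ∣V∣ G + 3 * c  ≤⟨ +-monoˡ-≤ (3 * c) big ⟩
        3 * ∣ X ∣ + 3 * c  ≡⟨ *-distribˡ-+ 3 ∣ X ∣ c ⟨
        3 * (∣ X ∣ + c)  ≤⟨ *-monoʳ-≤ 3 (begin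
          ∣ X ∣ + c  ≤⟨ +-mono-≤ (≤-reflexive (∣∣≡♯ X))
                                       (componentSize-≤ X u (not ∘ lookup X) (λ v → outside u∉X)) ⟩
          ♯ (lookup X) + ♯ (not ∘ lookup X) ≡⟨ ∑-distrib-+ (𝟙 ∘ lookup X) (𝟙 ∘ not ∘ lookup X) ⟨
          sum (λ v → 𝟙 (lookup X v) + 𝟙 (not (lookup X v))) ≡⟨ sum-cong-≗ (λ v → 𝟙-not (lookup X v)) ⟩
          sum {∣V∣ G} (λ v → 1)  ≡⟨ trans (sum-const (∣V∣ G) 1) (*-identityʳ _) ⟩
          ∣V∣ G  ∎) ⟩
        3 * ∣V∣ G  ≡⟨⟩
        ∣V∣ G + 2 * ∣V∣ G  ∎)
      where
      outside : ∀ {X u v} → u ∉ X → Star (AdjAvoiding G X) u v → not (lookup X v) ≡ true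
      outside {X} {u} u∉X ε with lookup X u in eq
      ... | true  = contradiction (Vecₚ.lookup⇒[]= u X eq) u∉X
      ... | false = refl
      outside u∉X ((_ , w∉X , _) ◅ r) = outside w∉X r

  mkGraph : ∀ n (a : Fin n → Fin n → Bool) → (∀ u v → a u v ≡ a v u) → (∀ v → a v v ≡ false) → Graph
  mkGraph n a s i = record { ∣V∣ = n ; adj = a ; symm = s ; irrefl = i }

  module _ {n : ℕ} {a a′ : Fin n → Fin n → Bool}
    {s : ∀ u v → a u v ≡ a v u} {i : ∀ v → a v v ≡ false}
    {s′ : ∀ u v → a′ u v ≡ a′ v u} {i′ : ∀ v → a′ v v ≡ false} where
    private
      G  = mkGraph n a s i
      G′ = mkGraph n a′ s′ i′

    balanced-cong : (∀ u v → a′ u v ≡ a u v) → ∀ X → IsBalancedSeparator G X → IsBalancedSeparator G′ X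
    balanced-cong eq X bal = balanced⇐ G′ λ u u∉X → ≤-trans
      (*-monoʳ-≤ 3 (componentSize-≤ G′ X u (λ v → does (reach? G X u v))
        (λ v r → dec-true (reach? G X u v)
          (Star.map (λ { (p , q , e) → p , q , trans (sym (eq _ _)) e }) r))))
      (balanced⇒ G bal u u∉X)

  -- Needed because a graph and its copy along a tabulated embedding agree only pointwise in their
  -- adjacencies, and their proofs of symmetry differ.
  hasSeparationNumber-cong : ∀ {n} {a a′ : Fin n → Fin n → Bool} {s i s′ i′ k} →
    (∀ u v → a′ u v ≡ a u v) →
    HasSeparationNumber (mkGraph n a s i) k → HasSeparationNumber (mkGraph n a′ s′ i′) k
  hasSeparationNumber-cong {s = s} {i} {s′} {i′} eq ((X , bal , size) , min) =
    (X , balanced-cong {s = s} {i} {s′} {i′} eq X bal , size) ,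
    λ Y bal′ → min Y (balanced-cong {s = s′} {i′} {s} {i} (λ u v → sym (eq u v)) Y bal′)

  -- This is ⌈m/3⌉, the least size at which a set is balanced by its size alone.
  third : ℕ → ℕ
  third m = (m + 2) / 3

  m≤3*third : ∀ m → m ≤ 3 * third m
  m≤3*third m = +-cancelʳ-≤ 2 m _ (begin
    m + 2  ≡⟨ m≡m%n+[m/n]*n (m + 2) 3 ⟩
    (m + 2) Data.Nat.% 3 + third m * 3 ≤⟨ +-monoˡ-≤ (third m * 3) (s≤s⁻¹ (m%n<n (m + 2) 3)) ⟩
    2 + third m * 3  ≡⟨ cong (2 +_) (*-comm (third m) 3) ⟩
    2 + 3 * third m  ≡⟨ +-comm 2 _ ⟩
    3 * third m + 2  ∎)

  third-least : ∀ {m k} → m ≤ 3 * k → third m ≤ k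
  third-least {m} {k} m≤ = s≤s⁻¹ (m<n*o⇒m/o<n {o = 3} (begin-strict
    m + 2  ≤⟨ +-monoˡ-≤ 2 m≤ ⟩
    3 * k + 2  <⟨ n<1+n _ ⟩
    suc (3 * k + 2) ≡⟨ eq k ⟩
    suc k * 3  ∎))
    where
    eq : ∀ k → suc (3 * k + 2) ≡ suc k * 3
    eq = solve-∀

  subsetOfSize : ∀ {n} k → k ≤ n → Σ[ X ∈ Subset n ] ∣ X ∣ ≡ k
  subsetOfSize {zero}  zero    _       = [] , refl
  subsetOfSize {suc n} zero    _       with X , e ← subsetOfSize {n} zero z≤n = false ∷ X , e
  subsetOfSize {suc n} (suc k) (s≤s h) with X , e ← subsetOfSize {n} k h     = true ∷ X , cong suc e

  third≤ : ∀ m → third m ≤ m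
  third≤ m = third-least (m≤n*m m 3)

  separationNumber-≤-third : ∀ G {k} → HasSeparationNumber G k → k ≤ third (∣V∣ G)
  separationNumber-≤-third G (_ , min) with X , size ← subsetOfSize (third (∣V∣ G)) (third≤ (∣V∣ G)) =
    subst (_ ≤_) size (min X (large-balanced G X (subst (λ t → ∣V∣ G ≤ 3 * t) (sym size) (m≤3*third (∣V∣ G)))))

  complete : ℕ → Graph
  complete n = mkGraph n (λ u v → not (does (u Finₚ.≟ v)))
    (λ u v → cong not (sym-does u v))
    (λ v → cong not (dec-true (v Finₚ.≟ v) refl))
    where
    sym-does : ∀ (u v : Fin n) → does (u Finₚ.≟ v) ≡ does (v Finₚ.≟ u)
    sym-does u v with u Finₚ.≟ v
    ... | yes refl = sym (dec-true (u Finₚ.≟ u) refl)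
    ... | no u≢v   = sym (dec-false (v Finₚ.≟ u) (u≢v ∘ sym))

  -- What remains after the removal of X is a single component, so balance means 3(n - |X|) ≤ 2n,
  -- that is, n ≤ 3|X|, unless X is everything.
  complete-separationNumber : ∀ n → HasSeparationNumber (complete n) (third n)
  complete-separationNumber n with separationNumber (complete n)
  ... | k , has@((X , bal , size) , min) = subst (HasSeparationNumber (complete n))
    (≤-antisym (separationNumber-≤-third (complete n) has)
               (subst (third n ≤_) size (third-least n≤3∣X∣))) has
    where
    G = complete n
    connected : ∀ {u} → u ∉ X → ∀ v → not (lookup X v) ≡ true → Star (AdjAvoiding G X) u v
    connected {u} u∉X v e with u Finₚ.≟ v
    ... | yes refl = ε
    ... | no u≢v   = (u∉X , (λ v∈ → contradiction (trans (sym (cong not (Vecₚ.[]=⇒lookup v∈))) e) λ ())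
                        , cong not (dec-false (u Finₚ.≟ v) u≢v)) ◅ ε
    n≤3∣X∣ : n ≤ 3 * ∣ X ∣
    n≤3∣X∣ with Finₚ.any? (λ u → ¬? (u Subₚ.∈? X))
    ... | yes (u , u∉X) = +-cancelʳ-≤ (2 * n) n _ (begin
      3 * n  ≡⟨ cong (3 *_) (trans (sym (*-identityʳ n)) (sym (sum-const n 1))) ⟩
      3 * sum {n} (λ v → 1)  ≡⟨ cong (3 *_) (sum-cong-≗ (λ v → 𝟙-not (lookup X v))) ⟨
      3 * sum (λ v → 𝟙 (lookup X v) + 𝟙 (not (lookup X v))) ≡⟨ cong (3 *_) (∑-distrib-+ (𝟙 ∘ lookup X) (𝟙 ∘ not ∘ lookup X)) ⟩
      3 * (♯ (lookup X) + ♯ (not ∘ lookup X))  ≡⟨ *-distribˡ-+ 3 (♯ (lookup X)) _ ⟩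
      3 * ♯ (lookup X) + 3 * ♯ (not ∘ lookup X)  ≤⟨ +-mono-≤ (≤-reflexive (cong (3 *_) (sym (∣∣≡♯ X))))
        (≤-trans (*-monoʳ-≤ 3 (componentSize-≥ G X u (not ∘ lookup X) (connected u∉X))) (balanced⇒ G bal u u∉X)) ⟩
      3 * ∣ X ∣ + 2 * n  ∎)
    ... | no ¬∃ = begin
      n  ≡⟨ trans (*-identityʳ n) refl ⟨
      n * 1  ≡⟨ sum-const n 1 ⟨
      sum {n} (λ _ → 1) ≤⟨ sum-mono-≤ (λ u → ≤-reflexive (cong 𝟙 (sym (all∈ u)))) ⟩
      ♯ (lookup X)  ≡⟨ ∣∣≡♯ X ⟨
      ∣ X ∣  ≤⟨ m≤n*m ∣ X ∣ 3 ⟩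
      3 * ∣ X ∣  ∎
      where
      all∈ : ∀ u → lookup X u ≡ true
      all∈ u with u Subₚ.∈? X
      ... | yes u∈ = Vecₚ.[]=⇒lookup u∈
      ... | no u∉  = contradiction (u , u∉) ¬∃

  anyVec? : ∀ {m} n {P : Vec (Fin m) n → Set} → (∀ xs → Dec (P xs)) → Dec (∃ P)
  anyVec? zero    P? = map′ ([] ,_) (λ { ([] , p) → p }) (P? [])
  anyVec? (suc n) P? = map′ (λ { (x , xs , p) → x ∷ xs , p }) (λ { (x ∷ xs , p) → x , xs , p })
    (Finₚ.any? λ x → anyVec? n λ xs → P? (x ∷ xs))

  any≤? : ∀ n {P : ℕ → Set} → (∀ k → Dec (P k)) → Dec (∃[ k ] k ≤ n × P k)
  any≤? n {P} P? = map′ (λ { (i , p) → toℕ i , s≤s⁻¹ (Finₚ.toℕ<n i) , p })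
    (λ { (k , k≤n , p) → fromℕ< (s≤s k≤n) , subst P (sym (Finₚ.toℕ-fromℕ< (s≤s k≤n))) p })
    (Finₚ.any? {n = suc n} (P? ∘ toℕ))

  pullback : (G : Graph) {n : ℕ} → (Fin n → V G) → Graph
  pullback G {n} f = mkGraph n (λ u v → adj G (f u) (f v))
    (λ u v → symm G (f u) (f v)) (λ v → irrefl G (f v))

  -- The graphs on at most M vertices are added in order that the separation
  -- function is computable: a small induced subgraph of a late Γ j cannot
  -- exceed the separation number of a complete graph on at most M vertices.
  module InducedClass (Γ : ℕ → Graph) (M : ℕ) where

    𝒢 : GraphClass
    𝒢 G = ∣V∣ G ≤ M ⊎ ∃[ j ] IsInducedSubgraph G (Γ j)

    hereditary : Hereditary 𝒢
    hereditary G H (inj₁ small) (f , inj , _) = inj₁ (≤-trans (Finₚ.injective⇒≤ inj) small)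
    hereditary G H (inj₂ (j , g , g-inj , g-adj)) (f , f-inj , f-adj) =
      inj₂ (j , g ∘ f , f-inj ∘ g-inj , λ u v → trans (f-adj u v) (g-adj (f u) (f v)))

    Injects : ∀ j {m} → Vec (V (Γ j)) m → Set
    Injects j {m} xs = ∀ (a b : Fin m) → lookup xs a ≡ lookup xs b → a ≡ b

    -- A finite, decidable stand-in for the separation numbers of the members with at most n
    -- vertices. The complete graph on `n ⊓ M` vertices dominates the members of order at most `M`,
    -- and of the `Γ j` only those with j ≤ n are searched.
    Attained : ℕ → ℕ → Set
    Attained n k = k ≡ third (n ⊓ M) ⊎
      (∃[ j ] j ≤ n × (∃[ m ] m ≤ n × (Σ[ xs ∈ Vec (V (Γ j)) m ]
        Injects j xs × HasSeparationNumber (pullback (Γ j) (lookup xs)) k)))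

    attained? : ∀ n k → Dec (Attained n k)
    attained? n k = (k ≟ third (n ⊓ M)) ⊎-dec
      any≤? n λ j → any≤? n λ m → anyVec? m λ xs →
        (Finₚ.all? λ a → Finₚ.all? λ b → (lookup xs a Finₚ.≟ lookup xs b) →-dec (a Finₚ.≟ b))
        ×-dec hasSeparationNumber? (pullback (Γ j) (lookup xs)) k

    attained-≤ : ∀ {n k} → Attained n k → k ≤ n
    attained-≤ {n} (inj₁ refl) = ≤-trans (third≤ (n ⊓ M)) (m⊓n≤m n M)
    attained-≤ (inj₂ (j , _ , m , m≤n , xs , _ , has)) =
      ≤-trans (≤-trans (separationNumber-≤-third (pullback (Γ j) (lookup xs)) has) (third≤ m)) m≤n

    abstract
     maximum : ∀ n → ∃[ k ] Attained n k × (∀ i → Attained n i → i ≤ k)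
     maximum n = greatest (attained? n) n (third (n ⊓ M) , inj₁ refl) (λ _ → attained-≤)

    sep : ℕ → ℕ
    sep n = proj₁ (maximum n)

    third-mono : ∀ {m n} → m ≤ n → third m ≤ third n
    third-mono m≤n = third-least (≤-trans m≤n (m≤3*third _))

    module _ (far : ∀ G j k → ∣V∣ G < j → IsInducedSubgraph G (Γ j) → HasSeparationNumber G k → 3 * k ≤ M) where

      sep-isSeparationFunction : IsSeparationFunction 𝒢 sep
      sep-isSeparationFunction n = realised (proj₁ (proj₂ (maximum n))) , bound
        where
        k = sep n
        max : ∀ i → Attained n i → i ≤ k
        max = proj₂ (proj₂ (maximum n))
        realised : ∀ {k} → Attained n k → ∃[ G ] 𝒢 G × ∣V∣ G ≤ n × HasSeparationNumber G k
        realised (inj₁ refl) = complete (n ⊓ M) , inj₁ (m⊓n≤n n M) , m⊓n≤m n M , complete-separationNumber (n ⊓ M)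
        realised (inj₂ (j , _ , m , m≤n , xs , inj , has)) =
          pullback (Γ j) (lookup xs) , inj₂ (j , lookup xs , inj _ _ , λ _ _ → refl) , m≤n , has
        small : ∀ {l} → l ≤ third (n ⊓ M) → l ≤ k
        small l≤ = ≤-trans l≤ (max _ (inj₁ refl))
        bound : ∀ G l → 𝒢 G → ∣V∣ G ≤ n → HasSeparationNumber G l → l ≤ k
        bound G l (inj₁ ≤M) ≤n has =
          small (≤-trans (separationNumber-≤-third G has) (third-mono (⊓-glb ≤n ≤M)))
        bound G l (inj₂ (j , f , inj , f-adj)) ≤n has with j ≤? n
        ... | yes j≤n = max l (inj₂ (j , j≤n , ∣V∣ G , ≤n , tabulate f ,
                (λ a b e → inj (trans (sym (Vecₚ.lookup∘tabulate f a)) (trans e (Vecₚ.lookup∘tabulate f b)))) ,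
                hasSeparationNumber-cong {s = symm G} {irrefl G} {symm (pullback (Γ j) (lookup (tabulate f)))} {irrefl (pullback (Γ j) (lookup (tabulate f)))}
                  (λ u v → trans (cong₂ (adj (Γ j)) (Vecₚ.lookup∘tabulate f u) (Vecₚ.lookup∘tabulate f v))
                                 (sym (f-adj u v))) has))
        -- Now |V(G)| ≤ n < j, so `far` applies. If `M` ≤ n, it gives 3l ≤ `M`; otherwise G itself
        -- has fewer than `M` vertices. Both times a complete graph does as well.
        ... | no j≰n with M ≤? n
        ...   | yes M≤n = small (*-cancelˡ-≤ 3 (≤-trans (far G j l (≤-<-trans ≤n (≰⇒> j≰n)) (f , inj , f-adj) has)
                  (≤-trans (⊓-glb M≤n ≤-refl) (m≤3*third (n ⊓ M)))))
        ...   | no M≰n = small (≤-trans (separationNumber-≤-third G has)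
                  (third-mono (⊓-glb ≤n (≤-trans ≤n (<⇒≤ (≰⇒> M≰n))))))

-- Points of the grid, and the subdivided grid as a graph.

module SubdividedGrid where

  open Counting
  open Separation
  open import Data.Bool using (Bool; _∨_)
  import Data.Bool.Properties as Boolₚ
  open import Data.Nat
  open import Data.Nat.Properties
  open import Data.Fin as Fin using (Fin; zero; suc; toℕ; combine; remQuot)
  import Data.Fin.Properties as Finₚ
  open import Data.Vec as Vec using (Vec; []; _∷_; lookup)
  import Data.Vec.Properties as Vecₚ
  open import Data.Product using (∃-syntax; _,_; proj₁; proj₂; uncurry)
  open import Data.Sum using (_⊎_)
  open import Function using (_∘_)
  open import Relation.Nullary using (¬_; Dec; no; does; contradiction)
  open import Relation.Nullary.Decidable using (dec-true; dec-false; _⊎-dec_; _×-dec_; map′)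
  open import Relation.Binary.PropositionalEquality
  open import Algebra.Properties.CommutativeMonoid.Sum +-0-commutativeMonoid
    using (sum; sum-cong-≗; ∑-distrib-+; ∑-comm)
  open import Algebra.Properties.Semiring.Sum +-*-semiring using (*-distribʳ-sum)

  Point : ℕ → ℕ → Set
  Point L d = Vec (Fin L) d

  sumᵛ : ∀ {L} d → (Point L d → ℕ) → ℕ
  sumᵛ zero    f = f []
  sumᵛ (suc d) f = sum (λ z → sumᵛ d (λ y → f (z ∷ y)))

  sumᵛ-mono-≤ : ∀ {L} d {f g : Point L d → ℕ} → (∀ w → f w ≤ g w) → sumᵛ d f ≤ sumᵛ d g
  sumᵛ-mono-≤ zero    f≤g = f≤g []
  sumᵛ-mono-≤ (suc d) f≤g = sum-mono-≤ (λ z → sumᵛ-mono-≤ d (λ y → f≤g (z ∷ y)))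

  sumᵛ-cong : ∀ {L} d {f g : Point L d → ℕ} → (∀ w → f w ≡ g w) → sumᵛ d f ≡ sumᵛ d g
  sumᵛ-cong zero    eq = eq []
  sumᵛ-cong (suc d) eq = sum-cong-≗ (λ z → sumᵛ-cong d (λ y → eq (z ∷ y)))

  sumᵛ-const : ∀ L d c → sumᵛ {L} d (λ _ → c) ≡ L ^ d * c
  sumᵛ-const L zero    c = sym (*-identityˡ c)
  sumᵛ-const L (suc d) c = trans (sum-cong-≗ {L} (λ z → sumᵛ-const L d c))
    (trans (sum-const L (L ^ d * c)) (sym (*-assoc L (L ^ d) c)))

  sumᵛ-distrib-+ : ∀ {L} d (f g : Point L d → ℕ) → sumᵛ d (λ w → f w + g w) ≡ sumᵛ d f + sumᵛ d g
  sumᵛ-distrib-+ zero    f g = refl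
  sumᵛ-distrib-+ (suc d) f g = trans (sum-cong-≗ (λ z → sumᵛ-distrib-+ d (f ∘ (z ∷_)) (g ∘ (z ∷_))))
    (∑-distrib-+ (λ z → sumᵛ d (f ∘ (z ∷_))) (λ z → sumᵛ d (g ∘ (z ∷_))))

  sumᵛ-*ʳ : ∀ {L} d (f : Point L d → ℕ) c → sumᵛ d f * c ≡ sumᵛ d (λ w → f w * c)
  sumᵛ-*ʳ zero    f c = refl
  sumᵛ-*ʳ {L} (suc d) f c = trans (*-distribʳ-sum c (λ z → sumᵛ d (f ∘ (z ∷_))))
    (sum-cong-≗ {L} (λ z → sumᵛ-*ʳ d (f ∘ (z ∷_)) c))

  sumᵛ-sum-comm : ∀ {L n} d (f : Fin n → Point L d → ℕ) →
    sumᵛ d (λ w → sum (λ z → f z w)) ≡ sum (λ z → sumᵛ d (f z))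
  sumᵛ-sum-comm zero    f = refl
  sumᵛ-sum-comm (suc d) f = trans (sum-cong-≗ (λ x → sumᵛ-sum-comm d (λ z y → f z (x ∷ y)))) (∑-comm (λ x z → sumᵛ d (λ y → f z (x ∷ y))))

  sumᵛ<⇒term< : ∀ {L} d (f g : Point L d → ℕ) → sumᵛ d f < sumᵛ d g → ∃[ w ] f w < g w
  sumᵛ<⇒term< zero    f g lt = [] , lt
  sumᵛ<⇒term< (suc d) f g lt with z , lt′ ← sum<⇒term< _ _ lt
    with y , lt″ ← sumᵛ<⇒term< d (f ∘ (z ∷_)) (g ∘ (z ∷_)) lt′ = z ∷ y , lt″

  sumᵛ-positive : ∀ {L} d (f : Point L d → ℕ) → 0 < sumᵛ d f → ∃[ w ] 0 < f w
  sumᵛ-positive {L} d f p = sumᵛ<⇒term< d (λ _ → 0) f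
    (subst (_< sumᵛ d f) (sym (trans (sumᵛ-const L d 0) (*-zeroʳ (L ^ d)))) p)

  ♯ᵛ : ∀ {L} d → (Point L d → Bool) → ℕ
  ♯ᵛ d P = sumᵛ d (𝟙 ∘ P)

  pointIndex : ∀ {L d} → Point L d → Fin (L ^ d)
  pointIndex []      = zero
  pointIndex (z ∷ y) = combine z (pointIndex y)

  point : ∀ {L} d → Fin (L ^ d) → Point L d
  point zero        i = []
  point {L} (suc d) i with z , j ← remQuot {L} (L ^ d) i = z ∷ point d j

  point-pointIndex : ∀ {L d} (w : Point L d) → point d (pointIndex w) ≡ w
  point-pointIndex []                  = refl
  point-pointIndex {L} {suc d} (z ∷ y) =
    trans (cong (λ p → proj₁ p ∷ point d (proj₂ p)) (Finₚ.remQuot-combine {L} {L ^ d} z (pointIndex y)))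
      (cong (z ∷_) (point-pointIndex y))

  pointIndex-point : ∀ {L} d (i : Fin (L ^ d)) → pointIndex (point {L} d i) ≡ i
  pointIndex-point zero zero = refl
  pointIndex-point {L} (suc d) i = trans (cong (combine (proj₁ (remQuot {L} (L ^ d) i))) (pointIndex-point d (proj₂ (remQuot {L} (L ^ d) i))))
    (Finₚ.combine-remQuot {L} (L ^ d) i)

  sum-pointIndex : ∀ {L} d (f : Fin (L ^ d) → ℕ) → sum f ≡ sumᵛ d (f ∘ pointIndex)
  sum-pointIndex zero        f = +-identityʳ _
  sum-pointIndex {L} (suc d) f = trans (sum-combine L f) (sum-cong-≗ {L} (λ z → sum-pointIndex d (λ p → f (combine z p))))

  -- w′ = w + eᵢ
  data Step {L} : ∀ {d} → Fin d → Point L d → Point L d → Set where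
    here  : ∀ {d} {z z′} {y : Point L d} → toℕ z′ ≡ suc (toℕ z) → Step zero (z ∷ y) (z′ ∷ y)
    there : ∀ {d} {z i} {y y′ : Point L d} → Step i y y′ → Step (suc i) (z ∷ y) (z ∷ y′)

  point-≟ : ∀ {L d} (w w′ : Point L d) → Dec (w ≡ w′)
  point-≟ = Vecₚ.≡-dec Finₚ._≟_

  step? : ∀ {L d} i (w w′ : Point L d) → Dec (Step i w w′)
  step? zero    (z ∷ y) (z′ ∷ y′) = map′ (λ { (e , refl) → here e }) (λ { (here e) → e , refl })
    ((toℕ z′ ≟ suc (toℕ z)) ×-dec point-≟ y y′)
  step? (suc i) (z ∷ y) (z′ ∷ y′) = map′ (λ { (refl , s) → there s }) (λ { (there s) → refl , s })
    ((z Finₚ.≟ z′) ×-dec step? i y y′)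

  step-functional : ∀ {L d} {i} {w w₁ w₂ : Point L d} → Step i w w₁ → Step i w w₂ → w₁ ≡ w₂
  step-functional (here e)  (here e′)  = cong (_∷ _) (Finₚ.toℕ-injective (trans e (sym e′)))
  step-functional (there s) (there s′) = cong (_ ∷_) (step-functional s s′)

  step-lookup : ∀ {L d} {i} {w w′ : Point L d} → Step i w w′ → toℕ (lookup w′ i) ≡ suc (toℕ (lookup w i))
  step-lookup (here e)  = e
  step-lookup (there s) = step-lookup s

  step-lookup-≢ : ∀ {L d} {i j} {w w′ : Point L d} → Step i w w′ → i ≢ j → lookup w′ j ≡ lookup w j
  step-lookup-≢ {j = zero}  (here e)  i≢j = contradiction refl i≢j
  step-lookup-≢ {j = suc j} (here e)  i≢j = refl
  step-lookup-≢ {j = zero}  (there s) i≢j = refl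
  step-lookup-≢ {j = suc j} (there s) i≢j = step-lookup-≢ s (i≢j ∘ cong suc)

  module Subdivision (L d k : ℕ) where

    -- Arm i of the grid point w leads towards w + eᵢ; it is kept, dangling,
    -- even if w + eᵢ lies outside of the grid.
    data Vtx : Set where
      ctr : Point L d → Vtx
      arm : Point L d → Fin d → Fin k → Vtx

    basePoint : Vtx → Point L d
    basePoint (ctr w)     = w
    basePoint (arm w i x) = w

    -- Edges are oriented in the direction of increasing coordinates, and `graph` is the symmetric
    -- closure. The orientation is what later makes coordinates and positions along an edge move by
    -- at most one in a known direction.
    data Next : Vtx → Vtx → Set where
      leave : ∀ {w i x} → toℕ x ≡ 0 → Next (ctr w) (arm w i x)
      along : ∀ {w i x y} → toℕ y ≡ suc (toℕ x) → Next (arm w i x) (arm w i y)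
      enter : ∀ {w w′ i x} → suc (toℕ x) ≡ k → Step i w w′ → Next (arm w i x) (ctr w′)

    next? : ∀ a b → Dec (Next a b)
    next? (ctr w) (ctr w′) = no λ ()
    next? (ctr w) (arm w′ i x) = map′ (λ { (refl , e) → leave e }) (λ { (leave e) → refl , e })
      (point-≟ w w′ ×-dec (toℕ x ≟ 0))
    next? (arm w i x) (ctr w′) = map′ (λ { (e , s) → enter e s }) (λ { (enter e s) → e , s })
      ((suc (toℕ x) ≟ k) ×-dec step? i w w′)
    next? (arm w i x) (arm w′ i′ y) =
      map′ (λ { (refl , refl , e) → along e }) (λ { (along e) → refl , refl , e })
      (point-≟ w w′ ×-dec ((i Finₚ.≟ i′) ×-dec (toℕ y ≟ suc (toℕ x))))

    next-irrefl : ∀ {a} → ¬ Next a a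
    next-irrefl (along e) = contradiction e (<⇒≢ (n<1+n _))

    -- The dangling arms give all gadgets the same size 1 + dk, so sizes of unions of gadgets are
    -- plain products.
    order : ℕ
    order = L ^ d * suc (d * k)

    gadget : Point L d → Fin (suc (d * k)) → Vtx
    gadget w zero    = ctr w
    gadget w (suc j) = uncurry (arm w) (remQuot {d} k j)

    vtx : Fin order → Vtx
    vtx v = gadget (point d (proj₁ (remQuot {L ^ d} (suc (d * k)) v))) (proj₂ (remQuot {L ^ d} (suc (d * k)) v))

    vtxIndex : Vtx → Fin order
    vtxIndex (ctr w)     = combine (pointIndex w) zero
    vtxIndex (arm w i x) = combine (pointIndex w) (suc (combine i x))

    vtx-combine : ∀ w j → vtx (combine (pointIndex w) j) ≡ gadget w j
    vtx-combine w j = trans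
      (cong (λ p → gadget (point d (proj₁ p)) (proj₂ p)) (Finₚ.remQuot-combine {L ^ d} {suc (d * k)} (pointIndex w) j))
      (cong (λ w′ → gadget w′ j) (point-pointIndex w))

    vtx-vtxIndex : ∀ a → vtx (vtxIndex a) ≡ a
    vtx-vtxIndex (ctr w)     = vtx-combine w zero
    vtx-vtxIndex (arm w i x) = trans (vtx-combine w (suc (combine i x)))
      (cong (uncurry (arm w)) (Finₚ.remQuot-combine i x))

    gadget-index : ∀ w j → vtxIndex (gadget w j) ≡ combine (pointIndex w) j
    gadget-index w zero    = refl
    gadget-index w (suc j) = cong (combine (pointIndex w) ∘ suc) (Finₚ.combine-remQuot {d} k j)

    vtxIndex-vtx : ∀ v → vtxIndex (vtx v) ≡ v
    vtxIndex-vtx v = trans (gadget-index (point d p) j)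
      (trans (cong (λ q → combine q j) (pointIndex-point d p)) (Finₚ.combine-remQuot {L ^ d} (suc (d * k)) v))
      where
      p = proj₁ (remQuot {L ^ d} (suc (d * k)) v)
      j = proj₂ (remQuot {L ^ d} (suc (d * k)) v)

    vtx-injective : ∀ {u v} → vtx u ≡ vtx v → u ≡ v
    vtx-injective {u} {v} e = trans (sym (vtxIndex-vtx u)) (trans (cong vtxIndex e) (vtxIndex-vtx v))

    gadgetSum : (Vtx → ℕ) → Point L d → ℕ
    gadgetSum F w = F (ctr w) + sum (λ i → sum (λ x → F (arm w i x)))

    sum-vtx : ∀ (F : Vtx → ℕ) → sum (F ∘ vtx) ≡ sumᵛ d (gadgetSum F)
    sum-vtx F = trans (sum-combine (L ^ d) (F ∘ vtx))
      (trans (sum-pointIndex d (λ p → sum (λ j → F (vtx (combine p j)))))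
        (sumᵛ-cong d λ w → cong₂ _+_ (cong F (vtx-combine w zero))
          (trans (sum-combine d (λ j → F (vtx (combine (pointIndex w) (suc j)))))
            (sum-cong-≗ λ i → sum-cong-≗ λ x → cong F (vtx-vtxIndex (arm w i x))))))

    graph : Graph
    graph = mkGraph order (λ u v → does (next? (vtx u) (vtx v)) ∨ does (next? (vtx v) (vtx u)))
      (λ u v → Boolₚ.∨-comm (does (next? (vtx u) (vtx v))) _)
      (λ v → cong (λ b → b ∨ b) (dec-false (next? (vtx v) (vtx v)) next-irrefl))

    Joined : Vtx → Vtx → Set
    Joined a b = Next a b ⊎ Next b a

    adj⇒joined : ∀ {u v} → Adj graph u v → Joined (vtx u) (vtx v)
    adj⇒joined {u} {v} = does⇒ (next? (vtx u) (vtx v) ⊎-dec next? (vtx v) (vtx u))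

    joined⇒adj : ∀ {u v} → Joined (vtx u) (vtx v) → Adj graph u v
    joined⇒adj {u} {v} = dec-true (next? (vtx u) (vtx v) ⊎-dec next? (vtx v) (vtx u))

-- Balanced separators of the subdivided grid are large.

module SeparatorLowerBound where

  open Counting
  open Separation
  open SubdividedGrid
  open import Data.Bool using (Bool; true; false; not)
  import Data.Bool.Properties as Boolₚ
  open import Data.Nat
  open import Data.Nat.Properties
  open import Data.Fin as Fin using (Fin; zero; suc; toℕ; fromℕ<)
  import Data.Fin.Properties as Finₚ
  open import Data.Vec as Vec using (Vec; []; _∷_; lookup)
  import Data.Vec.Properties as Vecₚ
  open import Data.Product using (∃-syntax; _×_; _,_)
  open import Data.Sum using (_⊎_; inj₁; inj₂; swap)
  open import Data.Empty using (⊥)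
  open import Function using (_∘_)
  open import Relation.Nullary using (Dec; yes; no; does; contradiction)
  open import Relation.Nullary.Decidable using (dec-true)
  open import Relation.Binary.PropositionalEquality
  open import Algebra.Properties.CommutativeMonoid.Sum +-0-commutativeMonoid
    using (sum; sum-cong-≗; ∑-distrib-+)
  open import Algebra.Properties.Semiring.Sum +-*-semiring using (*-distribˡ-sum)
  open import Data.Nat.Tactic.RingSolver using (solve-∀)
  open import Data.Fin.Subset using (Subset; _∉_; ∣_∣)
  open import Relation.Binary.Construct.Closure.ReflexiveTransitive as Star
    using (Star; ε; _◅_; _◅◅_)
  open ≤-Reasoning

  reverse : ∀ {A : Set} {R : A → A → Set} → (∀ {a b} → R a b → R b a) → ∀ {a b} → Star R a b → Star R b a
  reverse sy ε       = ε
  reverse sy (r ◅ s) = reverse sy s ◅◅ (sy r ◅ ε)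

  AdjFree : ∀ {L d} → (Point L d → Bool) → Point L d → Point L d → Set
  AdjFree X w w′ = X w ≡ false × X w′ ≡ false × ∃[ i ] (Step i w w′ ⊎ Step i w′ w)

  adjFree-sym : ∀ {L d} {X : Point L d → Bool} {w w′} → AdjFree X w w′ → AdjFree X w′ w
  adjFree-sym (p , q , i , s) = q , p , i , swap s

  Linked : ∀ {L d} → (Point L d → Bool) → Point L d → Point L d → Set
  Linked X = Star (AdjFree X)

  linked-∷ : ∀ {L d} (X : Point L (suc d) → Bool) z {y y′} →
    Linked (λ y → X (z ∷ y)) y y′ → Linked X (z ∷ y) (z ∷ y′)
  linked-∷ X z = Star.gmap (z ∷_) λ
    { (p , q , i , inj₁ s) → p , q , suc i , inj₁ (there s)
    ; (p , q , i , inj₂ s) → p , q , suc i , inj₂ (there s) }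

  module _ {L d : ℕ} (X : Point L (suc d) → Bool) (y : Point L d) (free : ∀ z → X (z ∷ y) ≡ false) where

    line-up : ∀ n (z z′ : Fin L) → toℕ z′ ≡ n + toℕ z → Linked X (z ∷ y) (z′ ∷ y)
    line-up zero    z z′ e rewrite Finₚ.toℕ-injective e = ε
    line-up (suc n) z z′ e = line-up n z z″ (Finₚ.toℕ-fromℕ< lt) ◅◅
      ((free z″ , free z′ , zero , inj₁ (here (trans e (cong suc (sym (Finₚ.toℕ-fromℕ< lt)))))) ◅ ε)
      where
      lt : n + toℕ z < L
      lt = ≤-trans (≤-reflexive (sym e)) (<⇒≤ (Finₚ.toℕ<n z′))
      z″ = fromℕ< lt

    line : ∀ z z′ → Linked X (z ∷ y) (z′ ∷ y)
    line z z′ with ≤-total (toℕ z) (toℕ z′)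
    ... | inj₁ le = line-up (toℕ z′ ∸ toℕ z) z z′ (sym (m∸n+n≡m le))
    ... | inj₂ le = reverse adjFree-sym (line-up (toℕ z ∸ toℕ z′) z′ z (sym (m∸n+n≡m le)))

  -- Tuned to the induction in `grid`: slices must have cores of quality 2m, and the factor 2m keeps
  -- the share of slices with too many points of X below 1/(2m). The two losses add up to 1/m.
  η : ℕ → ℕ → ℕ
  η zero    m = 1
  η (suc d) m = 2 * m * η d (2 * m)

  η>0 : ∀ d {m} → 0 < m → 0 < η d m
  η>0 zero    _  = ≤-refl
  η>0 (suc d) {m} m>0 = *-mono-< {0} {2 * m} {0} 2m>0 (η>0 d 2m>0)
    where 2m>0 = ≤-trans m>0 (m≤n*m m 2)

  -- A discrete isoperimetric conclusion: away from X there is a pairwise linked set that misses at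
  -- most a 1/m share of the grid. The paths that link its points may leave the set but not enter X.
  record Core {L d} (m : ℕ) (X : Point L d → Bool) : Set where
    field
      member : Point L d → Bool
      large  : m * ♯ᵛ d (not ∘ member) ≤ L ^ d
      avoids : ∀ u → member u ≡ true → X u ≡ false
      linked : ∀ u v → member u ≡ true → member v ≡ true → Linked X u v

  -- Most slices z ∷_ contain a large core by induction, and since any two cores
  -- cover more than half of [L]^d each, some line joins them.
  module GridStep {L d m : ℕ} (2≤m : 2 ≤ m) (L>0 : 0 < L) (X : Point L (suc d) → Bool)
    (few : η (suc d) m * (L * ♯ᵛ (suc d) X) < L ^ suc d)
    (slice-core : ∀ z → η d (2 * m) * (L * ♯ᵛ d (λ y → X (z ∷ y))) < L ^ d →
                  Core (2 * m) (λ y → X (z ∷ y))) where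

    M = 2 * m
    4≤M : 4 ≤ M
    4≤M = *-monoʳ-≤ 2 2≤m
    η₁ = η d M
    count : Fin L → ℕ
    count z = ♯ᵛ d (λ y → X (z ∷ y))
    Good : Fin L → Set
    Good z = η₁ * (L * count z) < L ^ d
    core : ∀ z → Dec (Good z) → Point L d → Bool
    core z (yes p) = Core.member (slice-core z p)
    core z (no _)  = λ _ → false
    good? : ∀ z → Dec (Good z)
    good? z = η₁ * (L * count z) <? L ^ d
    C : Point L (suc d) → Bool
    C (z ∷ y) = core z (good? z) y

    core-avoids : ∀ z g y → core z g y ≡ true → X (z ∷ y) ≡ false
    core-avoids z (yes p) y c = Core.avoids (slice-core z p) y c
    avoids : ∀ u → C u ≡ true → X u ≡ false
    avoids (z ∷ y) c = core-avoids z (good? z) y c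

    core-large : ∀ z g y → core z g y ≡ true → M * ♯ᵛ d (not ∘ core z g) ≤ L ^ d
    core-large z (yes p) y c = Core.large (slice-core z p)

    core-linked : ∀ z g y y′ → core z g y ≡ true → core z g y′ ≡ true → Linked X (z ∷ y) (z ∷ y′)
    core-linked z (yes p) y y′ c c′ = linked-∷ X z (Core.linked (slice-core z p) y y′ c c′)

    -- A good slice is paid for by its large core. A bad slice has so many points of X that the
    -- second summand covers all of its L^d points.
    slice-bound : ∀ z g → M * ♯ᵛ d (not ∘ core z g) ≤ L ^ d + M * (η₁ * L) * count z
    slice-bound z (yes p) = ≤-trans (Core.large (slice-core z p)) (m≤m+n _ _)
    slice-bound z (no ¬p) = begin
      M * sumᵛ {L} d (λ _ → 1)  ≡⟨ cong (M *_) (trans (sumᵛ-const L d 1) (*-identityʳ _)) ⟩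
      M * L ^ d  ≤⟨ *-monoʳ-≤ M (≮⇒≥ ¬p) ⟩
      M * (η₁ * (L * count z))  ≡⟨ eq M η₁ L (count z) ⟩
      M * (η₁ * L) * count z  ≤⟨ m≤n+m _ _ ⟩
      L ^ d + M * (η₁ * L) * count z ∎
      where
      eq : ∀ a b c e → a * (b * (c * e)) ≡ a * (b * c) * e
      eq = solve-∀

    large : m * ♯ᵛ (suc d) (not ∘ C) ≤ L ^ suc d
    large = *-cancelˡ-≤ 2 (begin
      2 * (m * ♯ᵛ (suc d) (not ∘ C))  ≡⟨ *-assoc 2 m _ ⟨
      M * ♯ᵛ (suc d) (not ∘ C)  ≡⟨ *-distribˡ-sum M (λ z → ♯ᵛ d (not ∘ core z (good? z))) ⟩
      sum (λ z → M * ♯ᵛ d (not ∘ core z (good? z))) ≤⟨ sum-mono-≤ (λ z → slice-bound z (good? z)) ⟩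
      sum (λ z → L ^ d + c * count z)  ≡⟨ ∑-distrib-+ (λ _ → L ^ d) (λ z → c * count z) ⟩
      sum {L} (λ z → L ^ d) + sum (λ z → c * count z)
        ≡⟨ cong₂ _+_ (sum-const L (L ^ d)) (sym (*-distribˡ-sum c count)) ⟩
      L ^ suc d + c * ♯ᵛ (suc d) X  ≡⟨ cong (L ^ suc d +_) (eq M η₁ L (♯ᵛ (suc d) X)) ⟩
      L ^ suc d + η (suc d) m * (L * ♯ᵛ (suc d) X) ≤⟨ +-monoʳ-≤ (L ^ suc d) (<⇒≤ few) ⟩
      L ^ suc d + L ^ suc d  ≡⟨ cong (L ^ suc d +_) (+-identityʳ _) ⟨
      2 * L ^ suc d  ∎)
      where
      c = M * (η₁ * L)
      eq : ∀ a b l e → a * (b * l) * e ≡ a * b * (l * e)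
      eq = solve-∀

    hit : Point L d → Bool
    hit y = does (Finₚ.any? (λ z → X (z ∷ y) Boolₚ.≟ true))

    hit≤ : ♯ᵛ d hit ≤ ♯ᵛ (suc d) X
    hit≤ = begin
      ♯ᵛ d hit  ≤⟨ sumᵛ-mono-≤ d one ⟩
      sumᵛ d (λ y → sum (λ z → 𝟙 (X (z ∷ y))))  ≡⟨ sumᵛ-sum-comm d (λ z y → 𝟙 (X (z ∷ y))) ⟩
      ♯ᵛ (suc d) X  ∎
      where
      one : ∀ y → 𝟙 (hit y) ≤ sum (λ z → 𝟙 (X (z ∷ y)))
      one y with Finₚ.any? (λ z → X (z ∷ y) Boolₚ.≟ true)
      ... | no _ = z≤n
      ... | yes (z , e) = ≤-trans (≤-reflexive (cong 𝟙 (sym e))) (term≤sum (λ z → 𝟙 (X (z ∷ y))) z)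

    4X<L^d : 4 * ♯ᵛ (suc d) X < L ^ d
    4X<L^d = *-cancelˡ-< L _ _ (begin-strict
      L * (4 * ♯ᵛ (suc d) X)  ≡⟨ eq L (♯ᵛ (suc d) X) ⟩
      4 * 1 * (L * ♯ᵛ (suc d) X)  ≤⟨ *-monoˡ-≤ (L * ♯ᵛ (suc d) X) (*-mono-≤ 4≤M (η>0 d (≤-trans (s≤s z≤n) 4≤M))) ⟩
      η (suc d) m * (L * ♯ᵛ (suc d) X)  <⟨ few ⟩
      L * L ^ d  ∎)
      where
      eq : ∀ l x → l * (4 * x) ≡ 4 * 1 * (l * x)
      eq = solve-∀

    module _ (P Q : Point L d → Bool) where

      missing : Point L d → ℕ
      missing y = 𝟙 (not (P y)) + (𝟙 (not (Q y)) + 𝟙 (hit y))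

      missing-sum : sumᵛ d missing ≡ ♯ᵛ d (not ∘ P) + (♯ᵛ d (not ∘ Q) + ♯ᵛ d hit)
      missing-sum = trans (sumᵛ-distrib-+ d (𝟙 ∘ not ∘ P) (λ y → 𝟙 (not (Q y)) + 𝟙 (hit y)))
        (cong (♯ᵛ d (not ∘ P) +_) (sumᵛ-distrib-+ d (𝟙 ∘ not ∘ Q) (𝟙 ∘ hit)))

      4≤M-bound : ∀ x → M * x ≤ L ^ d → 4 * x ≤ L ^ d
      4≤M-bound x h = ≤-trans (*-monoˡ-≤ x 4≤M) h

      -- Each of the three ways to fail affects at most a quarter of the points y: the two cores
      -- because M ≥ 4, the lines through X because a point of X spoils only one line. Hence some y
      -- fails in no way.
      missing-few : M * ♯ᵛ d (not ∘ P) ≤ L ^ d → M * ♯ᵛ d (not ∘ Q) ≤ L ^ d →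
        sumᵛ d missing < sumᵛ {L} d (λ _ → 1)
      missing-few hP hQ = *-cancelˡ-< 4 _ _ (begin-strict
        4 * sumᵛ d missing  ≡⟨ cong (4 *_) missing-sum ⟩
        4 * (p + (q + h))  ≡⟨ eq p q h ⟩
        4 * p + (4 * q + 4 * h)  <⟨ +-mono-≤-< (4≤M-bound p hP) (+-mono-≤-< (4≤M-bound q hQ)
                                                                (≤-<-trans (*-monoʳ-≤ 4 hit≤) 4X<L^d)) ⟩
        L ^ d + (L ^ d + L ^ d)  ≤⟨ m≤n+m _ (L ^ d) ⟩
        L ^ d + (L ^ d + (L ^ d + L ^ d))  ≡⟨ eq₄ (L ^ d) ⟩
        4 * (L ^ d * 1)  ≡⟨ cong (4 *_) (sumᵛ-const L d 1) ⟨
        4 * sumᵛ {L} d (λ _ → 1)  ∎)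
        where
        p = ♯ᵛ d (not ∘ P)
        q = ♯ᵛ d (not ∘ Q)
        h = ♯ᵛ d hit
        eq : ∀ a b c → 4 * (a + (b + c)) ≡ 4 * a + (4 * b + 4 * c)
        eq = solve-∀
        eq₄ : ∀ a → a + (a + (a + a)) ≡ 4 * (a * 1)
        eq₄ = solve-∀

      common : M * ♯ᵛ d (not ∘ P) ≤ L ^ d → M * ♯ᵛ d (not ∘ Q) ≤ L ^ d →
        ∃[ y ] P y ≡ true × Q y ≡ true × hit y ≡ false
      common hP hQ =
        let y , lt = sumᵛ<⇒term< d missing (λ _ → 1) (missing-few hP hQ)
        in y , read (P y) (Q y) (hit y) lt
        where
        read : ∀ a b c → 𝟙 (not a) + (𝟙 (not b) + 𝟙 c) < 1 → a ≡ true × b ≡ true × c ≡ false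
        read true  true  false _ = refl , refl , refl
        read true  true  true  (s≤s ())
        read true  false c (s≤s ())
        read false b c (s≤s ())

    not-hit : ∀ y → hit y ≡ false → ∀ z → X (z ∷ y) ≡ false
    not-hit y h z with X (z ∷ y) in eq
    ... | false = refl
    ... | true  = contradiction (trans (sym (dec-true (Finₚ.any? (λ z → X (z ∷ y) Boolₚ.≟ true)) (z , eq))) h) λ ()

    linked : ∀ u v → C u ≡ true → C v ≡ true → Linked X u v
    linked (z ∷ a) (z′ ∷ b) ca cb =
      let g  = good? z
          g′ = good? z′
          y , cy , cy′ , h = common (core z g) (core z′ g′) (core-large z g a ca) (core-large z′ g′ b cb)
      in core-linked z g a y ca cy ◅◅ (line X y (not-hit y h) z z′ ◅◅ core-linked z′ g′ y b cy′ cb)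

  -- Induction on the dimension, applied to the slices with 2m in place of m. In dimension 0, L > 0
  -- and the hypothesis say that the only point is not in X.
  grid : ∀ {L} d m → 2 ≤ m → 0 < L → (X : Point L d → Bool) →
    η d m * (L * ♯ᵛ d X) < L ^ d → Core m X
  grid {L} zero m 2≤m L>0 X few = record
    { member = λ _ → true
    ; large  = ≤-trans (≤-reflexive (*-zeroʳ m)) z≤n
    ; avoids = free
    ; linked = λ { [] [] _ _ → ε }
    }
    where
    free : ∀ u → true ≡ true → X u ≡ false
    free [] _ with X []
    ... | false = refl
    ... | true  = contradiction few (≤⇒≯ (≤-trans L>0 (≤-reflexive (trans (sym (*-identityʳ L)) (sym (+-identityʳ (L * 1)))))))
  grid {L} (suc d) m 2≤m L>0 X few = record { member = C ; large = large ; avoids = avoids ; linked = linked }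
    where
    open GridStep 2≤m L>0 X few
      (λ z → grid d (2 * m) (≤-trans 2≤m (m≤n*m m 2)) L>0 (λ y → X (z ∷ y)))

  module _ {L d k : ℕ} (L>0 : 0 < L) (k>0 : 0 < k) where
    open Subdivision L d k

    module _ (X : Subset order) where

      Free : Vtx → Set
      Free a = lookup X (vtxIndex a) ≡ false

      Reach : Vtx → Vtx → Set
      Reach a b = Star (AdjAvoiding graph X) (vtxIndex a) (vtxIndex b)

      free⇒∉ : ∀ {a} → Free a → vtxIndex a ∉ X
      free⇒∉ f a∈ = contradiction (trans (sym (Vecₚ.[]=⇒lookup a∈)) f) λ ()

      edge : ∀ a b → Free a → Free b → Joined a b → Reach a b
      edge a b fa fb j = (free⇒∉ {a} fa , free⇒∉ {b} fb ,
        joined⇒adj (subst₂ Joined (sym (vtx-vtxIndex a)) (sym (vtx-vtxIndex b)) j)) ◅ ε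

      occupied : Point L d → ℕ
      occupied = gadgetSum (λ a → 𝟙 (lookup X (vtxIndex a)))

      -- Projects X to the grid. A vertex of X blocks only one point, while in an unblocked gadget
      -- all arms are intact, so that paths of grid points lift to paths in the subdivided grid.
      blocked : Point L d → Bool
      blocked w = does (0 <? occupied w)

      blocked≤ : ♯ᵛ d blocked ≤ ∣ X ∣
      blocked≤ = begin
        ♯ᵛ d blocked  ≤⟨ sumᵛ-mono-≤ d (λ w → 𝟙-<-≤ (occupied w)) ⟩
        sumᵛ d occupied  ≡⟨ sum-vtx (λ a → 𝟙 (lookup X (vtxIndex a))) ⟨
        sum (λ v → 𝟙 (lookup X (vtxIndex (vtx v)))) ≡⟨ sum-cong-≗ (λ v → cong (𝟙 ∘ lookup X) (vtxIndex-vtx v)) ⟩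
        ♯ (lookup X)  ≡⟨ ∣∣≡♯ X ⟨
        ∣ X ∣  ∎

      unoccupied : ∀ {w} → blocked w ≡ false → occupied w ≡ 0
      unoccupied {w} = 𝟙-<-false (occupied w)

      𝟙≡0 : ∀ {b} → 𝟙 b ≡ 0 → b ≡ false
      𝟙≡0 {false} _ = refl

      ctr-free : ∀ w → blocked w ≡ false → Free (ctr w)
      ctr-free w b = 𝟙≡0 (m+n≡0⇒m≡0 _ (unoccupied {w} b))

      arm-free : ∀ w → blocked w ≡ false → ∀ i x → Free (arm w i x)
      arm-free w b i x = 𝟙≡0 (n≤0⇒n≡0 (begin
        F i x  ≤⟨ term≤sum (F i) x ⟩
        sum (F i)  ≤⟨ term≤sum (λ i → sum (F i)) i ⟩
        sum (λ i → sum (F i))  ≡⟨ m+n≡0⇒n≡0 (𝟙 (lookup X (vtxIndex (ctr w)))) (unoccupied {w} b) ⟩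
        0  ∎))
        where
        F : Fin d → Fin k → ℕ
        F i x = 𝟙 (lookup X (vtxIndex (arm w i x)))

      along-arm : ∀ w → blocked w ≡ false → ∀ i n x → toℕ x ≡ n → Reach (ctr w) (arm w i x)
      along-arm w b i zero    x e = edge (ctr w) (arm w i x) (ctr-free w b) (arm-free w b i x) (inj₁ (leave e))
      along-arm w b i (suc n) x e = along-arm w b i n x′ (Finₚ.toℕ-fromℕ< lt) ◅◅
        edge (arm w i x′) (arm w i x) (arm-free w b i x′) (arm-free w b i x)
          (inj₁ (along (trans e (cong suc (sym (Finₚ.toℕ-fromℕ< lt))))))
        where
        lt : n < k
        lt = ≤-trans (≤-reflexive (sym e)) (<⇒≤ (Finₚ.toℕ<n x))
        x′ = fromℕ< lt

      reach-sym : ∀ a b → Reach a b → Reach b a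
      reach-sym a b = reverse (λ { {u} {v} (p , q , e) → q , p , trans (symm graph v u) e })

      step-reach : ∀ {w w′ i} → blocked w ≡ false → blocked w′ ≡ false → Step i w w′ → Reach (ctr w) (ctr w′)
      step-reach {w} {w′} {i} b b′ s = along-arm w b i (pred k) last eq ◅◅
        edge (arm w i last) (ctr w′) (arm-free w b i last) (ctr-free w′ b′) (inj₁ (enter (trans (cong suc eq) k≡) s))
        where
        k≡ : suc (pred k) ≡ k
        k≡ = suc-pred k {{>-nonZero k>0}}
        last = fromℕ< (≤-reflexive k≡)
        eq = Finₚ.toℕ-fromℕ< (≤-reflexive k≡)

      linked⇒reach : ∀ {w w′} → Linked blocked w w′ → Reach (ctr w) (ctr w′)
      linked⇒reach ε = ε
      linked⇒reach ((b , b′ , i , inj₁ s) ◅ r) = step-reach b b′ s ◅◅ linked⇒reach r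
      linked⇒reach (_◅_ {w} {w′} (b , b′ , i , inj₂ s) r) = reach-sym (ctr w′) (ctr w) (step-reach b′ b s) ◅◅ linked⇒reach r

      base-reach : ∀ a → blocked (basePoint a) ≡ false → Reach (ctr (basePoint a)) a
      base-reach (ctr w)     b = ε
      base-reach (arm w i x) b = along-arm w b i (toℕ x) x refl

    module _ (X : Subset order) (bal : IsBalancedSeparator graph X) (core : Core 4 (blocked X)) where
      open Core core renaming (member to C)
      private
        c s : ℕ
        c = ♯ᵛ d C
        s = suc (d * k)

      core-total : c + ♯ᵛ d (not ∘ C) ≡ L ^ d
      core-total = trans (sym (sumᵛ-distrib-+ d (𝟙 ∘ C) (𝟙 ∘ not ∘ C)))
        (trans (sumᵛ-cong d (λ w → 𝟙-not (C w))) (trans (sumᵛ-const L d 1) (*-identityʳ _)))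

      core-≥ : 3 * L ^ d ≤ 4 * c
      core-≥ = +-cancelʳ-≤ (L ^ d) _ _ (begin
        3 * L ^ d + L ^ d  ≡⟨ +-comm (3 * L ^ d) (L ^ d) ⟩
        4 * L ^ d  ≡⟨ cong (4 *_) core-total ⟨
        4 * (c + ♯ᵛ d (not ∘ C))  ≡⟨ *-distribˡ-+ 4 c _ ⟩
        4 * c + 4 * ♯ᵛ d (not ∘ C)  ≤⟨ +-monoʳ-≤ (4 * c) large ⟩
        4 * c + L ^ d  ∎)

      private
        P : Vtx → Bool
        P a = C (basePoint a)

      core-gadgets : ♯ (P ∘ vtx) ≡ c * s
      core-gadgets = trans (sum-vtx (𝟙 ∘ P)) (trans (sumᵛ-cong d gadget-size) (sym (sumᵛ-*ʳ d (𝟙 ∘ C) s)))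
        where
        gadget-size : ∀ w → gadgetSum (𝟙 ∘ P) w ≡ 𝟙 (C w) * s
        gadget-size w = trans
          (cong (𝟙 (C w) +_) (trans (sum-cong-≗ {d} (λ i → sum-const k (𝟙 (C w))))
            (trans (sum-const d (k * 𝟙 (C w))) (sym (*-assoc d k (𝟙 (C w)))))))
          (*-comm (suc (d * k)) (𝟙 (C w)))

      core-≤ : ∀ u → C u ≡ true → 3 * c ≤ 2 * L ^ d
      core-≤ u Cu = *-cancelʳ-≤ (3 * c) (2 * L ^ d) s (begin
        3 * c * s  ≡⟨ *-assoc 3 c s ⟩
        3 * (c * s)  ≡⟨ cong (3 *_) core-gadgets ⟨
        3 * ♯ (P ∘ vtx)  ≤⟨ *-monoʳ-≤ 3 (componentSize-≥ graph X (vtxIndex (ctr u)) (P ∘ vtx) reaches) ⟩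
        3 * componentSize graph X (vtxIndex (ctr u))
          ≤⟨ balanced⇒ graph bal (vtxIndex (ctr u)) (free⇒∉ X {ctr u} (ctr-free X u (avoids u Cu))) ⟩
        2 * (L ^ d * s)  ≡⟨ *-assoc 2 (L ^ d) s ⟨
        2 * L ^ d * s  ∎)
        where
        reaches : ∀ v → P (vtx v) ≡ true → Star (AdjAvoiding graph X) (vtxIndex (ctr u)) v
        reaches v Pv = subst (Star (AdjAvoiding graph X) (vtxIndex (ctr u))) (vtxIndex-vtx v)
          (linked⇒reach X (linked u (basePoint (vtx v)) Cu Pv) ◅◅ base-reach X (vtx v) (avoids (basePoint (vtx v)) Pv))

      -- The gadgets of the core lie in one component and make up at least 3/4 of all gadgets,
      -- whereas balance permits only 2/3: 9 L^d ≤ 12 c ≤ 8 L^d.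
      no-core : ⊥
      no-core with sumᵛ-positive d (𝟙 ∘ C) (*-cancelˡ-< 4 0 c (<-≤-trans (*-mono-< {0} {3} (s≤s z≤n) L^d>0) core-≥))
        where
        L^d>0 : 0 < L ^ d
        L^d>0 = >-nonZero⁻¹ (L ^ d) {{m^n≢0 L d {{>-nonZero L>0}}}}
      ... | u , Cu = <-irrefl refl (begin-strict
        8 * L ^ d  <⟨ *-monoˡ-< (L ^ d) {{m^n≢0 L d {{>-nonZero L>0}}}} (n<1+n 8) ⟩
        9 * L ^ d  ≡⟨ *-assoc 3 3 (L ^ d) ⟩
        3 * (3 * L ^ d)  ≤⟨ *-monoʳ-≤ 3 core-≥ ⟩
        3 * (4 * c)  ≡⟨ trans (sym (*-assoc 3 4 c)) (*-assoc 4 3 c) ⟩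
        4 * (3 * c)  ≤⟨ *-monoʳ-≤ 4 (core-≤ u (𝟙-positive Cu)) ⟩
        4 * (2 * L ^ d)  ≡⟨ *-assoc 4 2 (L ^ d) ⟨
        8 * L ^ d  ∎)

    -- Otherwise `grid` supplies a core; m = 4 is used because 1 - 1/4 exceeds the 2/3 of a balanced
    -- separator.
    separator-large : ∀ X → IsBalancedSeparator graph X → L ^ d ≤ η d 4 * (L * ∣ X ∣)
    separator-large X bal = ≮⇒≥ λ few → no-core X bal (grid d 4 (s≤s (s≤s z≤n)) L>0 (blocked X)
      (≤-<-trans (*-monoʳ-≤ (η d 4) (*-monoʳ-≤ L (blocked≤ X))) few))

-- Separators of subgraphs made of equally spaced hyperplanes.

module SeparatorUpperBound where

  open Counting
  open Separation
  open SubdividedGrid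
  open import Data.Bool using (Bool; true; false; if_then_else_)
  open import Data.Nat
  open import Data.Nat.Properties
  open import Data.Fin as Fin using (Fin; zero; suc; toℕ)
  import Data.Fin.Properties as Finₚ
  open import Data.Vec as Vec using (Vec; []; _∷_; lookup; tabulate)
  open import Data.Product using (∃-syntax; _×_; _,_; proj₁; proj₂)
  open import Data.Sum using (_⊎_; inj₁; inj₂)
  open import Function using (_∘_)
  open import Relation.Nullary using (Dec; yes; no; does; contradiction)
  open import Relation.Nullary.Decidable using (dec-true)
  open import Relation.Binary.PropositionalEquality
  open import Algebra.Properties.CommutativeMonoid.Sum +-0-commutativeMonoid using (sum; ∑-comm)
  open import Algebra.Properties.Semiring.Sum +-*-semiring using (*-distribˡ-sum; *-distribʳ-sum)
  open import Data.Nat.Tactic.RingSolver using (solve-∀)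
  open import Data.Fin.Subset using (Subset; _∉_; ∣_∣)
  open import Relation.Binary.Construct.Closure.ReflexiveTransitive as Star using (Star; ε; _◅_)
  open import Function.Definitions using (Injective)
  open import Data.Nat.DivMod
  open import Data.Nat.Divisibility using (_∣_; ∣m+n∣m⇒∣n; ∣⇒≤; m%n≡0⇒n∣m)
  open ≤-Reasoning

  -- Why hyperplanes at the multiples of ℓ separate: a coordinate that moves by one at a time cannot
  -- change its block of length ℓ without touching a multiple.
  same-block : ∀ a ℓ .{{_ : NonZero ℓ}} → suc a % ℓ ≢ 0 → suc a / ℓ ≡ a / ℓ
  same-block a ℓ nz with suc (a % ℓ) <? ℓ
  ... | yes lt = begin-equality
    suc a / ℓ  ≡⟨ cong (λ x → suc x / ℓ) (m≡m%n+[m/n]*n a ℓ) ⟩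
    (suc (a % ℓ) + a / ℓ * ℓ) / ℓ  ≡⟨ +-distrib-/-∣ʳ (suc (a % ℓ)) (Data.Nat.Divisibility.divides (a / ℓ) refl) ⟩
    suc (a % ℓ) / ℓ + a / ℓ * ℓ / ℓ  ≡⟨ cong₂ _+_ (m<n⇒m/n≡0 lt) (m*n/n≡m (a / ℓ) ℓ) ⟩
    a / ℓ  ∎
    where import Data.Nat.Divisibility
  ... | no ¬lt = contradiction (begin-equality
    suc a % ℓ  ≡⟨ cong (λ x → suc x % ℓ) (m≡m%n+[m/n]*n a ℓ) ⟩
    (suc (a % ℓ) + a / ℓ * ℓ) % ℓ  ≡⟨ [m+kn]%n≡m%n (suc (a % ℓ)) (a / ℓ) ℓ ⟩
    suc (a % ℓ) % ℓ  ≡⟨ cong (_% ℓ) (≤-antisym (m%n<n a ℓ) (≮⇒≥ ¬lt)) ⟩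
    ℓ % ℓ  ≡⟨ n%n≡0 ℓ ⟩
    0  ∎) nz

  block-near : ∀ a b ℓ .{{_ : NonZero ℓ}} → a / ℓ ≡ b / ℓ → a < b + ℓ
  block-near a b ℓ e = begin-strict
    a  ≡⟨ m≡m%n+[m/n]*n a ℓ ⟩
    a % ℓ + a / ℓ * ℓ  <⟨ +-monoˡ-< (a / ℓ * ℓ) (m%n<n a ℓ) ⟩
    ℓ + a / ℓ * ℓ  ≡⟨ cong (λ q → ℓ + q * ℓ) e ⟩
    ℓ + b / ℓ * ℓ  ≤⟨ +-monoʳ-≤ ℓ (m/n*n≤m b ℓ) ⟩
    ℓ + b  ≡⟨ +-comm ℓ b ⟩
    b + ℓ  ∎

  shift-≤ : ∀ a ℓ .{{_ : NonZero ℓ}} (c c′ : Fin ℓ) → toℕ c ≤ toℕ c′ →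
    (a + toℕ c) % ℓ ≡ 0 → (a + toℕ c′) % ℓ ≡ 0 → toℕ c ≡ toℕ c′
  shift-≤ a ℓ c c′ le p p′ with toℕ c′ ∸ toℕ c in eq
  ... | zero  = ≤-antisym le (m∸n≡0⇒m≤n eq)
  ... | suc δ = contradiction (∣⇒≤ {{_}} ℓ∣δ) (<⇒≱ (≤-<-trans (≤-reflexive (sym eq)) (≤-<-trans (m∸n≤m (toℕ c′) (toℕ c)) (Finₚ.toℕ<n c′))))
    where
    ℓ∣δ : ℓ ∣ suc δ
    ℓ∣δ = ∣m+n∣m⇒∣n (subst (ℓ ∣_) (trans (cong (a +_) (trans (sym (m+[n∸m]≡n le)) (cong (toℕ c +_) eq))) (sym (+-assoc a (toℕ c) (suc δ))))
             (m%n≡0⇒n∣m _ ℓ p′)) (m%n≡0⇒n∣m _ ℓ p)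

  -- The difference of the offsets would be a multiple of ℓ smaller than ℓ. Hence the ℓ shifted
  -- families of hyperplanes are disjoint.
  shift-unique : ∀ a ℓ .{{_ : NonZero ℓ}} (c c′ : Fin ℓ) →
    (a + toℕ c) % ℓ ≡ 0 → (a + toℕ c′) % ℓ ≡ 0 → c ≡ c′
  shift-unique a ℓ c c′ p p′ with ≤-total (toℕ c) (toℕ c′)
  ... | inj₁ le = Finₚ.toℕ-injective (shift-≤ a ℓ c c′ le p p′)
  ... | inj₂ le = sym (Finₚ.toℕ-injective (shift-≤ a ℓ c′ c le p′ p))

  ♯ᵛ-window : ∀ {L} d t (Q : Point L d → Bool) →
    (∀ w w′ → Q w ≡ true → Q w′ ≡ true → ∀ i → toℕ (lookup w i) ≤ toℕ (lookup w′ i) + t) →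
    ♯ᵛ d Q ≤ suc t ^ d
  ♯ᵛ-window zero    t Q near = 𝟙≤1 (Q [])
  ♯ᵛ-window {L} (suc d) t Q near = begin
    sum count  ≤⟨ sum-mono-≤ bound ⟩
    sum (λ z → 𝟙 (inhabited z) * suc t ^ d)  ≡⟨ *-distribʳ-sum (suc t ^ d) (𝟙 ∘ inhabited) ⟨
    ♯ inhabited * suc t ^ d  ≤⟨ *-monoˡ-≤ (suc t ^ d) (♯-window t inhabited near₀) ⟩
    suc t * suc t ^ d  ∎
    where
    count : Fin L → ℕ
    count z = ♯ᵛ d (λ y → Q (z ∷ y))
    inhabited : Fin L → Bool
    inhabited z = does (0 <? count z)
    witness : ∀ z → inhabited z ≡ true → ∃[ y ] Q (z ∷ y) ≡ true
    witness z p with y , q ← sumᵛ-positive d (λ y → 𝟙 (Q (z ∷ y))) (does⇒ (0 <? count z) p) = y , 𝟙-positive q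
    near₀ : ∀ z z′ → inhabited z ≡ true → inhabited z′ ≡ true → toℕ z ≤ toℕ z′ + t
    near₀ z z′ p p′ = near _ _ (proj₂ (witness z p)) (proj₂ (witness z′ p′)) zero
    bound : ∀ z → count z ≤ 𝟙 (inhabited z) * suc t ^ d
    bound z = ≤-𝟙-< (count z)
      (♯ᵛ-window d t (λ y → Q (z ∷ y)) (λ w w′ q q′ i → near (z ∷ w) (z ∷ w′) q q′ (suc i)))

  module _ {L d k : ℕ} where
    open Subdivision L d k

    -- Position in the lattice of mesh k + 1 that carries the subdivided grid; an inner vertex of an
    -- arm is displaced in the direction of the arm only.
    coord : Fin d → Vtx → ℕ
    coord i (ctr w)      = suc k * toℕ (lookup w i)
    coord i (arm w j x)  = suc k * toℕ (lookup w i) + (if does (i Finₚ.≟ j) then suc (toℕ x) else 0)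

    coord-next : ∀ {a b} → Next a b → ∀ i → coord i b ≡ coord i a ⊎ coord i b ≡ suc (coord i a)
    coord-next (leave {w} {j} {x} e) i with i Finₚ.≟ j
    ... | yes refl = inj₂ (trans (cong (λ n → suc k * toℕ (lookup w i) + suc n) e) (+-comm _ 1))
    ... | no _     = inj₁ (+-identityʳ _)
    coord-next (along {w} {j} {x} {y} e) i with i Finₚ.≟ j
    ... | yes refl = inj₂ (trans (cong (λ n → suc k * toℕ (lookup w i) + suc n) e) (+-suc _ _))
    ... | no _     = inj₁ refl
    coord-next (enter {w} {w′} {j} {x} e s) i with i Finₚ.≟ j
    ... | yes refl = inj₂ (begin-equality
      suc k * toℕ (lookup w′ i)  ≡⟨ cong (suc k *_) (step-lookup s) ⟩
      suc k * suc (toℕ (lookup w i))  ≡⟨ *-suc (suc k) _ ⟩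
      suc k + suc k * toℕ (lookup w i)  ≡⟨ +-comm (suc k) _ ⟩
      suc k * toℕ (lookup w i) + suc k  ≡⟨ cong (λ n → suc k * toℕ (lookup w i) + suc n) e ⟨
      suc k * toℕ (lookup w i) + suc (suc (toℕ x)) ≡⟨ +-suc _ _ ⟩
      suc (suc k * toℕ (lookup w i) + suc (toℕ x)) ∎)
    ... | no i≢j   = inj₁ (trans (cong (λ z → suc k * toℕ z) (step-lookup-≢ s (i≢j ∘ sym))) (sym (+-identityʳ _)))

    coord-arm : ∀ w i x → coord i (arm w i x) ≡ suc k * toℕ (lookup w i) + suc (toℕ x)
    coord-arm w i x rewrite dec-true (i Finₚ.≟ i) refl = refl

    coord-≥ : ∀ i a → suc k * toℕ (lookup (basePoint a) i) ≤ coord i a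
    coord-≥ i (ctr w)     = ≤-refl
    coord-≥ i (arm w j x) = m≤m+n _ _

    coord-≤ : ∀ i a → coord i a ≤ suc k * toℕ (lookup (basePoint a) i) + k
    coord-≤ i (ctr w)     = m≤m+n _ _
    coord-≤ i (arm w j x) = +-monoʳ-≤ _ (offset (does (i Finₚ.≟ j)))
      where
      offset : ∀ b → (if b then suc (toℕ x) else 0) ≤ k
      offset true  = Finₚ.toℕ<n x
      offset false = z≤n

    -- A box of side ℓ meets at most (t + 1)^d gadgets, and in each of them the centre and at most ξ
    -- vertices per arm. The bound ξ is the length k of an arm for wide boxes and the side ℓ for
    -- boxes narrower than an arm.
    box-size : ∀ (P : Vtx → Bool) ℓ t ξ → 0 < ℓ → ℓ ≤ suc k * t → k ≤ ξ ⊎ ℓ ≤ ξ →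
      (∀ a b → P a ≡ true → P b ≡ true → ∀ i → coord i a < coord i b + ℓ) →
      ♯ (P ∘ vtx) ≤ suc t ^ d * suc (d * ξ)
    box-size P ℓ t ξ ℓ>0 ℓ≤ arms near = begin
      ♯ (P ∘ vtx)  ≡⟨ sum-vtx (𝟙 ∘ P) ⟩
      sumᵛ d inGadget  ≤⟨ sumᵛ-mono-≤ d bound ⟩
      sumᵛ d (λ w → 𝟙 (inhabited w) * suc (d * ξ))  ≡⟨ sumᵛ-*ʳ d (𝟙 ∘ inhabited) (suc (d * ξ)) ⟨
      ♯ᵛ d inhabited * suc (d * ξ)  ≤⟨ *-monoˡ-≤ (suc (d * ξ)) (♯ᵛ-window d t inhabited near₀) ⟩
      suc t ^ d * suc (d * ξ)  ∎
      where
      inGadget : Point L d → ℕ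
      inGadget = gadgetSum (𝟙 ∘ P)
      inhabited : Point L d → Bool
      inhabited w = does (0 <? inGadget w)
      witness : ∀ w → 0 < inGadget w → ∃[ a ] basePoint a ≡ w × P a ≡ true
      witness w p with P (ctr w) in eq
      ... | true  = ctr w , refl , eq
      ... | false with i , q ← sum-positive (λ i → sum (λ x → 𝟙 (P (arm w i x)))) p
        with x , r ← sum-positive (λ x → 𝟙 (P (arm w i x))) q = arm w i x , refl , 𝟙-positive r
      near₀ : ∀ w w′ → inhabited w ≡ true → inhabited w′ ≡ true → ∀ i →
        toℕ (lookup w i) ≤ toℕ (lookup w′ i) + t
      near₀ w w′ p p′ i with witness w (does⇒ (0 <? inGadget w) p) | witness w′ (does⇒ (0 <? inGadget w′) p′)
      ... | a , refl , Pa | b , refl , Pb = s≤s⁻¹ (*-cancelˡ-< (suc k) _ _ (begin-strict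
        suc k * toℕ (lookup (basePoint a) i)  ≤⟨ coord-≥ i a ⟩
        coord i a  <⟨ near a b Pa Pb i ⟩
        coord i b + ℓ  ≤⟨ +-mono-≤ (coord-≤ i b) ℓ≤ ⟩
        suc k * z + k + suc k * t  ≤⟨ +-monoˡ-≤ (suc k * t) (+-monoʳ-≤ (suc k * z) (n≤1+n k)) ⟩
        suc k * z + suc k + suc k * t  ≡⟨ eq (suc k) z t ⟩
        suc k * suc (z + t)  ∎))
        where
        z = toℕ (lookup (basePoint b) i)
        eq : ∀ K z t → K * z + K + K * t ≡ K * suc (z + t)
        eq = solve-∀
      arm-bound : ∀ w i → k ≤ ξ ⊎ ℓ ≤ ξ → ♯ (λ x → P (arm w i x)) ≤ ξ
      arm-bound w i (inj₁ k≤ξ) = ≤-trans (♯≤n _) k≤ξ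
      arm-bound w i (inj₂ ℓ≤ξ) = ≤-trans (♯-window (pred ℓ) (λ x → P (arm w i x)) close) (≤-trans (≤-reflexive ℓ≡) ℓ≤ξ)
        where
        ℓ≡ : suc (pred ℓ) ≡ ℓ
        ℓ≡ = suc-pred ℓ {{>-nonZero ℓ>0}}
        close : ∀ x y → P (arm w i x) ≡ true → P (arm w i y) ≡ true → toℕ x ≤ toℕ y + pred ℓ
        close x y Px Py = s≤s⁻¹ (s≤s⁻¹ (+-cancelˡ-< (suc k * toℕ (lookup w i)) _ _ (begin-strict
          c + suc (toℕ x)  ≡⟨ coord-arm w i x ⟨
          coord i (arm w i x)  <⟨ near _ _ Px Py i ⟩
          coord i (arm w i y) + ℓ  ≡⟨ cong₂ _+_ (coord-arm w i y) (sym ℓ≡) ⟩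
          c + suc (toℕ y) + suc (pred ℓ)  ≡⟨ eq c (toℕ y) (pred ℓ) ⟩
          c + suc (suc (toℕ y + pred ℓ))  ∎)))
          where
          c = suc k * toℕ (lookup w i)
          eq : ∀ c y p → c + suc y + suc p ≡ c + suc (suc (y + p))
          eq = solve-∀
      bound : ∀ w → inGadget w ≤ 𝟙 (inhabited w) * suc (d * ξ)
      bound w = ≤-𝟙-< (inGadget w) (+-mono-≤ (𝟙≤1 (P (ctr w)))
        (≤-trans (sum-mono-≤ (λ i → arm-bound w i arms)) (≤-reflexive (sum-const d ξ))))

    module _ (G : Graph) (f : V G → V graph) (f-inj : Injective _≡_ _≡_ f)
             (f-adj : ∀ u v → Adj G u v → Adj graph (f u) (f v)) where

      private n = ∣V∣ G

      -- All ℓ offsets together cut every vertex at most once, so an average offset cuts at most n /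
      -- ℓ vertices.
      shift : ∀ ℓ .{{_ : NonZero ℓ}} (i : Fin d) → ∃[ c ]
        ℓ * ♯ {n} (λ v → does ((coord i (vtx (f v)) + toℕ {ℓ} c) % ℓ ≟ 0)) ≤ n
      shift ℓ i with c , h ← average {ℓ} (λ c → ♯ {n} (λ v → does ((coord i (vtx (f v)) + toℕ c) % ℓ ≟ 0))) (>-nonZero⁻¹ ℓ) =
        c , ≤-trans h (begin
          sum (λ c → sum (λ v → 𝟙 (onPlane c v)))  ≡⟨ ∑-comm (λ c v → 𝟙 (onPlane c v)) ⟩
          sum (λ v → ♯ (λ c → onPlane c v))  ≤⟨ sum-mono-≤ (λ v → ♯-unique (λ c → onPlane c v) (λ c c′ p p′ →
              shift-unique (coord i (vtx (f v))) ℓ c c′ (does⇒ (_ ≟ 0) p) (does⇒ (_ ≟ 0) p′))) ⟩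
          sum {n} (λ v → 1)  ≡⟨ trans (sum-const n 1) (*-identityʳ n) ⟩
          n  ∎)
        where
        onPlane : Fin ℓ → Fin n → Bool
        onPlane c v = does ((coord i (vtx (f v)) + toℕ c) % ℓ ≟ 0)

      -- In each direction, remove every ℓ-th hyperplane; the offsets are chosen
      -- so that at most n / ℓ vertices are lost per direction.
      slab-separator : ∀ ℓ t ξ → 0 < ℓ → ℓ ≤ suc k * t → k ≤ ξ ⊎ ℓ ≤ ξ →
        3 * (suc t ^ d * suc (d * ξ)) ≤ 2 * n →
        ∃[ X ] IsBalancedSeparator G X × ℓ * ∣ X ∣ ≤ d * n
      slab-separator ℓ t ξ ℓ>0 ℓ≤ arms fits = X , balanced⇐ G bal , size
        where
        instance
          ℓ≢0 : NonZero ℓ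
          ℓ≢0 = >-nonZero ℓ>0
        c : Fin d → ℕ
        c i = toℕ (proj₁ (shift ℓ i))
        pos : Fin d → Fin n → ℕ
        pos i v = coord i (vtx (f v)) + c i
        cut? : ∀ v → Dec (∃[ i ] pos i v % ℓ ≡ 0)
        cut? v = Finₚ.any? (λ i → pos i v % ℓ ≟ 0)
        X : Subset n
        X = tabulate (λ v → does (cut? v))
        size : ℓ * ∣ X ∣ ≤ d * n
        size = begin
          ℓ * ∣ X ∣  ≡⟨ cong (ℓ *_) (∣tabulate∣ (λ v → does (cut? v))) ⟩
          ℓ * ♯ (λ v → does (cut? v))  ≤⟨ *-monoʳ-≤ ℓ (sum-mono-≤ union) ⟩
          ℓ * sum (λ v → sum (λ i → 𝟙 (does (pos i v % ℓ ≟ 0)))) ≡⟨ cong (ℓ *_) (∑-comm (λ v i → 𝟙 (does (pos i v % ℓ ≟ 0)))) ⟩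
          ℓ * sum (λ i → ♯ (λ v → does (pos i v % ℓ ≟ 0)))  ≡⟨ *-distribˡ-sum ℓ (λ i → ♯ (λ v → does (pos i v % ℓ ≟ 0))) ⟩
          sum (λ i → ℓ * ♯ (λ v → does (pos i v % ℓ ≟ 0)))  ≤⟨ sum-mono-≤ (λ i → proj₂ (shift ℓ i)) ⟩
          sum {d} (λ i → n)  ≡⟨ sum-const d n ⟩
          d * n  ∎
          where
          union : ∀ v → 𝟙 (does (cut? v)) ≤ sum (λ i → 𝟙 (does (pos i v % ℓ ≟ 0)))
          union v with cut? v
          ... | no _        = z≤n
          ... | yes (i , e) = ≤-trans (≤-reflexive (cong 𝟙 (sym (dec-true (pos i v % ℓ ≟ 0) e))))
                                (term≤sum (λ i → 𝟙 (does (pos i v % ℓ ≟ 0))) i)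
        uncut : ∀ {v} → v ∉ X → ∀ i → pos i v % ℓ ≢ 0
        uncut {v} v∉X i e = v∉X (∈-tabulate⁺ (λ v → does (cut? v)) (dec-true (cut? v) (i , e)))
        step-block : ∀ i {a b} → coord i b ≡ coord i a ⊎ coord i b ≡ suc (coord i a) →
          (coord i b + c i) % ℓ ≢ 0 → (coord i b + c i) / ℓ ≡ (coord i a + c i) / ℓ
        step-block i (inj₁ e) nz = cong (λ y → (y + c i) / ℓ) e
        step-block i {a} {b} (inj₂ e) nz = trans (cong (λ y → (y + c i) / ℓ) e)
          (same-block (coord i a + c i) ℓ (λ z → nz (trans (cong (λ y → (y + c i) % ℓ) e) z)))
        block : ∀ {u v} → Star (AdjAvoiding G X) u v → ∀ i → pos i v / ℓ ≡ pos i u / ℓ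
        block ε i = refl
        block (_◅_ {u} {v} (u∉ , v∉ , e) r) i = trans (block r i) (one (adj⇒joined (f-adj u v e)))
          where
          -- `step-block` requires the end with the larger coordinate to avoid the hyperplanes: v
          -- for one orientation of the edge, u for the other.
          one : Joined (vtx (f u)) (vtx (f v)) → pos i v / ℓ ≡ pos i u / ℓ
          one (inj₁ nx) = step-block i {vtx (f u)} {vtx (f v)} (coord-next nx i) (uncut v∉ i)
          one (inj₂ nx) = sym (step-block i {vtx (f v)} {vtx (f u)} (coord-next nx i) (uncut u∉ i))
        bal : ∀ u → u ∉ X → 3 * componentSize G X u ≤ 2 * n
        bal u u∉X = ≤-trans (*-monoʳ-≤ 3 (begin
          componentSize G X u  ≤⟨ componentSize-≤ G X u (P ∘ vtx ∘ f) (λ v r → dec-true (P? (vtx (f v))) (block r)) ⟩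
          ♯ (P ∘ vtx ∘ f)  ≤⟨ ♯-injective f f-inj (P ∘ vtx) ⟩
          ♯ (P ∘ vtx)  ≤⟨ box-size P ℓ t ξ ℓ>0 ℓ≤ arms near ⟩
          suc t ^ d * suc (d * ξ)  ∎)) fits
          where
          P? : ∀ a → Dec (∀ i → (coord i a + c i) / ℓ ≡ pos i u / ℓ)
          P? a = Finₚ.all? (λ i → (coord i a + c i) / ℓ ≟ pos i u / ℓ)
          P : Vtx → Bool
          P a = does (P? a)
          near : ∀ a b → P a ≡ true → P b ≡ true → ∀ i → coord i a < coord i b + ℓ
          near a b Pa Pb i = +-cancelʳ-< (c i) _ _ (begin-strict
            coord i a + c i  <⟨ block-near _ _ ℓ (trans (does⇒ (P? a) Pa i) (sym (does⇒ (P? b) Pb i))) ⟩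
            coord i b + c i + ℓ  ≡⟨ eq (coord i b) (c i) ℓ ⟩
            coord i b + ℓ + c i  ∎)
            where
            eq : ∀ a b c → a + b + c ≡ a + c + b
            eq = solve-∀

-- Edge counts of shallow minors, by labelling the edges.

module ShallowMinors where

  open Counting
  open Separation
  open SubdividedGrid
  open import Data.Bool using (true)
  import Data.Bool.Properties as Boolₚ
  open import Data.Nat
  open import Data.Nat.Properties
  open import Data.Fin as Fin using (Fin; zero; suc; toℕ; combine)
  import Data.Fin.Properties as Finₚ
  open import Relation.Binary using (tri<; tri≈; tri>)
  open import Function.Bundles using (Equivalence)
  open import Data.Fin using (#_)
  open import Data.Vec as Vec using (Vec; _∷_; lookup)
  open import Data.Product using (∃; ∃₂; ∃-syntax; Σ-syntax; _×_; _,_; proj₁; proj₂)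
  open import Data.Sum using (_⊎_; inj₁; inj₂)
  open import Function using (_∘_)
  open import Relation.Nullary using (¬_; Dec; yes; no; contradiction)
  open import Relation.Nullary.Decidable using (_×-dec_)
  open import Relation.Binary.PropositionalEquality
  open import Data.Fin.Subset using (_∈_)
  open import Relation.Binary.Construct.Closure.ReflexiveTransitive as Star using (Star; ε; _◅_)
  open import Function.Definitions using (Injective)
  open import Data.List as List using (List; length; filter; cartesianProduct; allFin)
  open import Data.List.Relation.Unary.All as All using (All)
  open import Data.List.Relation.Unary.AllPairs using (_∷_)
  open import Data.List.Relation.Unary.Unique.Propositional using (Unique)
  open import Data.List.Relation.Unary.Unique.Propositional.Properties
    using (filter⁺; cartesianProduct⁺; allFin⁺)
  import Data.List.Membership.Propositional.Properties as Memₚ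
  open ≤-Reasoning

  lookup-unique : ∀ {A : Set} {xs : List A} → Unique xs → Injective _≡_ _≡_ (List.lookup xs)
  lookup-unique (x∉ ∷ u) {zero}  {zero}  e = refl
  lookup-unique (x∉ ∷ u) {zero}  {suc j} e = contradiction e (All.lookup x∉ (Memₚ.∈-lookup j))
  lookup-unique (x∉ ∷ u) {suc i} {zero}  e = contradiction (sym e) (All.lookup x∉ (Memₚ.∈-lookup i))
  lookup-unique (x∉ ∷ u) {suc i} {suc j} e = cong suc (lookup-unique u e)

  -- The edges are listed without repetition as ordered pairs, so labels that determine the pair
  -- inject them into `Fin M`. As `Lab` is a relation, a label can carry its justification.
  ∣E∣≤labels : ∀ (H : Graph) {A : Set} {M} (enc : A → Fin M) → Injective _≡_ _≡_ enc →
    (Lab : V H → V H → A → Set) →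
    (∀ x y → toℕ x < toℕ y → Adj H x y → ∃ (Lab x y)) →
    (∀ {x y x′ y′ l} → toℕ x < toℕ y → toℕ x′ < toℕ y′ → Lab x y l → Lab x′ y′ l → x ≡ x′ × y ≡ y′) →
    ∣E∣ H ≤ M
  ∣E∣≤labels H enc enc-inj Lab label unique = Finₚ.injective⇒≤ {f = enc ∘ lab} inj
    where
    E? : ∀ (e : V H × V H) → Dec (toℕ (proj₁ e) < toℕ (proj₂ e) × Adj H (proj₁ e) (proj₂ e))
    E? (u , v) = (u Fin.<? v) ×-dec (adj H u v Boolₚ.≟ true)
    pairs edges : List (V H × V H)
    pairs = cartesianProduct (allFin (∣V∣ H)) (allFin (∣V∣ H))
    edges = filter E? pairs
    edge : ∀ j → let (x , y) = List.lookup edges j in toℕ x < toℕ y × Adj H x y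
    edge j = proj₂ (Memₚ.∈-filter⁻ E? {xs = pairs} (Memₚ.∈-lookup {xs = edges} j))
    labelled : ∀ j → ∃ (Lab (proj₁ (List.lookup edges j)) (proj₂ (List.lookup edges j)))
    labelled j = label _ _ (proj₁ (edge j)) (proj₂ (edge j))
    lab : Fin (length edges) → _
    lab = proj₁ ∘ labelled
    inj : Injective _≡_ _≡_ (enc ∘ lab)
    inj {i} {j} e = lookup-unique {xs = edges}
      (filter⁺ E? (cartesianProduct⁺ (allFin⁺ (∣V∣ H)) (allFin⁺ (∣V∣ H))))
      (let p , q = unique (proj₁ (edge i)) (proj₁ (edge j)) (proj₂ (labelled i))
                     (subst (Lab _ _) (sym (enc-inj e)) (proj₂ (labelled j)))
       in cong₂ _,_ p q)

  ∣E∣≤∣V∣² : ∀ H → ∣E∣ H ≤ ∣V∣ H * ∣V∣ H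
  ∣E∣≤∣V∣² H = ∣E∣≤labels H {V H × V H} (λ { (x , y) → combine x y })
    (λ { {x , y} {x′ , y′} e → let p , q = Finₚ.combine-injective x y x′ y′ e in cong₂ _,_ p q })
    (λ x y l → l ≡ (x , y)) (λ x y _ _ → (x , y) , refl)
    (λ { _ _ refl refl → refl , refl })

  module _ {A : Set} {R : A → A → Set} where

    walk-weaken : ∀ {m a b} n → WalkAtMost R m a b → WalkAtMost R (n + m) a b
    walk-weaken zero    w = w
    walk-weaken (suc n) w = one (walk-weaken n w)
      where
      one : ∀ {m a b} → WalkAtMost R m a b → WalkAtMost R (suc m) a b
      one here       = here
      one (step r w) = step r (one w)

    walk-++ : ∀ {m n a b c} → WalkAtMost R m a b → WalkAtMost R n b c → WalkAtMost R (m + n) a c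
    walk-++ {m}     here       w′ = walk-weaken m w′
    walk-++ (step r w) w′ = step r (walk-++ w w′)

    walk-reverse : (∀ {a b} → R a b → R b a) → ∀ {m a b} → WalkAtMost R m a b → WalkAtMost R m b a
    walk-reverse sy here = here
    walk-reverse sy {suc m} {a} {b} (step r w) = subst (λ n → WalkAtMost R n b a) (+-comm m 1)
      (walk-++ (walk-reverse sy w) (step (sy r) (here {k = 0})))

    walk⇒star : ∀ {m a b} → WalkAtMost R m a b → Star R a b
    walk⇒star here       = ε
    walk⇒star (step r w) = r ◅ walk⇒star w

  ↑ˡ≢↑ʳ : ∀ {m n} (a : Fin m) (b : Fin n) → a Fin.↑ˡ n ≢ m Fin.↑ʳ b
  ↑ˡ≢↑ʳ (suc a) b e = ↑ˡ≢↑ʳ a b (Finₚ.suc-injective e)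

  module Minors (L d k : ℕ) where
    open Subdivision L d k

    -- Position p on the subdivided edge from w to w + eᵢ; the ends are at 0 and suc k.
    data At (w : Point L d) (i : Fin d) (p : ℕ) : Vtx → Set where
      origin : p ≡ 0 → At w i p (ctr w)
      inner : ∀ {x} → p ≡ suc (toℕ x) → At w i p (arm w i x)
      end   : ∀ {w′} → p ≡ suc k → Step i w w′ → At w i p (ctr w′)

    data IsCentre : Vtx → Set where
      centre : ∀ {w} → IsCentre (ctr w)

    isCentre? : ∀ a → Dec (IsCentre a)
    isCentre? (ctr w)     = yes centre
    isCentre? (arm w i x) = no λ ()

    next-at : ∀ {a b} → Next a b →
      Σ[ w ∈ Point L d ] Σ[ i ∈ Fin d ] ∃[ p ] p ≤ k × At w i p a × At w i (suc p) b
    next-at (leave {w} {i} e)     = w , i , 0 , z≤n , origin refl , inner (cong suc (sym e))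
    next-at (along {w} {i} {x} e) = w , i , suc (toℕ x) , Finₚ.toℕ<n x , inner refl , inner (cong suc (sym e))
    next-at (enter {w} {i = i} {x} e s) = w , i , suc (toℕ x) , Finₚ.toℕ<n x , inner refl , end (cong suc e) s

    private
      x≢k : ∀ {x : Fin k} {p} → p ≡ suc (toℕ x) → p ≢ suc k
      x≢k {x} e e′ = <⇒≢ (Finₚ.toℕ<n x) (suc-injective (trans (sym e) e′))

    at-unique : ∀ {w i p a b} → At w i p a → At w i p b → a ≡ b
    at-unique (origin _)  (origin _)    = refl
    at-unique (origin e)  (inner e′)   = contradiction (trans (sym e) e′) λ ()
    at-unique (origin e)  (end e′ _)   = contradiction (trans (sym e) e′) λ ()
    at-unique (inner e)  (origin e′)   = contradiction (trans (sym e′) e) λ ()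
    at-unique (inner e)  (inner e′)   = cong (arm _ _) (Finₚ.toℕ-injective (suc-injective (trans (sym e) e′)))
    at-unique (inner {x} e) (end e′ _) = contradiction e′ (x≢k {x} e)
    at-unique (end e _)  (origin e′)   = contradiction (trans (sym e′) e) λ ()
    at-unique (end e _)  (inner {x} e′) = contradiction e (x≢k {x} e′)
    at-unique (end _ s)  (end _ s′)   = cong ctr (step-functional s s′)

    at-zero : ∀ {w i a} → At w i 0 a → IsCentre a
    at-zero (origin _) = centre

    at-last : ∀ {w i a} → At w i (suc k) a → IsCentre a
    at-last (inner {x} e) = contradiction refl (x≢k {x} e)
    at-last (end _ _)     = centre

    at-interior : ∀ {w i p a} → 1 ≤ p → p ≤ k → At w i p a → ¬ IsCentre a
    at-interior () p≤k (origin refl)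
    at-interior 1≤p p≤k (inner _) ()
    at-interior 1≤p p≤k (end refl _) _ = contradiction p≤k (<⇒≱ (n<1+n k))

    at-≤ : ∀ {w i p a} → At w i p a → p ≤ suc k
    at-≤ (origin refl)      = z≤n
    at-≤ (inner {x} refl)  = ≤-trans (Finₚ.toℕ<n x) (n≤1+n k)
    at-≤ (end refl _)      = ≤-refl

    -- Centres have to be excluded, since one centre may lie on several subdivided edges.
    at-injective : ∀ {w w′ i i′ p p′ a} → ¬ IsCentre a → At w i p a → At w′ i′ p′ a →
      w ≡ w′ × i ≡ i′ × p ≡ p′
    at-injective ¬c (origin _) _         = contradiction centre ¬c
    at-injective ¬c (end _ _) _         = contradiction centre ¬c
    at-injective ¬c (inner e) (inner e′) = refl , refl , trans e (sym e′)

    at-next : ∀ {w i p a b} → ¬ IsCentre a → At w i p a → Next a b → At w i (suc p) b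
    at-next ¬c (origin _) _           = contradiction centre ¬c
    at-next ¬c (end _ _) _           = contradiction centre ¬c
    at-next ¬c (inner e) (along e′)  = inner (cong suc (trans e (sym e′)))
    at-next ¬c (inner e) (enter e′ s) = end (cong suc (trans e e′)) s

    at-prev : ∀ {w i p a b} → ¬ IsCentre a → At w i (suc p) a → Next b a → At w i p b
    at-prev ¬c (origin _) _           = contradiction centre ¬c
    at-prev ¬c (end _ _) _           = contradiction centre ¬c
    at-prev ¬c (inner e) (leave e′)  = origin (trans (suc-injective e) e′)
    at-prev ¬c (inner e) (along e′)  = inner (trans (suc-injective e) e′)

    module _ (r : ℕ) (G H : Graph) (f : V G → V graph) (f-inj : Injective _≡_ _≡_ f)
             (f-adj : ∀ u v → Adj G u v → Adj graph (f u) (f v))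
             (φ : V G → V H) (contraction : IsContraction r G H φ) where

      Spot : Point L d → Fin d → ℕ → V G → Set
      Spot w i p u = At w i p (vtx (f u))

      spot-unique : ∀ {w i p u v} → Spot w i p u → Spot w i p v → u ≡ v
      spot-unique s s′ = f-inj (vtx-injective (at-unique s s′))

      HasCentre : V H → Set
      HasCentre x = ∃[ u ] φ u ≡ x × IsCentre (vtx (f u))

      hasCentre? : ∀ x → Dec (HasCentre x)
      hasCentre? x = Finₚ.any? (λ u → (φ u Finₚ.≟ x) ×-dec isCentre? (vtx (f u)))

      InFibre : V H → V G → V G → Set
      InFibre = AdjInFibre r G H φ

      inFibre-sym : ∀ {x a b} → InFibre x a b → InFibre x b a
      inFibre-sym {a = a} {b} (p , q , e) = q , p , trans (symm G b a) e

      fibre-walk : ∀ {x u v} → φ u ≡ x → φ v ≡ x → WalkAtMost (InFibre x) (r + r) u v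
      fibre-walk {x} {u} {v} p q with c , _ , reach ← proj₁ (proj₂ contraction) x =
        walk-++ (walk-reverse inFibre-sym (reach u p)) (reach v q)

      -- Records where an edge of the minor comes from: on the subdivided edge (w, i) the fibre
      -- changes from x to y between the positions p and p + 1.
      record Forward (w : Point L d) (i : Fin d) (x y : V H) : Set where
        constructor forward
        field
          {p}   : ℕ
          {u v} : V G
          φu    : φ u ≡ x
          φv    : φ v ≡ y
          atu   : Spot w i p u
          atv   : Spot w i (suc p) v
          p≤k   : p ≤ k
          x≢y   : x ≢ y

      Between : Point L d → Fin d → ℕ → ℕ → V G → Set
      Between w i l h a = ∃[ q ] l < q × q ≤ h × Spot w i q a

      -- The positions from l + 1 to h are inner vertices of one subdivided edge, so a walk can
      -- leave them only through the two steps at their ends, and both are barred to the fibre.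
      segment : ∀ {x w i l h} → h ≤ k →
        (∀ {a b} → φ a ≡ x → φ b ≡ x → Spot w i (suc l) a → ¬ Spot w i l b) →
        (∀ {a b} → φ a ≡ x → φ b ≡ x → Spot w i h a → ¬ Spot w i (suc h) b) →
        ∀ {a b} → Star (InFibre x) a b → Between w i l h a → Between w i l h b
      segment h≤k noDown noUp ε s = s
      segment {x} {w} {i} {l} {h} h≤k noDown noUp (_◅_ {a} {b} (φa , φb , e) r) (q , l<q , q≤h , at) =
        segment h≤k noDown noUp r (move (adj⇒joined (f-adj a b e)) l<q at)
        where
        inside : ¬ IsCentre (vtx (f a))
        inside = at-interior (≤-trans (s≤s z≤n) l<q) (≤-trans q≤h h≤k) at
        move : Joined (vtx (f a)) (vtx (f b)) → l < q → Spot w i q a → Between w i l h b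
        move (inj₁ nx) l<q at with m≤n⇒m<n∨m≡n q≤h
        ... | inj₁ q<h  = suc q , ≤-trans l<q (n≤1+n q) , q<h , at-next inside at nx
        ... | inj₂ refl = contradiction (at-next inside at nx) (noUp φa φb at)
        move (inj₂ nx) (s≤s {n = q′} l≤q′) at with m≤n⇒m<n∨m≡n l≤q′
        ... | inj₁ l<q′ = q′ , l<q′ , ≤-trans (n≤1+n q′) q≤h , at-prev inside at nx
        ... | inj₂ refl = contradiction (at-prev inside at nx) (noDown φa φb at)

      connected : ∀ {x u v} → φ u ≡ x → φ v ≡ x → Star (InFibre x) u v
      connected p q = walk⇒star (fibre-walk p q)

      -- A fibre x without a centre is confined to the positions 1 to p of one subdivided edge:
      -- position 0 is a centre, and position p + 1 belongs to y.
      forward-≤ : ∀ {w i w′ i′ x y y′} → ¬ HasCentre x →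
        (F : Forward w i x y) (F′ : Forward w′ i′ x y′) →
        w ≡ w′ × i ≡ i′ × Forward.p F′ ≤ Forward.p F
      forward-≤ {w} {i} {x = x} ¬S (forward {p} {u} {v} φu φv atu atv p≤k x≢y) F′@(forward {p′} {u′} φu′ _ atu′ _ _ _)
        with q , _ , q≤p , at ← segment {x} {w} {i} {0} {p} p≤k
               (λ {a} {b} _ φb _ at0 → ¬S (b , φb , at-zero at0))
               (λ {a} {b} _ φb _ atb → x≢y (trans (sym φb) (trans (cong φ (spot-unique atb atv)) φv)))
               (connected φu φu′)
               (p , n≢0⇒n>0 (λ { refl → ¬S (u , φu , at-zero atu) }) , ≤-refl , atu)
        with e₁ , e₂ , refl ← at-injective (λ c → ¬S (u′ , φu′ , c)) at atu′ = e₁ , e₂ , q≤p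

      -- By `forward-≤` in both directions, x is left at a single position. A fibre without a centre
      -- thus has at most one neighbour ahead, and symmetrically at most one behind.
      forward-uniqueˡ : ∀ {w i w′ i′ x y y′} → ¬ HasCentre x → Forward w i x y → Forward w′ i′ x y′ → y ≡ y′
      forward-uniqueˡ ¬S F F′ with refl , refl , p′≤p ← forward-≤ ¬S F F′ with _ , _ , p≤p′ ← forward-≤ ¬S F′ F
        with refl ← ≤-antisym p≤p′ p′≤p =
        trans (sym (Forward.φv F)) (trans (cong φ (spot-unique (Forward.atv F) (Forward.atv F′))) (Forward.φv F′))

      forward-≥ : ∀ {w i w′ i′ x x′ y} → ¬ HasCentre y →
        (F : Forward w i x y) (F′ : Forward w′ i′ x′ y) →
        w ≡ w′ × i ≡ i′ × Forward.p F ≤ Forward.p F′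
      forward-≥ {w} {i} {x = x} {y = y} ¬S (forward {p} {u} {v} φu φv atu atv p≤k x≢y) F′@(forward {p′} {v = v′} _ φv′ _ atv′ _ _)
        with q , p<q , _ , at ← segment {y} {w} {i} {p} {k} ≤-refl
               (λ {a} {b} _ φb _ atb → x≢y (trans (sym φu) (trans (cong φ (spot-unique atu atb)) φb)))
               (λ {a} {b} _ φb _ atk → ¬S (b , φb , at-last atk))
               (connected φv φv′)
               (suc p , ≤-refl , ≤∧≢⇒< p≤k (λ { refl → ¬S (v , φv , at-last atv) }) , atv)
        with e₁ , e₂ , refl ← at-injective (λ c → ¬S (v′ , φv′ , c)) at atv′ = e₁ , e₂ , s≤s⁻¹ p<q

      forward-uniqueʳ : ∀ {w i w′ i′ x x′ y} → ¬ HasCentre y → Forward w i x y → Forward w′ i′ x′ y → x ≡ x′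
      forward-uniqueʳ ¬S F F′ with refl , refl , p≤p′ ← forward-≥ ¬S F F′ with _ , _ , p′≤p ← forward-≥ ¬S F′ F
        with refl ← ≤-antisym p≤p′ p′≤p =
        trans (sym (Forward.φu F)) (trans (cong φ (spot-unique (Forward.atu F) (Forward.atu F′))) (Forward.φu F′))

      -- The fibre y begins at p + 1 and would be trapped between p + 1 and p′: below it lies x, and
      -- the change of fibres at p′ stops it above. No centre lies in that range.
      not-later : ∀ {w i x y x′ y′} → HasCentre y → (F : Forward w i x y) (F′ : Forward w i x′ y′) →
        ¬ (Forward.p F < Forward.p F′)
      not-later {w} {i} {x} {y} (c , φc , cc) (forward {p} {u} {v} φu φv atu atv p≤k x≢y)
        (forward {p′} {u′} {v′} φu′ φv′ atu′ atv′ p′≤k x′≢y′) p<p′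
        with q , p<q , q≤p′ , at ← segment {y} {w} {i} {p} {p′} p′≤k
               (λ {a} {b} _ φb _ atb → x≢y (trans (sym φu) (trans (cong φ (spot-unique atu atb)) φb)))
               (λ {a} {b} φa φb ata atb → x′≢y′ (trans (sym φu′) (trans (trans (cong φ (spot-unique atu′ ata)) φa)
                  (trans (sym φb) (trans (cong φ (spot-unique atb atv′)) φv′)))))
               (connected φv φc) (suc p , ≤-refl , p<p′ , atv)
        = at-interior (≤-trans (s≤s z≤n) p<q) (≤-trans q≤p′ p′≤k) at cc

      forward-unique : ∀ {w i x y x′ y′} → HasCentre y → HasCentre y′ →
        Forward w i x y → Forward w i x′ y′ → x ≡ x′ × y ≡ y′
      forward-unique S S′ F F′ with <-cmp (Forward.p F) (Forward.p F′)
      ... | tri< lt _ _ = contradiction lt (not-later S F F′)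
      ... | tri> _ _ gt = contradiction gt (not-later S′ F′ F)
      ... | tri≈ _ refl _ =
        trans (sym (Forward.φu F)) (trans (cong φ (spot-unique (Forward.atu F) (Forward.atu F′))) (Forward.φu F′)) ,
        trans (sym (Forward.φv F)) (trans (cong φ (spot-unique (Forward.atv F) (Forward.atv F′))) (Forward.φv F′))

      adj⇒forward : ∀ {x y} → Adj H x y → ∃₂ λ w i → Forward w i x y ⊎ Forward w i y x
      adj⇒forward {x} {y} e with Equivalence.to (proj₂ (proj₂ contraction) x y) e
      ... | x≢y , u , v , φu , φv , e′ with adj⇒joined (f-adj u v e′)
      ...   | inj₁ nx with w , i , p , p≤k , ata , atb ← next-at nx =
        w , i , inj₁ (forward φu φv ata atb p≤k x≢y)
      ...   | inj₂ nx with w , i , p , p≤k , ata , atb ← next-at nx =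
        w , i , inj₂ (forward φv φu ata atb p≤k (x≢y ∘ sym))

      -- An edge with an end without a centre is charged to that end, once for each choice of end
      -- and of orientation: 4 |V(H)| labels. An edge between two fibres with centres is charged to
      -- its subdivided edge, once for each orientation: 2 d L^d labels.
      Label : Set
      Label = Fin 4 × V H ⊎ Fin 2 × Point L d × Fin d

      data Lab (x y : V H) : Label → Set where
        fwdˡ : ∀ {w i} → ¬ HasCentre x → Forward w i x y → Lab x y (inj₁ (# 0 , x))
        fwdʳ : ∀ {w i} → ¬ HasCentre y → Forward w i x y → Lab x y (inj₁ (# 1 , y))
        bwdˡ : ∀ {w i} → ¬ HasCentre x → Forward w i y x → Lab x y (inj₁ (# 2 , x))
        bwdʳ : ∀ {w i} → ¬ HasCentre y → Forward w i y x → Lab x y (inj₁ (# 3 , y))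
        fwdˢ : ∀ {w i} → HasCentre x → HasCentre y → Forward w i x y → Lab x y (inj₂ (# 0 , w , i))
        bwdˢ : ∀ {w i} → HasCentre x → HasCentre y → Forward w i y x → Lab x y (inj₂ (# 1 , w , i))

      label : ∀ {x y} → Adj H x y → ∃ (Lab x y)
      label {x} {y} e with adj⇒forward e | hasCentre? x | hasCentre? y
      ... | _ , _ , inj₁ F | no ¬S | _      = _ , fwdˡ ¬S F
      ... | _ , _ , inj₁ F | yes _ | no ¬S  = _ , fwdʳ ¬S F
      ... | _ , _ , inj₁ F | yes S | yes S′ = _ , fwdˢ S S′ F
      ... | _ , _ , inj₂ F | no ¬S | _      = _ , bwdˡ ¬S F
      ... | _ , _ , inj₂ F | yes _ | no ¬S  = _ , bwdʳ ¬S F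
      ... | _ , _ , inj₂ F | yes S | yes S′ = _ , bwdˢ S S′ F

      lab-unique : ∀ {x y x′ y′ l} → Lab x y l → Lab x′ y′ l → x ≡ x′ × y ≡ y′
      lab-unique (fwdˡ ¬S F) (fwdˡ _ F′) = refl , forward-uniqueˡ ¬S F F′
      lab-unique (fwdʳ ¬S F) (fwdʳ _ F′) = forward-uniqueʳ ¬S F F′ , refl
      lab-unique (bwdˡ ¬S F) (bwdˡ _ F′) = refl , forward-uniqueʳ ¬S F F′
      lab-unique (bwdʳ ¬S F) (bwdʳ _ F′) = forward-uniqueˡ ¬S F F′ , refl
      lab-unique (fwdˢ _ S F) (fwdˢ _ S′ F′) = forward-unique S S′ F F′
      lab-unique (bwdˢ S _ F) (bwdˢ S′ _ F′) with p , q ← forward-unique S S′ F F′ = q , p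

      encode : Label → Fin (4 * ∣V∣ H + 2 * (L ^ d * d))
      encode (inj₁ (t , x))     = combine t x Fin.↑ˡ _
      encode (inj₂ (t , w , i)) = (4 * ∣V∣ H) Fin.↑ʳ combine t (combine (pointIndex w) i)

      encode-injective : Injective _≡_ _≡_ encode
      encode-injective {inj₁ (t , x)} {inj₁ (t′ , x′)} e
        with refl , refl ← Finₚ.combine-injective t x t′ x′ (Finₚ.↑ˡ-injective _ _ _ e) = refl
      encode-injective {inj₂ (t , w , i)} {inj₂ (t′ , w′ , i′)} e
        with refl , e′ ← Finₚ.combine-injective t _ t′ _ (Finₚ.↑ʳ-injective (4 * ∣V∣ H) _ _ e)
        with e″ , refl ← Finₚ.combine-injective (pointIndex w) i (pointIndex w′) i′ e′ =
        cong (λ w → inj₂ (t , w , i)) (trans (sym (point-pointIndex w)) (trans (cong (point d) e″) (point-pointIndex w′)))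
      encode-injective {inj₁ (t , x)} {inj₂ (t′ , w′ , i′)} e = contradiction e (↑ˡ≢↑ʳ (combine t x) _)
      encode-injective {inj₂ (t′ , w′ , i′)} {inj₁ (t , x)} e = contradiction (sym e) (↑ˡ≢↑ʳ (combine t x) _)

      ∣E∣≤deep : ∣E∣ H ≤ 4 * ∣V∣ H + 2 * (L ^ d * d)
      ∣E∣≤deep = ∣E∣≤labels H encode encode-injective Lab (λ x y _ → label) (λ _ _ → lab-unique)

      -- To reach a centre the walk must leave the interior of the subdivided edge; it is too short
      -- for the end k + 1 and hence visits the end 0.
      near : ∀ {z m w i q a b} → WalkAtMost (InFibre z) m a b → φ a ≡ z → IsCentre (vtx (f b)) →
        Spot w i q a → q + m ≤ k → ∃[ c ] φ c ≡ z × Spot w i 0 c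
      near {q = zero}  {a} wk φa cb at le = a , φa , at
      near {q = suc q} {a} here φa cb at le = contradiction cb (at-interior (s≤s z≤n) (m+n≤o⇒m≤o _ le) at)
      near {m = suc m} {w} {i} {suc q} {a} (step (_ , φa′ , e) wk) φa cb at le = move (adj⇒joined (f-adj a _ e))
        where
        inside = at-interior (s≤s z≤n) (m+n≤o⇒m≤o _ le) at
        move : _ → _
        move (inj₁ nx) = near wk φa′ cb (at-next inside at nx) (≤-trans (≤-reflexive (cong suc (sym (+-suc q m)))) le)
        move (inj₂ nx) = near wk φa′ cb (at-prev inside at nx) (≤-trans (+-mono-≤ (n≤1+n q) (n≤1+n m)) le)

      -- Mirror image of `near`: with fewer than q steps the end 0 is out of reach.
      far : ∀ {z m w i q a b} → WalkAtMost (InFibre z) m a b → φ a ≡ z → IsCentre (vtx (f b)) →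
        Spot w i q a → m < q → ∃[ c ] φ c ≡ z × Spot w i (suc k) c
      far {q = q} wk φa cb at lt with m≤n⇒m<n∨m≡n (at-≤ at)
      far {a = a} wk φa cb at lt | inj₂ refl = a , φa , at
      far here φa cb at lt | inj₁ (s≤s q≤k) = contradiction cb (at-interior (≤-trans (s≤s z≤n) lt) q≤k at)
      far {m = suc m} {w} {i} {suc q} {a} (step (_ , φa′ , e) wk) φa cb at (s≤s lt) | inj₁ (s≤s q≤k) = move (adj⇒joined (f-adj a _ e))
        where
        inside = at-interior (s≤s z≤n) q≤k at
        move : _ → _
        move (inj₁ nx) = far wk φa′ cb (at-next inside at nx) (≤-trans lt (≤-trans (n≤1+n q) (n≤1+n (suc q))))
        move (inj₂ nx) = far wk φa′ cb (at-prev inside at nx) lt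

      far-side : ∀ {p} → 2 * (r + r) < k → ¬ (suc p + (r + r) ≤ k) → r + r < p
      far-side {p} small ¬le = +-cancelʳ-< (r + r) _ _ (begin-strict
        r + r + (r + r)  ≡⟨ cong ((r + r) +_) (+-identityʳ _) ⟨
        2 * (r + r)  <⟨ small ⟩
        k  ≤⟨ s≤s⁻¹ (≰⇒> ¬le) ⟩
        p + (r + r)  ∎)

      -- Two adjacent fibres with centres would both contain the nearer end of
      -- the subdivided edge joining them.
      no-close-centres : 2 * (r + r) < k → ∀ {w i x y} → HasCentre x → HasCentre y → ¬ Forward w i x y
      no-close-centres small {w} {i} (s , φs , cs) (t , φt , ct) (forward {p} φu φv atu atv p≤k x≢y)
        with suc p + (r + r) ≤? k
      ... | yes le
        with c , φc , atc ← near (fibre-walk φu φs) φu cs atu (≤-trans (n≤1+n _) le)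
        with c′ , φc′ , atc′ ← near (fibre-walk φv φt) φv ct atv le =
        x≢y (trans (sym φc) (trans (cong φ (spot-unique atc atc′)) φc′))
      ... | no ¬le
        with c , φc , atc ← far (fibre-walk φu φs) φu cs atu (far-side small ¬le)
           | c′ , φc′ , atc′ ← far (fibre-walk φv φt) φv ct atv (≤-trans (far-side small ¬le) (n≤1+n p)) =
        x≢y (trans (sym φc) (trans (cong φ (spot-unique atc atc′)) φc′))

      ∣E∣≤shallow : 2 * (r + r) < k → ∣E∣ H ≤ 4 * ∣V∣ H
      ∣E∣≤shallow small = ∣E∣≤labels H {Fin 4 × V H} (λ { (t , x) → combine t x })
        (λ { {t , x} {t′ , x′} e → let p , q = Finₚ.combine-injective t x t′ x′ e in cong₂ _,_ p q })
        (λ x y l → Lab x y (inj₁ l)) (λ x y _ e → shallow (label e)) (λ _ _ → lab-unique)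
        where
        shallow : ∀ {x y} → ∃ (Lab x y) → ∃[ l ] Lab x y (inj₁ l)
        shallow (inj₁ l , lab)           = l , lab
        shallow (inj₂ _ , fwdˢ S S′ F) = contradiction F (no-close-centres small S S′)
        shallow (inj₂ _ , bwdˢ S S′ F) = contradiction F (no-close-centres small S′ S)

-- The family of grids: its separation function and its shallow minors at each scale.

module GridFamily where

  open Counting
  open Separation
  open SubdividedGrid
  open SeparatorLowerBound
  open SeparatorUpperBound
  open ShallowMinors
  open import Data.Nat
  open import Data.Nat.Properties
  open import Data.Fin as Fin using (Fin; zero; suc)
  import Data.Fin.Properties as Finₚ
  open import Data.Vec as Vec using (Vec)
  open import Data.Product using (∃-syntax; _×_; _,_; proj₁; proj₂)
  open import Data.Sum using (inj₁; inj₂; [_,_]′)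
  open import Function using (_∘_; id)
  open import Relation.Nullary using (yes; no; contradiction)
  open import Relation.Binary.PropositionalEquality
  open import Data.Nat.Tactic.RingSolver using (solve-∀)
  open import Data.Fin.Subset using (∣_∣)
  import Data.Fin.Subset.Properties as Subₚ
  open import Data.Fin.Subset using (⊤)
  open import Relation.Binary.Construct.Closure.ReflexiveTransitive as Star using (Star)
  open import Function.Definitions using (Injective)
  open import Data.Nat.DivMod
    using (_/_; m/n*n≤m; m≥n⇒m/n>0; m≡m%n+[m/n]*n; m%n<n; m*n/n≡m; /-monoˡ-≤)
  open ≤-Reasoning

  n<2^n : ∀ n → n < 2 ^ n
  n<2^n zero    = ≤-refl
  n<2^n (suc n) = ≤-trans (+-mono-≤ (≤-trans (s≤s z≤n) (n<2^n n)) (n<2^n n))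
    (≤-reflexive (cong (2 ^ n +_) (sym (+-identityʳ (2 ^ n)))))

  2^-mono : ∀ {m n} → m ≤ n → 2 ^ m ≤ 2 ^ n
  2^-mono = ^-monoʳ-≤ 2

  2^-cancel : ∀ {m n} → 2 ^ m ≤ 2 ^ n → m ≤ n
  2^-cancel {m} {n} h = ≮⇒≥ (λ n<m → contradiction h (<⇒≱ (^-monoʳ-< 2 (s≤s (s≤s z≤n)) n<m)))

  *-^ : ∀ a b n → (a * b) ^ n ≡ a ^ n * b ^ n
  *-^ a b zero    = refl
  *-^ a b (suc n) = trans (cong (a * b *_) (*-^ a b n)) (eq a b (a ^ n) (b ^ n))
    where
    eq : ∀ a b x y → a * b * (x * y) ≡ a * x * (b * y)
    eq = solve-∀

  2^>0 : ∀ n → 0 < 2 ^ n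
  2^>0 n = ≤-trans (s≤s z≤n) (n<2^n n)

  -- By `g-step` the side 2^(g j) at most doubles with j, so a bound obtained at the order of one
  -- grid holds up to a constant until the next.
  module Family (D : ℕ) (g : ℕ → ℕ)
    (g-mono : ∀ j → g j ≤ g (suc j)) (g-step : ∀ j → g (suc j) ≤ suc (g j)) where

    d : ℕ
    d = suc D

    module S (j : ℕ) = Subdivision (2 ^ g j) d (2 ^ j)

    Γ : ℕ → Graph
    Γ j = S.graph j

    g-mono-≤ : ∀ {i j} → i ≤ j → g i ≤ g j
    g-mono-≤ {i} {j} i≤j = go (≤⇒≤′ i≤j)
      where
      go : ∀ {j} → i ≤′ j → g i ≤ g j
      go ≤′-refl         = ≤-refl
      go (≤′-step i≤′j)  = ≤-trans (go i≤′j) (g-mono _)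

    -- Binary logarithm of the order of `Γ j`, up to an additive constant.
    volume : ℕ → ℕ
    volume j = d * g j + j

    -- n₀, σ and σ′ come from choosing the slab width in slab-separator.
    n₀ σ σ′ M : ℕ
    n₀ = 3 * 2 ^ d * suc d
    σ  = n₀ + 2 * d * n₀
    σ′ = d * n₀ * 2 ^ d
    M  = 3 * σ

    instance
      n₀≢0 : NonZero n₀
      n₀≢0 = >-nonZero (*-mono-< {0} {3 * 2 ^ d} {0} (*-mono-< {0} {3} {0} (s≤s z≤n) (2^>0 d)) (s≤s z≤n))

    order-≥ : ∀ j → 2 ^ volume j ≤ ∣V∣ (Γ j)
    order-≥ j = begin
      2 ^ volume j  ≡⟨ ^-distribˡ-+-* 2 (d * g j) j ⟩
      2 ^ (d * g j) * 2 ^ j  ≤⟨ *-mono-≤ (≤-reflexive (trans (cong (2 ^_) (*-comm d (g j))) (sym (^-*-assoc 2 (g j) d))))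
                                            (≤-trans (m≤n*m (2 ^ j) d) (n≤1+n _)) ⟩
      (2 ^ g j) ^ d * suc (d * 2 ^ j)  ∎

    suc-d-k : ∀ k → suc (d * k) ≤ suc d * suc k
    suc-d-k k = s≤s (≤-trans (*-monoʳ-≤ d (n≤1+n k)) (m≤n+m _ k))

    order-≤ : ∀ j → ∣V∣ (Γ j) ≤ 2 ^ (d * g j) * (suc d * suc (2 ^ j))
    order-≤ j = *-mono-≤ (≤-reflexive (trans (^-*-assoc 2 (g j) d) (cong (2 ^_) (*-comm (g j) d)))) (suc-d-k (2 ^ j))

    module _ (G : Graph) (j : ℕ) (induced : IsInducedSubgraph G (Γ j)) where
      private
        n = ∣V∣ G
        k = 2 ^ j
        f = proj₁ induced
        f-inj = proj₁ (proj₂ induced)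
        f-adj : ∀ u v → Adj G u v → Adj (Γ j) (f u) (f v)
        f-adj u v e = trans (sym (proj₂ (proj₂ induced) u v)) e

      order-induced : n ≤ ∣V∣ (Γ j)
      order-induced = Finₚ.injective⇒≤ f-inj

      -- Slabs of width ℓ = n / n₀, at most k + 1: a box meets at most 2^d gadgets in at most ℓ
      -- vertices per arm, hence is small compared to n. The cost d n / ℓ is at most 2 d n₀. Below
      -- n₀ vertices everything is removed.
      separator-narrow : n ≤ n₀ * suc k → ∃[ X ] IsBalancedSeparator G X × ∣ X ∣ ≤ σ
      separator-narrow n≤ with n₀ ≤? n
      ... | no n₀≰n = ⊤ , full-balanced G , ≤-trans (Subₚ.∣p∣≤n {n} ⊤) (≤-trans (<⇒≤ (≰⇒> n₀≰n)) (m≤m+n n₀ _))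
      ... | yes n₀≤n =
        let X , bal , size = slab-separator {2 ^ g j} {d} {k} G f f-inj f-adj ℓ 1 ℓ ℓ>0 ℓ≤ (inj₂ ≤-refl) fits
        in X , bal , ≤-trans (*-cancelˡ-≤ ℓ {{>-nonZero ℓ>0}} (≤-trans size (begin
          d * n  ≤⟨ *-monoʳ-≤ d n≤2ℓn₀ ⟩
          d * (2 * ℓ * n₀)  ≡⟨ eq d ℓ n₀ ⟩
          ℓ * (2 * d * n₀)  ∎))) (m≤n+m _ n₀)
        where
        ℓ = n / n₀
        ℓ>0 : 0 < ℓ
        ℓ>0 = m≥n⇒m/n>0 n₀≤n
        ℓ≤ : ℓ ≤ suc k * 1
        ℓ≤ = begin
          n / n₀  ≤⟨ /-monoˡ-≤ n₀ n≤ ⟩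
          n₀ * suc k / n₀  ≡⟨ cong (_/ n₀) (*-comm n₀ (suc k)) ⟩
          suc k * n₀ / n₀  ≡⟨ m*n/n≡m (suc k) n₀ ⟩
          suc k  ≡⟨ *-identityʳ (suc k) ⟨
          suc k * 1  ∎
        fits : 3 * (2 ^ d * suc (d * ℓ)) ≤ 2 * n
        fits = begin
          3 * (2 ^ d * suc (d * ℓ))  ≤⟨ *-monoʳ-≤ 3 (*-monoʳ-≤ (2 ^ d) (+-monoˡ-≤ (d * ℓ) ℓ>0)) ⟩
          3 * (2 ^ d * (suc d * ℓ))  ≡⟨ eq₂ (2 ^ d) (suc d) ℓ ⟩
          ℓ * n₀  ≤⟨ m/n*n≤m n n₀ ⟩
          n  ≤⟨ m≤n*m n 2 ⟩
          2 * n  ∎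
          where
          eq₂ : ∀ a b c → 3 * (a * (b * c)) ≡ c * (3 * a * b)
          eq₂ = solve-∀
        n≤2ℓn₀ : n ≤ 2 * ℓ * n₀
        n≤2ℓn₀ = begin
          n  ≡⟨ m≡m%n+[m/n]*n n n₀ ⟩
          n Data.Nat.% n₀ + ℓ * n₀ ≤⟨ +-monoˡ-≤ (ℓ * n₀) (<⇒≤ (m%n<n n n₀)) ⟩
          n₀ + ℓ * n₀  ≤⟨ +-monoˡ-≤ (ℓ * n₀) (≤-trans (≤-reflexive (sym (*-identityˡ n₀))) (*-monoˡ-≤ n₀ ℓ>0)) ⟩
          ℓ * n₀ + ℓ * n₀  ≡⟨ eq₃ ℓ n₀ ⟩
          2 * ℓ * n₀  ∎
          where
          eq₃ : ∀ a b → a * b + a * b ≡ 2 * a * b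
          eq₃ = solve-∀
        eq : ∀ a b c → a * (2 * b * c) ≡ b * (2 * a * c)
        eq = solve-∀

      Fills : ℕ → Set
      Fills τ = n₀ * (suc k * 2 ^ (d * τ)) ≤ n

      fills-bound : ∀ τ → Fills τ → τ ≤ n
      fills-bound τ h = begin
        τ  ≤⟨ <⇒≤ (n<2^n τ) ⟩
        2 ^ τ  ≤⟨ 2^-mono (m≤n*m τ d) ⟩
        2 ^ (d * τ)  ≤⟨ m≤n*m _ (suc k) ⟩
        suc k * 2 ^ (d * τ)  ≤⟨ m≤n*m _ n₀ ⟩
        n₀ * (suc k * 2 ^ (d * τ))  ≤⟨ h ⟩
        n  ∎

      -- Slabs of width (k + 1) 2^τ with τ maximal such that boxes still fit. By maximality n < n₀
      -- (k + 1) 2^(d(τ + 1)), which bounds the cost d n / ℓ by a constant times 2^((d - 1) τ).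
      separator-wide : n₀ * suc k ≤ n →
        ∃[ τ ] Fills τ × (∃[ X ] IsBalancedSeparator G X × ∣ X ∣ ≤ σ′ * 2 ^ (D * τ))
      separator-wide n≥
        with τ , fill , max ← greatest {Fills} (λ τ → n₀ * (suc k * 2 ^ (d * τ)) ≤? n) n
               (0 , subst (λ e → n₀ * (suc k * 2 ^ e) ≤ n) (sym (*-zeroʳ d)) (≤-trans (≤-reflexive (cong (n₀ *_) (*-identityʳ (suc k)))) n≥))
               fills-bound =
        τ , fill , result τ fill (≰⇒> (λ h → contradiction (max (suc τ) h) (<⇒≱ (n<1+n τ))))
        where
        result : ∀ τ → Fills τ → n < n₀ * (suc k * 2 ^ (d * suc τ)) →
          ∃[ X ] IsBalancedSeparator G X × ∣ X ∣ ≤ σ′ * 2 ^ (D * τ)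
        result τ fill short =
          let X , bal , size = slab-separator {2 ^ g j} {d} {k} G f f-inj f-adj (suc k * t) t k (*-mono-< {0} {suc k} {0} (s≤s z≤n) t>0) ≤-refl (inj₁ ≤-refl) fits
          in X , bal , *-cancelˡ-≤ (suc k * t) {{>-nonZero (*-mono-< {0} {suc k} {0} (s≤s z≤n) t>0)}} (begin
            suc k * t * ∣ X ∣  ≤⟨ size ⟩
            d * n  ≤⟨ *-monoʳ-≤ d (<⇒≤ short) ⟩
            d * (n₀ * (suc k * 2 ^ (d * suc τ)))  ≡⟨ cong (λ e → d * (n₀ * (suc k * e))) pow ⟩
            d * (n₀ * (suc k * (2 ^ d * (t * 2 ^ (D * τ)))))  ≡⟨ eq d n₀ (suc k) (2 ^ d) t (2 ^ (D * τ)) ⟩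
            suc k * t * (σ′ * 2 ^ (D * τ))  ∎)
          where
          t = 2 ^ τ
          t>0 = 2^>0 τ
          pow : 2 ^ (d * suc τ) ≡ 2 ^ d * (t * 2 ^ (D * τ))
          pow = trans (cong (2 ^_) (*-suc d τ)) (trans (^-distribˡ-+-* 2 d (d * τ)) (cong (2 ^ d *_) (^-distribˡ-+-* 2 τ (D * τ))))
          eq : ∀ d n₀ K p t q → d * (n₀ * (K * (p * (t * q)))) ≡ K * t * (d * n₀ * p * q)
          eq = solve-∀
          fits : 3 * (suc t ^ d * suc (d * k)) ≤ 2 * n
          fits = begin
            3 * (suc t ^ d * suc (d * k))  ≤⟨ *-monoʳ-≤ 3 (*-mono-≤ (^-monoˡ-≤ d (+-monoˡ-≤ t t>0)) (suc-d-k k)) ⟩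
            3 * ((t + t) ^ d * (suc d * suc k))  ≡⟨ cong (λ s → 3 * (s ^ d * (suc d * suc k))) (cong (t +_) (+-identityʳ t)) ⟨
            3 * ((2 * t) ^ d * (suc d * suc k))  ≡⟨ cong (λ s → 3 * (s * (suc d * suc k))) (*-^ 2 t d) ⟩
            3 * (2 ^ d * t ^ d * (suc d * suc k))  ≡⟨ cong (λ s → 3 * (2 ^ d * s * (suc d * suc k))) (trans (^-*-assoc 2 τ d) (cong (2 ^_) (*-comm τ d))) ⟩
            3 * (2 ^ d * 2 ^ (d * τ) * (suc d * suc k)) ≡⟨ eq₂ (2 ^ d) (2 ^ (d * τ)) (suc d) (suc k) ⟩
            n₀ * (suc k * 2 ^ (d * τ))  ≤⟨ fill ⟩
            n  ≤⟨ m≤n*m n 2 ⟩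
            2 * n  ∎
            where
            eq₂ : ∀ a b c e → 3 * (a * b * (c * e)) ≡ 3 * a * c * (e * b)
            eq₂ = solve-∀

    open InducedClass Γ M public using (𝒢; hereditary; sep)

    -- Fewer than j vertices are fewer than the 2^j of an arm, so the narrow case applies; this
    -- dictates `M` = 3σ.
    far : ∀ G j k → ∣V∣ G < j → IsInducedSubgraph G (Γ j) → HasSeparationNumber G k → 3 * k ≤ M
    far G j k small induced (_ , min) =
      let X , bal , size = separator-narrow G j induced (≤-trans (<⇒≤ small) (≤-trans (<⇒≤ (n<2^n j))
            (≤-trans (n≤1+n _) (m≤n*m (suc (2 ^ j)) n₀))))
      in *-monoʳ-≤ 3 (≤-trans (min X bal) size)

    sep-isSeparationFunction : IsSeparationFunction 𝒢 sep
    sep-isSeparationFunction = InducedClass.sep-isSeparationFunction Γ M (λ G j k → far G j k)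

    -- With T = 2^(D g J), the constants in `sep n` ≤ C₀ T and T ≤ c₀ `sep n`. The number E₀ bounds
    -- the logarithmic gap between 2^(volume J) and the order of the next grid.
    C₀ c₀ E₀ : ℕ
    C₀ = M + (σ + σ′ * 2 ^ D)
    c₀ = η d 4
    E₀ = d + (d + 2)

    M≤C₀ : M ≤ C₀
    M≤C₀ = m≤m+n M (σ + σ′ * 2 ^ D)

    σ≤C₀ : σ ≤ C₀
    σ≤C₀ = ≤-trans (m≤m+n σ (σ′ * 2 ^ D)) (m≤n+m (σ + σ′ * 2 ^ D) M)

    σ′≤C₀ : σ′ * 2 ^ D ≤ C₀
    σ′≤C₀ = ≤-trans (m≤n+m (σ′ * 2 ^ D) σ) (m≤n+m (σ + σ′ * 2 ^ D) M)

    module _ (n J : ℕ) (n< : n < ∣V∣ (Γ (suc J))) where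
      private T = 2 ^ (D * g J)

      T>0 : 0 < T
      T>0 = 2^>0 (D * g J)

      -- The factor n₀ (2^k + 1) outweighs the size of a gadget of `Γ i`, so 2^(dτ) is at most the
      -- number 2^(d g i) of gadgets.
      fills⇒≤g : ∀ τ i k → i ≤ k → n₀ * (suc (2 ^ k) * 2 ^ (d * τ)) ≤ ∣V∣ (Γ i) → τ ≤ g i
      fills⇒≤g τ i k i≤k h = *-cancelˡ-≤ d (2^-cancel (*-cancelˡ-≤ (suc d * suc (2 ^ k)) (begin
        suc d * suc (2 ^ k) * 2 ^ (d * τ)  ≤⟨ *-monoˡ-≤ (2 ^ (d * τ)) (*-monoˡ-≤ (suc (2 ^ k)) (m≤n*m (suc d) (3 * 2 ^ d) {{>-nonZero (*-mono-< {0} {3} {0} (s≤s z≤n) (2^>0 d))}})) ⟩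
        n₀ * suc (2 ^ k) * 2 ^ (d * τ)  ≡⟨ *-assoc n₀ (suc (2 ^ k)) (2 ^ (d * τ)) ⟩
        n₀ * (suc (2 ^ k) * 2 ^ (d * τ))  ≤⟨ h ⟩
        ∣V∣ (Γ i)  ≤⟨ order-≤ i ⟩
        2 ^ (d * g i) * (suc d * suc (2 ^ i)) ≤⟨ *-monoʳ-≤ (2 ^ (d * g i)) (*-monoʳ-≤ (suc d) (s≤s (2^-mono i≤k))) ⟩
        2 ^ (d * g i) * (suc d * suc (2 ^ k)) ≡⟨ *-comm (2 ^ (d * g i)) _ ⟩
        suc d * suc (2 ^ k) * 2 ^ (d * g i)  ∎)))

      separation-≤ : ∀ G l → 𝒢 G → ∣V∣ G ≤ n → HasSeparationNumber G l → l ≤ C₀ * T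
      separation-≤ G l (inj₁ small) _ has = begin
        l  ≤⟨ separationNumber-≤-third G has ⟩
        third (∣V∣ G) ≤⟨ third≤ (∣V∣ G) ⟩
        ∣V∣ G  ≤⟨ small ⟩
        M  ≤⟨ M≤C₀ ⟩
        C₀  ≤⟨ m≤m*n C₀ T {{>-nonZero T>0}} ⟩
        C₀ * T  ∎
      separation-≤ G l (inj₂ (j , induced)) ≤n (_ , min) = [ narrow , wide ]′ (≤-total (∣V∣ G) (n₀ * suc (2 ^ j)))
        where
        narrow : ∣V∣ G ≤ n₀ * suc (2 ^ j) → l ≤ C₀ * T
        narrow h =
          let X , bal , size = separator-narrow G j induced h
          in begin
            l  ≤⟨ min X bal ⟩
            ∣ X ∣  ≤⟨ size ⟩
            σ  ≤⟨ σ≤C₀ ⟩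
            C₀  ≤⟨ m≤m*n C₀ T {{>-nonZero T>0}} ⟩
            C₀ * T  ∎
        τ≤ : ∀ τ → Fills G j induced τ → τ ≤ g (suc J)
        -- For early j the room is limited by the order of `Γ j` itself. For later j the arms are
        -- longer than in `Γ (suc J)`, and the room is limited by n, which is below the order of
        -- that grid.
        τ≤ τ fill with ≤-total j (suc J)
        ... | inj₁ j≤ = ≤-trans (fills⇒≤g τ j j ≤-refl (≤-trans fill (order-induced G j induced))) (g-mono-≤ j≤)
        ... | inj₂ j≥ = fills⇒≤g τ (suc J) j j≥ (≤-trans fill (≤-trans ≤n (<⇒≤ n<)))
        wide : n₀ * suc (2 ^ j) ≤ ∣V∣ G → l ≤ C₀ * T
        wide h =
          let τ , fill , X , bal , size = separator-wide G j induced h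
          in begin
            l  ≤⟨ min X bal ⟩
            ∣ X ∣  ≤⟨ size ⟩
            σ′ * 2 ^ (D * τ)  ≤⟨ *-monoʳ-≤ σ′ (2^-mono (*-monoʳ-≤ D (≤-trans (τ≤ τ fill) (g-step J)))) ⟩
            σ′ * 2 ^ (D * suc (g J))  ≡⟨ cong (σ′ *_) (trans (cong (2 ^_) (*-suc D (g J))) (^-distribˡ-+-* 2 D (D * g J))) ⟩
            σ′ * (2 ^ D * T)  ≡⟨ *-assoc σ′ (2 ^ D) T ⟨
            σ′ * 2 ^ D * T  ≤⟨ *-monoˡ-≤ T σ′≤C₀ ⟩
            C₀ * T  ∎

      sep-≤ : sep n ≤ C₀ * T
      sep-≤ = let G , mem , ≤n , has = proj₁ (sep-isSeparationFunction n) in separation-≤ G (sep n) mem ≤n has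

      n-≤ : n ≤ 2 ^ (volume J + E₀)
      n-≤ = begin
        n  ≤⟨ <⇒≤ n< ⟩
        ∣V∣ (Γ (suc J))  ≤⟨ order-≤ (suc J) ⟩
        2 ^ (d * g (suc J)) * (suc d * suc k)  ≤⟨ *-mono-≤ (2^-mono (*-monoʳ-≤ d (g-step J)))
                                                          (*-mono-≤ (n<2^n d) (≤-trans (+-monoˡ-≤ k (2^>0 (suc J))) (≤-reflexive (cong (k +_) (sym (+-identityʳ k)))))) ⟩
        2 ^ (d * suc (g J)) * (2 ^ d * 2 ^ (2 + J))  ≡⟨ cong (2 ^ (d * suc (g J)) *_) (^-distribˡ-+-* 2 d (2 + J)) ⟨
        2 ^ (d * suc (g J)) * 2 ^ (d + (2 + J))  ≡⟨ ^-distribˡ-+-* 2 (d * suc (g J)) (d + (2 + J)) ⟨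
        2 ^ (d * suc (g J) + (d + (2 + J)))  ≡⟨ cong (2 ^_) (eq d (g J) J) ⟩
        2 ^ (volume J + E₀)  ∎
        where
        k = 2 ^ suc J
        eq : ∀ d g J → d * suc g + (d + (2 + J)) ≡ d * g + J + (d + (d + 2))
        eq = solve-∀

      -- Witnessed by `Γ J` itself; one factor L is cancelled in `separator-large`.
      sep-≥ : ∣V∣ (Γ J) ≤ n → T ≤ c₀ * sep n
      sep-≥ ≤n =
        let k , has@((X , bal , size) , _) = separationNumber (Γ J)
            k≤sep = proj₂ (sep-isSeparationFunction n) (Γ J) k (inj₂ (J , id , id , λ _ _ → refl)) ≤n has
            L = 2 ^ g J
        in begin
          2 ^ (D * g J)  ≡⟨ trans (cong (2 ^_) (*-comm D (g J))) (sym (^-*-assoc 2 (g J) D)) ⟩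
          L ^ D  ≤⟨ *-cancelˡ-≤ L {{>-nonZero (2^>0 (g J))}} (begin
            L ^ d  ≤⟨ separator-large (2^>0 (g J)) (2^>0 J) X bal ⟩
            c₀ * (L * ∣ X ∣)  ≡⟨ eq c₀ L ∣ X ∣ ⟩
            L * (c₀ * ∣ X ∣)  ∎) ⟩
          c₀ * ∣ X ∣  ≤⟨ *-monoʳ-≤ c₀ (≤-trans (≤-reflexive size) k≤sep) ⟩
          c₀ * sep n  ∎
        where
        eq : ∀ a b c → a * (b * c) ≡ b * (a * c)
        eq = solve-∀

    -- The bound 1 ≤ J makes `volume J` positive, so that it can serve as a denominator later.
    scale : ∀ n → ∣V∣ (Γ 1) ≤ n → ∃[ J ] 1 ≤ J × ∣V∣ (Γ J) ≤ n × n < ∣V∣ (Γ (suc J))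
    scale n ≤n =
      let J , fits , max = greatest (λ j → ∣V∣ (Γ j) ≤? n) n (1 , ≤n) small
      in J , max 1 ≤n , fits , ≰⇒> (λ h → <-irrefl refl (max (suc J) h))
      where
      small : ∀ j → ∣V∣ (Γ j) ≤ n → j ≤ n
      small j h = ≤-trans (<⇒≤ (n<2^n j)) (≤-trans (2^-mono (m≤n+m j (d * g j))) (≤-trans (order-≥ j) h))

    -- For j ≥ i + 3 the radius 2^i is less than k / 4, and 4 bounds the density. For j ≤ i + 2
    -- there are at most R² labels of subdivided edges with R = 2^ρ, and min(v², 4v + R²) ≤ (4 + R)
    -- v follows by comparing v with R. The summand `M` serves the members with at most `M`
    -- vertices.
    shallow-density : ∀ i ρ → d * g (2 + i) + suc d ≤ ρ + ρ → ∀ {G} → 𝒢 G → ∀ {H} → IsShallowMinor (2 ^ i) H G →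
      ∣E∣ H ≤ (M + (4 + 2 ^ ρ)) * ∣V∣ H
    shallow-density i ρ _ {G} (inj₁ small) {H} (G′ , (f , f-inj , _) , φ , onto , _) = begin
      ∣E∣ H  ≤⟨ ∣E∣≤∣V∣² H ⟩
      ∣V∣ H * ∣V∣ H  ≤⟨ *-monoˡ-≤ (∣V∣ H) (≤-trans (Finₚ.injective⇒≤ section-injective) (≤-trans (Finₚ.injective⇒≤ f-inj) small)) ⟩
      M * ∣V∣ H  ≤⟨ *-monoˡ-≤ (∣V∣ H) (m≤m+n M (4 + 2 ^ ρ)) ⟩
      (M + (4 + 2 ^ ρ)) * ∣V∣ H  ∎
      where
      section : V H → V G′
      section y = proj₁ (onto y)
      section-injective : Injective _≡_ _≡_ section
      section-injective {x} {y} e = trans (sym (proj₂ (onto x) refl)) (trans (cong φ e) (proj₂ (onto y) refl))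
    shallow-density i ρ ρ≥ {G} (inj₂ (j , f , f-inj , f-adj)) {H} (G′ , (h , h-inj , h-adj) , φ , contr) =
      [ shallow , deep ]′ (≤-total (3 + i) j)
      where
      k = 2 ^ j
      R = 2 ^ ρ
      v = ∣V∣ H
      F : V G′ → V (Γ j)
      F = f ∘ h
      F-inj : Injective _≡_ _≡_ F
      F-inj = h-inj ∘ f-inj
      F-adj : ∀ a b → Adj G′ a b → Adj (Γ j) (F a) (F b)
      F-adj a b e = trans (sym (f-adj (h a) (h b))) (h-adj a b e)
      four : 4 * v ≤ (M + (4 + R)) * v
      four = *-monoˡ-≤ v (≤-trans (m≤m+n 4 R) (m≤n+m (4 + R) M))
      shallow : 3 + i ≤ j → ∣E∣ H ≤ (M + (4 + R)) * v
      shallow i≤j = ≤-trans (Minors.∣E∣≤shallow (2 ^ g j) d k (2 ^ i) G′ H F F-inj F-adj φ contr (begin-strict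
        2 * (2 ^ i + 2 ^ i)  ≡⟨ cong (λ x → 2 * (2 ^ i + x)) (+-identityʳ (2 ^ i)) ⟨
        2 ^ (2 + i)  <⟨ ^-monoʳ-< 2 (s≤s (s≤s z≤n)) i≤j ⟩
        2 ^ j  ∎)) four
      lines : j ≤ 2 + i → 2 * ((2 ^ g j) ^ d * d) ≤ R * R
      lines j≤ = begin
        2 * ((2 ^ g j) ^ d * d)  ≤⟨ *-monoʳ-≤ 2 (*-mono-≤ (≤-reflexive (trans (^-*-assoc 2 (g j) d) (cong (2 ^_) (*-comm (g j) d)))) (<⇒≤ (n<2^n d))) ⟩
        2 * (2 ^ (d * g j) * 2 ^ d)  ≡⟨ cong (2 *_) (^-distribˡ-+-* 2 (d * g j) d) ⟨
        2 ^ suc (d * g j + d)  ≤⟨ 2^-mono (≤-trans (≤-reflexive (sym (+-suc (d * g j) d))) (≤-trans (+-monoˡ-≤ (suc d) (*-monoʳ-≤ d (g-mono-≤ j≤))) ρ≥)) ⟩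
        2 ^ (ρ + ρ)  ≡⟨ ^-distribˡ-+-* 2 ρ ρ ⟩
        R * R  ∎
      dense : j ≤ 2 + i → ∣E∣ H ≤ (M + (4 + R)) * v
      dense j≤ = [ few , many ]′ (≤-total v R)
        where
        few : v ≤ R → ∣E∣ H ≤ (M + (4 + R)) * v
        few v≤R = ≤-trans (∣E∣≤∣V∣² H) (*-monoˡ-≤ v (≤-trans v≤R (≤-trans (m≤n+m R 4) (m≤n+m (4 + R) M))))
        many : R ≤ v → ∣E∣ H ≤ (M + (4 + R)) * v
        many R≤v = begin
          ∣E∣ H  ≤⟨ Minors.∣E∣≤deep (2 ^ g j) d k (2 ^ i) G′ H F F-inj F-adj φ contr ⟩
          4 * v + 2 * ((2 ^ g j) ^ d * d)  ≤⟨ +-monoʳ-≤ (4 * v) (≤-trans (lines j≤) (*-monoʳ-≤ R R≤v)) ⟩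
          4 * v + R * v  ≡⟨ *-distribʳ-+ v 4 R ⟨
          (4 + R) * v  ≤⟨ *-monoˡ-≤ v (m≤n+m (4 + R) M) ⟩
          (M + (4 + R)) * v  ∎
      deep : j ≤ 3 + i → ∣E∣ H ≤ (M + (4 + R)) * v
      deep j≤ with m≤n⇒m<n∨m≡n j≤
      ... | inj₁ j<   = dense (s≤s⁻¹ j<)
      ... | inj₂ refl = shallow ≤-refl

-- Arithmetic of rationals through numerators and denominators.

module Fractions where

  open import Data.Nat as ℕ using (ℕ; zero; suc; NonZero)
  import Data.Nat.Properties as ℕₚ
  open import Data.Integer as ℤ using (ℤ; +_; -[1+_])
  import Data.Integer.Properties as ℤₚ
  open import Data.Rational as ℚ hiding (Positive; NonZero)
  open import Data.Rational.Properties
  import Data.Rational.Unnormalised as ℚᵘ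
  import Data.Rational.Unnormalised.Properties as ℚᵘₚ
  open import Data.Rational.Solver using (module +-*-Solver)
  open import Data.Rational.Base using (+-*-rawSemiring)
  open import Algebra.Definitions.RawSemiring +-*-rawSemiring using (_^_)
  open import Data.Product using (∃; ∃-syntax; _×_; _,_)
  open import Data.Sum using (inj₁; inj₂)
  open import Relation.Nullary using (contradiction)
  open import Relation.Binary.PropositionalEquality

  -- The denominator is given by its predecessor, as in `mkℚᵘ`, which makes it visibly nonzero.
  frac : ℕ → ℕ → ℚ
  frac a b = + a / suc b

  ι : ℕ → ℚ
  ι n = frac n 0

  module _ (a b : ℕ) where
    toℚᵘ-frac : toℚᵘ (frac a b) ℚᵘ.≃ ℚᵘ.mkℚᵘ (+ a) b
    toℚᵘ-frac = toℚᵘ-fromℚᵘ (ℚᵘ.mkℚᵘ (+ a) b)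

  frac-<⁻ : ∀ a b c e → frac a b < frac c e → a ℕ.* suc e ℕ.< c ℕ.* suc b
  frac-<⁻ a b c e h = ℤₚ.drop‿+<+ (subst₂ ℤ._<_ (sym (ℤₚ.pos-* a (suc e))) (sym (ℤₚ.pos-* c (suc b)))
    (ℚᵘₚ.drop-*<* (ℚᵘₚ.<-respʳ-≃ (toℚᵘ-frac c e) (ℚᵘₚ.<-respˡ-≃ (toℚᵘ-frac a b) (toℚᵘ-mono-< h)))))

  frac-<⁺ : ∀ a b c e → a ℕ.* suc e ℕ.< c ℕ.* suc b → frac a b < frac c e
  frac-<⁺ a b c e h = toℚᵘ-cancel-< (ℚᵘₚ.<-respʳ-≃ (ℚᵘₚ.≃-sym (toℚᵘ-frac c e)) (ℚᵘₚ.<-respˡ-≃ (ℚᵘₚ.≃-sym (toℚᵘ-frac a b))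
    (ℚᵘ.*<* (subst₂ ℤ._<_ (ℤₚ.pos-* a (suc e)) (ℤₚ.pos-* c (suc b)) (ℤ.+<+ h)))))

  frac-≡ : ∀ a b c e → a ℕ.* suc e ≡ c ℕ.* suc b → frac a b ≡ frac c e
  frac-≡ a b c e h = toℚᵘ-injective (ℚᵘₚ.≃-trans (toℚᵘ-frac a b) (ℚᵘₚ.≃-trans
    (ℚᵘ.*≡* (trans (sym (ℤₚ.pos-* a (suc e))) (trans (cong +_ h) (ℤₚ.pos-* c (suc b))))) (ℚᵘₚ.≃-sym (toℚᵘ-frac c e))))

  frac-* : ∀ a b c e → frac a b * frac c e ≡ frac (a ℕ.* c) (e ℕ.+ b ℕ.* suc e)
  frac-* a b c e = toℚᵘ-injective (ℚᵘₚ.≃-trans (toℚᵘ-homo-* (frac a b) (frac c e))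
    (ℚᵘₚ.≃-trans (ℚᵘₚ.*-cong (toℚᵘ-frac a b) (toℚᵘ-frac c e))
      (ℚᵘₚ.≃-trans (ℚᵘ.*≡* (cong (ℤ._* (+ suc (e ℕ.+ b ℕ.* suc e))) (sym (ℤₚ.pos-* a c)))) (ℚᵘₚ.≃-sym (toℚᵘ-frac (a ℕ.* c) (e ℕ.+ b ℕ.* suc e))))))

  frac-+ : ∀ a b c e → frac a b + frac c e ≡ frac (a ℕ.* suc e ℕ.+ c ℕ.* suc b) (e ℕ.+ b ℕ.* suc e)
  frac-+ a b c e = toℚᵘ-injective (ℚᵘₚ.≃-trans (toℚᵘ-homo-+ (frac a b) (frac c e))
    (ℚᵘₚ.≃-trans (ℚᵘₚ.+-cong (toℚᵘ-frac a b) (toℚᵘ-frac c e))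
      (ℚᵘₚ.≃-trans (ℚᵘ.*≡* (cong (ℤ._* (+ suc (e ℕ.+ b ℕ.* suc e))) (sym (trans (ℤₚ.pos-+ (a ℕ.* suc e) _) (cong₂ ℤ._+_ (ℤₚ.pos-* a (suc e)) (ℤₚ.pos-* c (suc b)))))))
        (ℚᵘₚ.≃-sym (toℚᵘ-frac (a ℕ.* suc e ℕ.+ c ℕ.* suc b) (e ℕ.+ b ℕ.* suc e))))))

  as-frac : ∀ p → 0ℚ < p → ∃ λ n → (↥ p ≡ + suc n) × p ≡ frac (suc n) (ℚ.denominator-1 p)
  as-frac p@(mkℚ (+ zero) d c) h    = contradiction h λ { (*<* (ℤ.+<+ ())) }
  as-frac p@(mkℚ (+ suc n) d c) h   = n , refl , sym (↥p/↧p≡p p)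
  as-frac p@(mkℚ (-[1+ n ]) d c) h  = contradiction h λ { (*<* ()) }

  ι-mono-< : ∀ {m n} → m ℕ.< n → ι m < ι n
  ι-mono-< {m} {n} h = frac-<⁺ m 0 n 0 (subst₂ ℕ._<_ (sym (ℕₚ.*-identityʳ m)) (sym (ℕₚ.*-identityʳ n)) h)

  ι-mono-≤ : ∀ {m n} → m ℕ.≤ n → ι m ≤ ι n
  ι-mono-≤ {m} {n} h with ℕₚ.m≤n⇒m<n∨m≡n h
  ... | inj₁ lt   = <⇒≤ (ι-mono-< lt)
  ... | inj₂ refl = ≤-refl

  ι-* : ∀ m n → ι m * ι n ≡ ι (m ℕ.* n)
  ι-* m n = frac-* m 0 n 0

  ι-^ : ∀ m k → ι m ^ k ≡ ι (m ℕ.^ k)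
  ι-^ m zero    = refl
  ι-^ m (suc k) = trans (cong (ι m *_) (ι-^ m k)) (ι-* m (m ℕ.^ k))

  0≤ι : ∀ n → 0ℚ ≤ ι n
  0≤ι n = ι-mono-≤ {0} {n} ℕ.z≤n

  *-mono-<ˡ : ∀ {p q} r → 0ℚ < r → p < q → p * r < q * r
  *-mono-<ˡ r 0<r = *-monoˡ-<-pos r {{positive 0<r}}

  *-mono-≤ˡ : ∀ {p q} r → 0ℚ ≤ r → p ≤ q → p * r ≤ q * r
  *-mono-≤ˡ r 0≤r = *-monoʳ-≤-nonNeg r {{nonNegative 0≤r}}

  *-mono-≤ʳ : ∀ {p q} r → 0ℚ ≤ r → p ≤ q → r * p ≤ r * q
  *-mono-≤ʳ r 0≤r = *-monoˡ-≤-nonNeg r {{nonNegative 0≤r}}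

  *-mono-≤-nonNeg : ∀ {p q r s} → 0ℚ ≤ p → 0ℚ ≤ s → p ≤ q → r ≤ s → p * r ≤ q * s
  *-mono-≤-nonNeg {p} {q} {r} {s} 0≤p 0≤s p≤q r≤s = ≤-trans (*-mono-≤ʳ p 0≤p r≤s) (*-mono-≤ˡ s 0≤s p≤q)

  0≤^ : ∀ {p} n → 0ℚ ≤ p → 0ℚ ≤ p ^ n
  0≤^ zero    0≤p = 0≤ι 1
  0≤^ {p} (suc n) 0≤p = subst (_≤ p * p ^ n) (*-zeroʳ p) (*-mono-≤ʳ p 0≤p (0≤^ n 0≤p))

  ^-mono-≤ : ∀ {p q} n → 0ℚ ≤ p → p ≤ q → p ^ n ≤ q ^ n
  ^-mono-≤ zero    0≤p p≤q = ≤-refl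
  ^-mono-≤ (suc n) 0≤p p≤q = *-mono-≤-nonNeg 0≤p (0≤^ n (≤-trans 0≤p p≤q)) p≤q (^-mono-≤ n 0≤p p≤q)

  *-^-distrib : ∀ p q n → (p * q) ^ n ≡ p ^ n * q ^ n
  *-^-distrib p q zero    = refl
  *-^-distrib p q (suc n) = trans (cong (p * q *_) (*-^-distrib p q n))
    (solve 4 (λ a b x y → a :* b :* (x :* y) := a :* x :* (b :* y)) refl p q (p ^ n) (q ^ n))
    where open +-*-Solver

  -- Take x′ = m / y with x y < m < z. It creates the slack that strict inequalities between cuts
  -- consume.
  mul-dense : ∀ {x y z} → 0ℚ < y → x * y < z → ∃[ x′ ] x < x′ × x′ * y < z
  mul-dense {x} {y} {z} 0<y h with m , xy<m , m<z ← <-dense h = m * i ,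
    subst (_< m * i) (cancel x) (*-mono-<ˡ i 0<i xy<m) ,
    subst (_< z) (sym (trans (*-assoc m i y) (trans (cong (m *_) (*-inverseˡ y)) (*-identityʳ m)))) m<z
    where
    instance
      y>0 : ℚ.Positive y
      y>0 = positive 0<y
      y≢0 : ℚ.NonZero y
      y≢0 = pos⇒nonZero y
    i = 1/ y
    0<i : 0ℚ < i
    0<i = positive⁻¹ i {{1/pos⇒pos y}}
    cancel : ∀ x → x * y * i ≡ x
    cancel x = trans (*-assoc x y i) (trans (cong (x *_) (*-inverseʳ y)) (*-identityʳ x))

-- The integer sequence that fixes the side lengths of the grids.

module ExponentSequence where

  open Fractions
  open import Data.Nat
  open import Data.Nat.Properties
  open import Data.Nat.Tactic.RingSolver using (solve-∀)
  import Data.Rational as ℚ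
  import Data.Rational.Properties as ℚₚ
  open import Data.Product using (Σ; Σ-syntax; ∃-syntax; _×_; _,_; proj₁; proj₂)
  open import Data.Sum using ([_,_]′)
  open import Function.Bundles using (Equivalence)
  open import Relation.Nullary using (contradiction)
  open import Relation.Binary using (tri<; tri≈; tri>)
  open import Relation.Binary.PropositionalEquality

  module Cuts {x : Cut} (isReal : IsReal x) where
    open IsReal isReal public

    lower-down : ∀ {p q} → p ℚ.< q → lower x q → lower x p
    lower-down {p} {q} p<q l = Equivalence.from (lower-rounded p) (q , p<q , l)

    lower-up : ∀ {p} → lower x p → ∃[ q ] p ℚ.< q × lower x q
    lower-up {p} = Equivalence.to (lower-rounded p)

    lower<upper : ∀ {p q} → lower x p → upper x q → p ℚ.< q
    lower<upper {p} {q} l u with ℚₚ.<-cmp p q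
    ... | tri< p<q _ _  = p<q
    ... | tri≈ _ refl _ = contradiction (l , u) (disjoint p)
    ... | tri> _ _ q<p  = contradiction (lower-down q<p l , u) (disjoint q)

  -- The hypothesis `steep` says d ε ≥ 2. When g and j both grow by one, g + j grows by 2, and ε (d
  -- g + j) keeps up.
  module Exponent (ε : ℝ) (ε≤1 : lower ⌊ ε ⌋ ≼ lower (fromℚ ℚ.1ℚ)) (D : ℕ)
    (steep : ∀ a b → upper ⌊ ε ⌋ (frac a b) → 2 * suc b ≤ suc D * a) where

    open Cuts (isReal ε)

    private
      d = suc D

    Lo Up : ℕ → ℕ → Set
    Lo a b = lower ⌊ ε ⌋ (frac a b)
    Up a b = upper ⌊ ε ⌋ (frac a b)

    lo<up : ∀ a b c e → Lo a b → Up c e → a * suc e < c * suc b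
    lo<up a b c e l u = frac-<⁻ a b c e (lower<upper l u)

    lo≤1 : ∀ a b → Lo a b → a ≤ suc b
    lo≤1 a b l = <⇒≤ (subst₂ _<_ (*-identityʳ a) (*-identityˡ (suc b)) (frac-<⁻ a b 1 0 (ε≤1 _ l)))

    -- The sequence g is chosen such that ε · (d · g j + j) stays within a bounded
    -- distance of g j + j, i.e. 2^(D · g j) is of order (2^(d · g j + j))^(1 - ε).
    record Approximates (j g : ℕ) : Set where
      field
        below : ∀ a b → Up a b → (g + j) * suc b ≤ a * (d * g + j) + suc b
        above : ∀ a b → Lo a b → a * (d * g + j) ≤ (g + j + d) * suc b

    open Approximates public

    initially : Approximates 0 0
    initially .below a b u = z≤n
    initially .above a b l = ≤-trans (≤-reflexive (trans (cong (a *_) (trans (+-identityʳ (d * 0)) (*-zeroʳ d))) (*-zeroʳ a))) z≤n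

    module _ (j g : ℕ) (approx : Approximates j g) where
      private
        A = d * g + j

      -- Here g + j < ε (A + 1), so adding one to j alone keeps the lower estimate; the upper one
      -- survives because ε ≤ 1.
      keep : Lo (g + j) A → Approximates (suc j) g
      keep l .below a b u = begin
        (g + suc j) * suc b  ≡⟨ cong (_* suc b) (+-suc g j) ⟩
        suc b + (g + j) * suc b  ≤⟨ +-monoʳ-≤ (suc b) (<⇒≤ (lo<up (g + j) A a b l u)) ⟩
        suc b + a * suc A  ≡⟨ trans (+-comm (suc b) _) (cong (λ e → a * e + suc b) (sym (+-suc (d * g) j))) ⟩
        a * (d * g + suc j) + suc b  ∎
        where open ≤-Reasoning
      keep l .above a b l′ = begin
        a * (d * g + suc j)  ≡⟨ trans (cong (a *_) (+-suc (d * g) j)) (*-suc a A) ⟩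
        a + a * A  ≤⟨ +-mono-≤ (lo≤1 a b l′) (above approx a b l′) ⟩
        suc b + (g + j + d) * suc b  ≡⟨ cong (λ e → (e + d) * suc b) (+-suc g j) ⟨
        (g + suc j + d) * suc b  ∎
        where open ≤-Reasoning

      -- The lower estimate survives by `steep`. For the upper one ε (A + 1) < g + j + 1, and the
      -- increment of g adds at most ε d ≤ d.
      raise : Up (suc (g + j)) A → Approximates (suc j) (suc g)
      raise u .below a b u′ = begin
        (suc g + suc j) * suc b  ≡⟨ eq₁ g j (suc b) ⟩
        (g + j) * suc b + 2 * suc b  ≤⟨ +-mono-≤ (below approx a b u′) (steep a b u′) ⟩
        a * A + suc b + d * a  ≤⟨ m≤m+n _ a ⟩
        a * A + suc b + d * a + a  ≡⟨ eq₂ a d g j (suc b) ⟩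
        a * (d * suc g + suc j) + suc b  ∎
        where
        open ≤-Reasoning
        eq₁ : ∀ g j s → (suc g + suc j) * s ≡ (g + j) * s + 2 * s
        eq₁ = solve-∀
        eq₂ : ∀ a d g j s → a * (d * g + j) + s + d * a + a ≡ a * (d * suc g + suc j) + s
        eq₂ = solve-∀
      raise u .above a b l = begin
        a * (d * suc g + suc j)  ≡⟨ eq₁ a d g j ⟩
        a * suc A + a * d  ≤⟨ +-mono-≤ (<⇒≤ (lo<up a b (suc (g + j)) A l u)) (*-monoˡ-≤ d (lo≤1 a b l)) ⟩
        suc (g + j) * suc b + suc b * d  ≤⟨ m≤n+m _ (suc b) ⟩
        suc b + (suc (g + j) * suc b + suc b * d) ≡⟨ eq₂ g j d (suc b) ⟩
        (suc g + suc j + d) * suc b  ∎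
        where
        open ≤-Reasoning
        eq₁ : ∀ a d g j → a * (d * suc g + suc j) ≡ a * suc (d * g + j) + a * d
        eq₁ = solve-∀
        eq₂ : ∀ g j d s → s + (suc (g + j) * s + s * d) ≡ (suc g + suc j + d) * s
        eq₂ = solve-∀

      -- The cases of `keep` and `raise` overlap, so locatedness of ε at two neighbouring fractions
      -- decides between them.
      next : Σ[ g′ ∈ ℕ ] (g ≤ g′ × g′ ≤ suc g) × Approximates (suc j) g′
      next = [ (λ l → g , (≤-refl , n≤1+n g) , keep l) , (λ u → suc g , (n≤1+n g , ≤-refl) , raise u) ]′
        (located (frac (g + j) A) (frac (suc (g + j)) A)
          (frac-<⁺ (g + j) A (suc (g + j)) A (*-monoˡ-< (suc A) (n<1+n (g + j)))))

    sequence : ∀ j → Σ ℕ (Approximates j)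
    sequence zero    = 0 , initially
    sequence (suc j) = let g′ , _ , approx = next j (proj₁ (sequence j)) (proj₂ (sequence j)) in g′ , approx

    g : ℕ → ℕ
    g j = proj₁ (sequence j)

    g-approximates : ∀ j → Approximates j (g j)
    g-approximates j = proj₂ (sequence j)

    g-mono : ∀ j → g j ≤ g (suc j)
    g-mono j = proj₁ (proj₁ (proj₂ (next j (g j) (g-approximates j))))

    g-step : ∀ j → g (suc j) ≤ suc (g j)
    g-step j = proj₂ (proj₁ (proj₂ (next j (g j) (g-approximates j))))

-- The separation function of the family has order n^(1 - ε).

module SeparationGrowth where

  open GridFamily
  open Fractions
  open ExponentSequence
  open import Data.Nat as ℕ using (ℕ; suc; NonZero)
  import Data.Nat.Properties as ℕₚ
  open import Data.Nat.Tactic.RingSolver using (solve-∀)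
  open import Data.Integer as ℤ using (ℤ; +_; -[1+_])
  import Data.Integer.Properties as ℤₚ
  open import Data.Rational as ℚ
    using (ℚ; mkℚ; 0ℚ; 1ℚ; _+_; _*_; _-_; -_; _/_; _<_; _≤_; _<?_; _≤?_; ↥_; ↧ₙ_; positive;
      nonNegative)
  open import Data.Rational.Properties
  import Data.Rational.Unnormalised.Properties as ℚᵘₚ
  open import Data.Rational.Solver using (module +-*-Solver)
  open import Data.Rational.Base using (+-*-rawSemiring)
  open import Algebra.Definitions.RawSemiring +-*-rawSemiring using (_^_)
  open import Data.Product using (Σ-syntax; ∃₂; ∃-syntax; _×_; _,_; proj₁; proj₂)
  open import Data.Sum using (_⊎_; inj₁; inj₂; [_,_]′)
  open import Function.Bundles using (mk⇔)
  open import Relation.Nullary using (Dec; yes; no; contradiction)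
  open import Relation.Nullary.Decidable using (toWitness)
  open import Relation.Binary.PropositionalEquality

  isReal-fromℚ : ∀ p → IsReal (fromℚ p)
  isReal-fromℚ p = record
    { lower-inhabited = p - 1ℚ , subst (p - 1ℚ <_) (+-identityʳ p) (+-monoʳ-< p (toWitness {a? = - 1ℚ <? 0ℚ} _))
    ; upper-inhabited = p + 1ℚ , subst (_< p + 1ℚ) (+-identityʳ p) (+-monoʳ-< p (toWitness {a? = 0ℚ <? 1ℚ} _))
    ; lower-rounded   = λ q → mk⇔ (λ h → let m , q<m , m<p = <-dense h in m , q<m , m<p) (λ { (r , q<r , r<p) → <-trans q<r r<p })
    ; upper-rounded   = λ q → mk⇔ (λ h → let m , p<m , m<q = <-dense h in m , m<q , p<m) (λ { (r , r<q , p<r) → <-trans p<r r<q })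
    ; disjoint        = λ { q (q<p , p<q) → <-asym q<p p<q }
    ; located         = λ q r q<r → decide q r q<r (q <? p)
    }
    where
    decide : ∀ q r → q < r → Dec (q < p) → q < p ⊎ p < r
    decide q r q<r (yes q<p) = inj₁ q<p
    decide q r q<r (no q≮p)  = inj₂ (≤-<-trans (≮⇒≥ q≮p) q<r)

  -- For nonnegative intervals a c is the least of the four corner products.
  ⊛-lower : ∀ {x y q} a b c e → lower x a → upper x b → lower y c → upper y e →
    0ℚ ≤ a → a ≤ b → 0ℚ ≤ c → c ≤ e → q < a * c → lower (x ⊛ y) q
  ⊛-lower a b c e la ub lc ue 0≤a a≤b 0≤c c≤e q<ac =
    a , b , c , e , (la , ub , lc , ue) , q<ac ,
    <-≤-trans q<ac (*-mono-≤-nonNeg 0≤a 0≤e ≤-refl c≤e) ,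
    <-≤-trans q<ac (*-mono-≤-nonNeg 0≤a 0≤c a≤b ≤-refl) ,
    <-≤-trans q<ac (*-mono-≤-nonNeg 0≤a 0≤e a≤b c≤e)
    where 0≤e = ≤-trans 0≤c c≤e

  frac-≡⁻ : ∀ a b c e → frac a b ≡ frac c e → a ℕ.* suc e ≡ c ℕ.* suc b
  frac-≡⁻ a b c e h = ℤₚ.+-injective (trans (ℤₚ.pos-* a (suc e)) (trans
    (ℚᵘₚ.drop-*≡* (ℚᵘₚ.≃-trans (ℚᵘₚ.≃-sym (toℚᵘ-frac a b)) (ℚᵘₚ.≃-trans (toℚᵘ-cong h) (toℚᵘ-frac c e))))
    (sym (ℤₚ.pos-* c (suc b)))))

  -- Interval multiplication also asks for upper bounds of its factors. Any large integer serves: Q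
  -- > n^m already gives Q^s > n^m, where s is the denominator of p.
  pow-upper : ∀ n .{{_ : NonZero n}} x p m → ↥ p ≡ + m → upper x p → ∀ B →
    ∃[ Q ] B ℕ.≤ Q × upper (n ^ᴿ x) (ι Q)
  pow-upper n x p m eq up B = Q , ℕₚ.≤-trans (ℕₚ.m≤n+m B (n ℕ.^ m)) (ℕₚ.n≤1+n _) ,
    p , up , ι-mono-< {0} {Q} (ℕ.s≤s ℕ.z≤n) ,
    subst₂ _<_ (cong (n ^ℤ_) (sym eq)) (sym (ι-^ Q (↧ₙ p))) (ι-mono-< {n ℕ.^ m} {Q ℕ.^ ↧ₙ p}
      (ℕₚ.<-≤-trans (ℕ.s≤s (ℕₚ.m≤m+n (n ℕ.^ m) B)) (ℕₚ.m≤m*n Q (Q ℕ.^ ℚ.denominator-1 p) {{ℕₚ.m^n≢0 Q (ℚ.denominator-1 p)}})))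
    where Q = suc (n ℕ.^ m ℕ.+ B)

  reciprocal-* : ∀ N .{{_ : NonZero N}} → + 1 / N * ι N ≡ 1ℚ
  reciprocal-* (suc k) = trans (frac-* 1 k (suc k) 0) (frac-≡ (1 ℕ.* suc k) (0 ℕ.+ k ℕ.* 1) 1 0 (eq k))
    where
    eq : ∀ k → 1 ℕ.* suc k ℕ.* 1 ≡ 1 ℕ.* suc (0 ℕ.+ k ℕ.* 1)
    eq = solve-∀

  reciprocal-≤1 : ∀ N .{{_ : NonZero N}} → + 1 / N ≤ 1ℚ
  reciprocal-≤1 (suc k) = ≮⇒≥ (λ h → contradiction (frac-<⁻ 1 0 1 k h) (ℕₚ.≤⇒≯ (ℕₚ.≤-trans (ℕ.s≤s ℕ.z≤n) (ℕₚ.m≤n*m (suc k) 1))))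

  0≤reciprocal : ∀ N .{{_ : NonZero N}} → 0ℚ ≤ + 1 / N
  0≤reciprocal (suc k) = <⇒≤ (frac-<⁺ 0 0 1 k (ℕ.s≤s ℕ.z≤n))

  module Theta (ε : ℝ) (ε>0 : Positive ε) (ε≤1 : lower ⌊ ε ⌋ ≼ lower (fromℚ 1ℚ)) (D : ℕ)
    (steep : ∀ a b → upper ⌊ ε ⌋ (frac a b) → 2 ℕ.* suc b ℕ.≤ suc D ℕ.* a) where

    open Exponent ε ε≤1 D steep public
    open Family D g g-mono g-step public
    open Cuts (isReal ε)

    x : Cut
    x = fromℚ 1ℚ ⊖ ⌊ ε ⌋

    lower-complement : ∀ {b U} → upper ⌊ ε ⌋ b → b < U → lower x (1ℚ - U)
    lower-complement {b} {U} up b<U = let m , b<m , m<U = <-dense b<U in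
      1ℚ - (m - b) , b ,
      subst (1ℚ - (m - b) <_) (+-identityʳ 1ℚ) (+-monoʳ-< 1ℚ (neg-antimono-< (subst (_< m - b) (+-inverseʳ b) (+-monoˡ-< (- b) b<m)))) ,
      up ,
      subst (1ℚ - U <_) (sym (solve 2 (λ m b → con 1ℚ :- (m :- b) :- b := con 1ℚ :- m) refl m b)) (+-monoʳ-< 1ℚ (neg-antimono-< m<U))
      where open +-*-Solver

    upper-x-2 : upper x (frac 2 0)
    upper-x-2 = frac 3 1 , 0ℚ , toWitness {a? = 1ℚ <? frac 3 1} _ , ε>0 , toWitness {a? = frac 3 1 - 0ℚ <? frac 2 0} _

    complement-sum : ∀ {p} m s → p ≡ frac m s → lower x p →
      ∃₂ λ a b → Up a b × m ℕ.* suc b ℕ.+ a ℕ.* suc s ℕ.< suc s ℕ.* suc b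
    complement-sum {p} m s refl (a , b , a<1 , up , p<a-b) =
      let n , _ , b≡ = as-frac b (lower<upper ε>0 up)
          bd = ℚ.denominator-1 b
          up′ = subst (upper ⌊ ε ⌋) b≡ up
          p+b<1 = <-trans (subst (p + b <_) (trans (+-assoc a (- b) b) (trans (cong (λ t → a + t) (+-inverseˡ b)) (+-identityʳ a))) (+-monoˡ-< b p<a-b)) a<1
          sum<1 = subst (_< 1ℚ) (trans (cong (λ t → p + t) b≡) (frac-+ m s (suc n) bd)) p+b<1
      in suc n , bd , up′ , subst₂ ℕ._<_ (ℕₚ.*-identityʳ _) (ℕₚ.*-identityˡ _) (frac-<⁻ (m ℕ.* suc bd ℕ.+ suc n ℕ.* suc s) (bd ℕ.+ s ℕ.* suc bd) 1 0 sum<1)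

    module _ (J : ℕ) where
      private
        G = g J ℕ.+ J
        A = volume J
        e = D ℕ.* g J

        volume≡ : A ≡ e ℕ.+ G
        volume≡ = eq D (g J) J
          where
          eq : ∀ D g J → suc D ℕ.* g ℕ.+ J ≡ D ℕ.* g ℕ.+ (g ℕ.+ J)
          eq = solve-∀

      -- Since A = e + G and ε A ≥ G - 1, it follows that (1 - ε) A ≤ e + 1; this is stated for
      -- rationals p < 1 - ε.
      exponent-≤ : ∀ {p} m s → p ≡ frac m s → lower x p → m ℕ.* A ℕ.≤ (e ℕ.+ 1) ℕ.* suc s × m ℕ.≤ suc s
      exponent-≤ m s p≡ l = let a , b , up , lt = complement-sum m s p≡ l in
        bound a (suc b) (below (g-approximates J) a b up) (ℕₚ.<⇒≤ lt) ,
        ℕₚ.*-cancelʳ-≤ m (suc s) (suc b) (ℕₚ.≤-trans (ℕₚ.m≤m+n _ _) (ℕₚ.<⇒≤ lt))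
        where
        open ℕₚ.≤-Reasoning
        S = suc s
        bound : ∀ a B .{{_ : NonZero B}} → G ℕ.* B ℕ.≤ a ℕ.* A ℕ.+ B → m ℕ.* B ℕ.+ a ℕ.* S ℕ.≤ S ℕ.* B →
          m ℕ.* A ℕ.≤ (e ℕ.+ 1) ℕ.* S
        bound a B h₁ h₂ = ℕₚ.*-cancelʳ-≤ (m ℕ.* A) _ B (ℕₚ.+-cancelʳ-≤ (G ℕ.* B ℕ.* S) _ _ (begin
          m ℕ.* A ℕ.* B ℕ.+ G ℕ.* B ℕ.* S  ≤⟨ ℕₚ.+-monoʳ-≤ (m ℕ.* A ℕ.* B) (ℕₚ.*-monoˡ-≤ S h₁) ⟩
          m ℕ.* A ℕ.* B ℕ.+ (a ℕ.* A ℕ.+ B) ℕ.* S  ≡⟨ eq₁ m A B a S ⟩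
          (m ℕ.* B ℕ.+ a ℕ.* S) ℕ.* A ℕ.+ B ℕ.* S  ≤⟨ ℕₚ.+-monoˡ-≤ (B ℕ.* S) (ℕₚ.*-monoˡ-≤ A h₂) ⟩
          S ℕ.* B ℕ.* A ℕ.+ B ℕ.* S  ≡⟨ cong (λ A → S ℕ.* B ℕ.* A ℕ.+ B ℕ.* S) volume≡ ⟩
          S ℕ.* B ℕ.* (e ℕ.+ G) ℕ.+ B ℕ.* S  ≡⟨ eq₂ S B e G ⟩
          (e ℕ.+ 1) ℕ.* S ℕ.* B ℕ.+ G ℕ.* B ℕ.* S  ∎))
          where
          eq₁ : ∀ m A B a S → m ℕ.* A ℕ.* B ℕ.+ (a ℕ.* A ℕ.+ B) ℕ.* S ≡ (m ℕ.* B ℕ.+ a ℕ.* S) ℕ.* A ℕ.+ B ℕ.* S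
          eq₁ = solve-∀
          eq₂ : ∀ S B e G → S ℕ.* B ℕ.* (e ℕ.+ G) ℕ.+ B ℕ.* S ≡ (e ℕ.+ 1) ℕ.* S ℕ.* B ℕ.+ G ℕ.* B ℕ.* S
          eq₂ = solve-∀

      module _ (n : ℕ) .{{_ : NonZero n}} (n≤ : n ℕ.≤ 2 ℕ.^ (A ℕ.+ E₀)) where

        Y : ℕ
        Y = 2 ℕ.^ (e ℕ.+ 1 ℕ.+ E₀)

        pow-≤ : ∀ p → lower x p → n ^ℤ (↥ p) ≤ ι (Y ℕ.^ ↧ₙ p)
        pow-≤ p@(mkℚ (+ m) s c) l = ι-mono-≤ (begin
          n ℕ.^ m  ≤⟨ ℕₚ.^-monoˡ-≤ m n≤ ⟩
          (2 ℕ.^ (A ℕ.+ E₀)) ℕ.^ m  ≡⟨ ℕₚ.^-*-assoc 2 (A ℕ.+ E₀) m ⟩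
          2 ℕ.^ ((A ℕ.+ E₀) ℕ.* m)  ≤⟨ 2^-mono (begin
            (A ℕ.+ E₀) ℕ.* m  ≡⟨ eq A E₀ m ⟩
            m ℕ.* A ℕ.+ E₀ ℕ.* m  ≤⟨ ℕₚ.+-mono-≤ (proj₁ bounds) (ℕₚ.*-monoʳ-≤ E₀ (proj₂ bounds)) ⟩
            (e ℕ.+ 1) ℕ.* suc s ℕ.+ E₀ ℕ.* suc s  ≡⟨ ℕₚ.*-distribʳ-+ (suc s) (e ℕ.+ 1) E₀ ⟨
            (e ℕ.+ 1 ℕ.+ E₀) ℕ.* suc s  ∎) ⟩
          2 ℕ.^ ((e ℕ.+ 1 ℕ.+ E₀) ℕ.* suc s)  ≡⟨ ℕₚ.^-*-assoc 2 (e ℕ.+ 1 ℕ.+ E₀) (suc s) ⟨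
          Y ℕ.^ suc s  ∎)
          where
          open ℕₚ.≤-Reasoning
          bounds = exponent-≤ {p} m s (sym (↥p/↧p≡p p)) l
          eq : ∀ A E m → (A ℕ.+ E) ℕ.* m ≡ m ℕ.* A ℕ.+ E ℕ.* m
          eq = solve-∀
        pow-≤ (mkℚ -[1+ m ] s c) l = ≤-trans (reciprocal-≤1 (n ℕ.^ suc m) {{ℕₚ.m^n≢0 n (suc m)}})
          (ι-mono-≤ {1} (ℕ.>-nonZero⁻¹ (Y ℕ.^ suc s) {{ℕₚ.m^n≢0 Y (suc s) {{ℕₚ.m^n≢0 2 (e ℕ.+ 1 ℕ.+ E₀)}}}}))

        power-≤ : ∀ z → lower (n ^ᴿ x) z → z ≤ ι Y
        power-≤ z (p , l , h) = ≮⇒≥ (λ Y<z → [ (λ z<0 → <-irrefl refl (<-trans (≤-<-trans (0≤ι Y) Y<z) z<0)) ,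
          (λ z^<n → <-irrefl refl (<-≤-trans z^<n (≤-trans (pow-≤ p l)
            (≤-trans (≤-reflexive (sym (ι-^ Y (↧ₙ p)))) (^-mono-≤ (↧ₙ p) (0≤ι Y) (<⇒≤ Y<z)))))) ]′ h)

        module _ (J≥1 : 1 ℕ.≤ J) (n≥ : 2 ℕ.^ A ℕ.≤ n) where
          private
            A′ = ℕ.pred A

            A≥1 : 1 ℕ.≤ A
            A≥1 = ℕₚ.≤-trans J≥1 (ℕₚ.m≤n+m J (d ℕ.* g J))

            A≡ : suc A′ ≡ A
            A≡ = ℕₚ.suc-pred A {{ℕ.>-nonZero A≥1}}

          -- Since ε A ≤ G + d, the rational u / A lies above ε, with room for locatedness and
          -- strictness. The exponent p′ = 1 - u / A satisfies p′ A = e - (d + 3), so n^p′ exceeds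
          -- 2^(e - v) for this v, even if p′ is negative.
          v u : ℕ
          v = suc ((d ℕ.+ 3) ℕ.* suc E₀)
          u = G ℕ.+ d ℕ.+ 3

          upper-near : upper ⌊ ε ⌋ (frac (G ℕ.+ d ℕ.+ 2) A′)
          upper-near = [ (λ l → contradiction (above (g-approximates J) (G ℕ.+ d ℕ.+ 1) A′ l) (ℕₚ.<⇒≱
                (subst (λ a → (G ℕ.+ d) ℕ.* a ℕ.< (G ℕ.+ d ℕ.+ 1) ℕ.* A) (sym A≡)
                  (ℕₚ.*-monoˡ-< A {{ℕ.>-nonZero A≥1}} (ℕₚ.m<m+n (G ℕ.+ d) (ℕ.s≤s ℕ.z≤n)))))) ,
              (λ up → up) ]′
            (located (frac (G ℕ.+ d ℕ.+ 1) A′) (frac (G ℕ.+ d ℕ.+ 2) A′)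
              (frac-<⁺ (G ℕ.+ d ℕ.+ 1) A′ (G ℕ.+ d ℕ.+ 2) A′ (ℕₚ.*-monoˡ-< (suc A′) (ℕₚ.+-monoʳ-< (G ℕ.+ d) (ℕₚ.n<1+n 1)))))

          U p′ : ℚ
          U  = frac u A′
          p′ = 1ℚ - U

          p′-lower : lower x p′
          p′-lower = lower-complement upper-near (frac-<⁺ (G ℕ.+ d ℕ.+ 2) A′ u A′ (ℕₚ.*-monoˡ-< (suc A′) (ℕₚ.+-monoʳ-< (G ℕ.+ d) (ℕₚ.n<1+n 2))))

          p′+U : p′ + U ≡ 1ℚ
          p′+U = solve 1 (λ U → con 1ℚ :- U :+ U := con 1ℚ) refl U
            where open +-*-Solver

          B : ℕ
          B = 2 ℕ.^ v

          instance
            B≢0 : NonZero B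
            B≢0 = ℕₚ.m^n≢0 2 v

          -- The number 2^(e - v), a lower bound for n^(1 - ε).
          z : ℚ
          z = ι (2 ℕ.^ e) * (+ 1 / B)

          z*B : z * ι B ≡ ι (2 ℕ.^ e)
          z*B = trans (*-assoc (ι (2 ℕ.^ e)) (+ 1 / B) (ι B)) (trans (cong (ι (2 ℕ.^ e) *_) (reciprocal-* B)) (*-identityʳ _))

          0≤z : 0ℚ ≤ z
          0≤z = subst (_≤ z) (*-zeroʳ (ι (2 ℕ.^ e))) (*-mono-≤ʳ (ι (2 ℕ.^ e)) (0≤ι (2 ℕ.^ e)) (0≤reciprocal B))

          z≤ : z ≤ ι (2 ℕ.^ e)
          z≤ = subst (z ≤_) (*-identityʳ (ι (2 ℕ.^ e))) (*-mono-≤ʳ (ι (2 ℕ.^ e)) (0≤ι (2 ℕ.^ e)) (reciprocal-≤1 B))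

          z^*B^ : ∀ S → z ^ S * ι (B ℕ.^ S) ≡ ι (2 ℕ.^ (e ℕ.* S))
          z^*B^ S = begin
            z ^ S * ι (B ℕ.^ S)  ≡⟨ cong (z ^ S *_) (ι-^ B S) ⟨
            z ^ S * ι B ^ S  ≡⟨ *-^-distrib z (ι B) S ⟨
            (z * ι B) ^ S  ≡⟨ cong (_^ S) z*B ⟩
            ι (2 ℕ.^ e) ^ S  ≡⟨ ι-^ (2 ℕ.^ e) S ⟩
            ι ((2 ℕ.^ e) ℕ.^ S)  ≡⟨ cong ι (ℕₚ.^-*-assoc 2 e S) ⟩
            ι (2 ℕ.^ (e ℕ.* S))  ∎
            where open ≡-Reasoning

          u≤ : u ℕ.≤ A ℕ.+ (d ℕ.+ 3)
          u≤ = subst₂ ℕ._≤_ (sym (ℕₚ.+-assoc G d 3)) refl (ℕₚ.+-monoˡ-≤ (d ℕ.+ 3) (subst (G ℕ.≤_) (sym volume≡) (ℕₚ.m≤n+m G e)))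

          e+u : e ℕ.+ u ≡ A ℕ.+ (d ℕ.+ 3)
          e+u = trans (cong (e ℕ.+_) (ℕₚ.+-assoc G d 3)) (trans (sym (ℕₚ.+-assoc e G (d ℕ.+ 3))) (cong (ℕ._+ (d ℕ.+ 3)) (sym volume≡)))

          d+3<v : d ℕ.+ 3 ℕ.< v
          d+3<v = ℕ.s≤s (ℕₚ.m≤m*n (d ℕ.+ 3) (suc E₀))

          -- The case p′ = m / S ≥ 0 of 2^(e - v) < n^p′ with denominators cleared; n ≥ 2^A is used.
          case-pos : ∀ m S .{{_ : NonZero S}} → m ℕ.* A ℕ.+ u ℕ.* S ≡ S ℕ.* A → 2 ℕ.^ (e ℕ.* S) ℕ.< n ℕ.^ m ℕ.* B ℕ.^ S
          case-pos m S h = begin-strict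
            2 ℕ.^ (e ℕ.* S)  <⟨ ℕₚ.^-monoʳ-< 2 (ℕ.s≤s (ℕ.s≤s ℕ.z≤n)) exps ⟩
            2 ℕ.^ (A ℕ.* m ℕ.+ v ℕ.* S)  ≡⟨ ℕₚ.^-distribˡ-+-* 2 (A ℕ.* m) (v ℕ.* S) ⟩
            2 ℕ.^ (A ℕ.* m) ℕ.* 2 ℕ.^ (v ℕ.* S)  ≡⟨ cong₂ ℕ._*_ (ℕₚ.^-*-assoc 2 A m) (ℕₚ.^-*-assoc 2 v S) ⟨
            (2 ℕ.^ A) ℕ.^ m ℕ.* B ℕ.^ S  ≤⟨ ℕₚ.*-monoˡ-≤ (B ℕ.^ S) (ℕₚ.^-monoˡ-≤ m n≥) ⟩
            n ℕ.^ m ℕ.* B ℕ.^ S  ∎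
            where
            open ℕₚ.≤-Reasoning
            exps : e ℕ.* S ℕ.< A ℕ.* m ℕ.+ v ℕ.* S
            exps = ℕₚ.+-cancelʳ-< (u ℕ.* S) _ _ (begin-strict
              e ℕ.* S ℕ.+ u ℕ.* S  ≡⟨ ℕₚ.*-distribʳ-+ S e u ⟨
              (e ℕ.+ u) ℕ.* S  ≡⟨ cong (ℕ._* S) e+u ⟩
              (A ℕ.+ (d ℕ.+ 3)) ℕ.* S  <⟨ ℕₚ.*-monoˡ-< S (ℕₚ.+-monoʳ-< A d+3<v) ⟩
              (A ℕ.+ v) ℕ.* S  ≡⟨ eq₁ A v S ⟩
              S ℕ.* A ℕ.+ v ℕ.* S  ≡⟨ cong (ℕ._+ v ℕ.* S) h ⟨
              m ℕ.* A ℕ.+ u ℕ.* S ℕ.+ v ℕ.* S  ≡⟨ eq₂ m A u S v ⟩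
              A ℕ.* m ℕ.+ v ℕ.* S ℕ.+ u ℕ.* S  ∎)
              where
              eq₁ : ∀ A v S → (A ℕ.+ v) ℕ.* S ≡ S ℕ.* A ℕ.+ v ℕ.* S
              eq₁ = solve-∀
              eq₂ : ∀ m A u S v → m ℕ.* A ℕ.+ u ℕ.* S ℕ.+ v ℕ.* S ≡ A ℕ.* m ℕ.+ v ℕ.* S ℕ.+ u ℕ.* S
              eq₂ = solve-∀

          -- The case p′ = - m / S, which arises when e < d + 3. Now n must not be too large: n ≤
          -- 2^(A + E₀) together with m ≤ (d + 3) S accounts for the factor 1 + E₀ in v.
          case-neg : ∀ m S .{{_ : NonZero S}} → S ℕ.* A ℕ.+ m ℕ.* A ≡ u ℕ.* S → 2 ℕ.^ (e ℕ.* S) ℕ.* n ℕ.^ m ℕ.< B ℕ.^ S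
          case-neg m S h = begin-strict
            2 ℕ.^ (e ℕ.* S) ℕ.* n ℕ.^ m  ≤⟨ ℕₚ.*-monoʳ-≤ (2 ℕ.^ (e ℕ.* S)) (ℕₚ.^-monoˡ-≤ m n≤) ⟩
            2 ℕ.^ (e ℕ.* S) ℕ.* (2 ℕ.^ (A ℕ.+ E₀)) ℕ.^ m  ≡⟨ cong (2 ℕ.^ (e ℕ.* S) ℕ.*_) (ℕₚ.^-*-assoc 2 (A ℕ.+ E₀) m) ⟩
            2 ℕ.^ (e ℕ.* S) ℕ.* 2 ℕ.^ ((A ℕ.+ E₀) ℕ.* m)  ≡⟨ ℕₚ.^-distribˡ-+-* 2 (e ℕ.* S) ((A ℕ.+ E₀) ℕ.* m) ⟨
            2 ℕ.^ (e ℕ.* S ℕ.+ (A ℕ.+ E₀) ℕ.* m)  <⟨ ℕₚ.^-monoʳ-< 2 (ℕ.s≤s (ℕ.s≤s ℕ.z≤n)) exps ⟩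
            2 ℕ.^ (v ℕ.* S)  ≡⟨ ℕₚ.^-*-assoc 2 v S ⟨
            B ℕ.^ S  ∎
            where
            open ℕₚ.≤-Reasoning
            k = d ℕ.+ 3
            mA≤ : m ℕ.* A ℕ.≤ k ℕ.* S
            mA≤ = ℕₚ.+-cancelˡ-≤ (S ℕ.* A) _ _ (begin
              S ℕ.* A ℕ.+ m ℕ.* A  ≡⟨ h ⟩
              u ℕ.* S  ≤⟨ ℕₚ.*-monoˡ-≤ S u≤ ⟩
              (A ℕ.+ k) ℕ.* S  ≡⟨ eq A k S ⟩
              S ℕ.* A ℕ.+ k ℕ.* S  ∎)
              where
              eq : ∀ A k S → (A ℕ.+ k) ℕ.* S ≡ S ℕ.* A ℕ.+ k ℕ.* S
              eq = solve-∀
            m≤ : m ℕ.≤ k ℕ.* S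
            m≤ = ℕₚ.≤-trans (ℕₚ.m≤m*n m A {{ℕ.>-nonZero A≥1}}) mA≤
            exps : e ℕ.* S ℕ.+ (A ℕ.+ E₀) ℕ.* m ℕ.< v ℕ.* S
            exps = ℕₚ.+-cancelˡ-< (S ℕ.* A) _ _ (begin-strict
              S ℕ.* A ℕ.+ (e ℕ.* S ℕ.+ (A ℕ.+ E₀) ℕ.* m)  ≡⟨ eq₁ S A e E₀ m ⟩
              e ℕ.* S ℕ.+ (S ℕ.* A ℕ.+ m ℕ.* A) ℕ.+ E₀ ℕ.* m  ≡⟨ cong (λ t → e ℕ.* S ℕ.+ t ℕ.+ E₀ ℕ.* m) h ⟩
              e ℕ.* S ℕ.+ u ℕ.* S ℕ.+ E₀ ℕ.* m  ≡⟨ cong (ℕ._+ E₀ ℕ.* m) (ℕₚ.*-distribʳ-+ S e u) ⟨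
              (e ℕ.+ u) ℕ.* S ℕ.+ E₀ ℕ.* m  ≡⟨ cong (λ t → t ℕ.* S ℕ.+ E₀ ℕ.* m) e+u ⟩
              (A ℕ.+ k) ℕ.* S ℕ.+ E₀ ℕ.* m  ≤⟨ ℕₚ.+-monoʳ-≤ ((A ℕ.+ k) ℕ.* S) (ℕₚ.*-monoʳ-≤ E₀ m≤) ⟩
              (A ℕ.+ k) ℕ.* S ℕ.+ E₀ ℕ.* (k ℕ.* S)  ≡⟨ eq₂ A k S E₀ ⟩
              S ℕ.* A ℕ.+ k ℕ.* suc E₀ ℕ.* S  <⟨ ℕₚ.+-monoʳ-< (S ℕ.* A) (ℕₚ.*-monoˡ-< S (ℕₚ.n<1+n (k ℕ.* suc E₀))) ⟩
              S ℕ.* A ℕ.+ v ℕ.* S  ∎)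
              where
              eq₁ : ∀ S A e E m → S ℕ.* A ℕ.+ (e ℕ.* S ℕ.+ (A ℕ.+ E) ℕ.* m) ≡ e ℕ.* S ℕ.+ (S ℕ.* A ℕ.+ m ℕ.* A) ℕ.+ E ℕ.* m
              eq₁ = solve-∀
              eq₂ : ∀ A k S E → (A ℕ.+ k) ℕ.* S ℕ.+ E ℕ.* (k ℕ.* S) ≡ S ℕ.* A ℕ.+ k ℕ.* suc E ℕ.* S
              eq₂ = solve-∀

          pow-> : ∀ p → p + U ≡ 1ℚ → z ^ ↧ₙ p < n ^ℤ (↥ p)
          pow-> p@(mkℚ (+ m) s c) h = *-cancelʳ-<-nonNeg (ι W) {{nonNegative (0≤ι W)}} (subst₂ _<_ (sym (z^*B^ S)) (sym (ι-* (n ℕ.^ m) W))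
            (ι-mono-< (case-pos m S (subst (λ A → m ℕ.* A ℕ.+ u ℕ.* S ≡ S ℕ.* A) A≡ nat))))
            where
            S = suc s
            W = B ℕ.^ S
            nat : m ℕ.* suc A′ ℕ.+ u ℕ.* S ≡ S ℕ.* suc A′
            nat = trans (sym (ℕₚ.*-identityʳ _)) (trans (frac-≡⁻ (m ℕ.* suc A′ ℕ.+ u ℕ.* S) (A′ ℕ.+ s ℕ.* suc A′) 1 0
              (trans (sym (frac-+ m s u A′)) (trans (cong (_+ U) (↥p/↧p≡p p)) h))) (ℕₚ.*-identityˡ _))
          pow-> (mkℚ -[1+ m ] s c) h = *-cancelʳ-<-nonNeg (ι W) {{nonNegative (0≤ι W)}} (*-cancelʳ-<-nonNeg (ι N) {{nonNegative (0≤ι N)}}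
            (subst₂ _<_ (sym lhs) (sym rhs) (ι-mono-< (case-neg (suc m) S (subst (λ A → S ℕ.* A ℕ.+ suc m ℕ.* A ≡ u ℕ.* S) A≡ nat)))))
            where
            S = suc s
            W = B ℕ.^ S
            N = n ℕ.^ suc m
            instance
              N≢0 : NonZero N
              N≢0 = ℕₚ.m^n≢0 n (suc m)
            q : ℚ
            q = mkℚ (+ suc m) s c
            U≡ : 1ℚ + q ≡ U
            U≡ = trans (cong (_+ q) (sym h)) (trans (solve 2 (λ q U → (:- q) :+ U :+ q := U) refl q U) refl)
              where open +-*-Solver
            nat : S ℕ.* suc A′ ℕ.+ suc m ℕ.* suc A′ ≡ u ℕ.* S
            nat = begin
              S ℕ.* suc A′ ℕ.+ suc m ℕ.* suc A′  ≡⟨ eq S (suc m) (suc A′) ⟩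
              (1 ℕ.* S ℕ.+ suc m ℕ.* 1) ℕ.* suc A′  ≡⟨ frac-≡⁻ (1 ℕ.* S ℕ.+ suc m ℕ.* 1) (s ℕ.+ 0 ℕ.* suc s) u A′ (trans (sym (frac-+ 1 0 (suc m) s)) (trans (cong (λ t → 1ℚ + t) (↥p/↧p≡p q)) U≡)) ⟩
              u ℕ.* suc (s ℕ.+ 0 ℕ.* suc s)  ≡⟨ cong (λ t → u ℕ.* suc t) (ℕₚ.+-identityʳ s) ⟩
              u ℕ.* S  ∎
              where
              open ≡-Reasoning
              eq : ∀ S m A → S ℕ.* A ℕ.+ m ℕ.* A ≡ (1 ℕ.* S ℕ.+ m ℕ.* 1) ℕ.* A
              eq = solve-∀
            lhs : z ^ S * ι W * ι N ≡ ι (2 ℕ.^ (e ℕ.* S) ℕ.* N)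
            lhs = trans (cong (_* ι N) (z^*B^ S)) (ι-* (2 ℕ.^ (e ℕ.* S)) N)
            rhs : + 1 / N * ι W * ι N ≡ ι W
            rhs = trans (solve 3 (λ a b c → a :* b :* c := a :* c :* b) refl (+ 1 / N) (ι W) (ι N))
              (trans (cong (_* ι W) (reciprocal-* N)) (*-identityˡ (ι W)))
              where open +-*-Solver

          power-> : lower (n ^ᴿ x) z
          power-> = p′ , p′-lower , inj₂ (pow-> p′ p′+U)

    -- From n^(1 - ε) ≤ T 2^(1 + E₀) and T ≤ c₀ `sep n`; the lower constant is 1 / (κ + 1).
    κ : ℕ
    κ = c₀ ℕ.* 2 ℕ.^ (1 ℕ.+ E₀)

    -- The factor v₀ cancels the denominator of `z`, whence C₁ z = C₀ T.
    v₀ C₁ : ℕ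
    v₀ = 2 ℕ.^ suc ((d ℕ.+ 3) ℕ.* suc E₀)
    C₁ = C₀ ℕ.* v₀

    lower-bound : ∀ n .{{_ : NonZero n}} → ∣V∣ (Γ 1) ℕ.≤ n →
      lower (fromℚ (frac 1 κ) ⊛ n ^ᴿ x) ≼ lower (fromℕ (sep n))
    lower-bound n N≤n q (a , b , z , _ , (a<c , c<b , lz , _) , q<az , _ , q<bz , _) =
      let J , _ , ≤n , n< = scale n N≤n
          z≤Y = power-≤ J n (n-≤ n J n<) z lz
      in decide (0ℚ ≤? z) (J , ≤n , n< , z≤Y)
      where
      decide : Dec (0ℚ ≤ z) → (Σ[ J ∈ ℕ ] ∣V∣ (Γ J) ℕ.≤ n × n ℕ.< ∣V∣ (Γ (suc J)) × z ≤ ι (2 ℕ.^ (D ℕ.* g J ℕ.+ 1 ℕ.+ E₀))) → q < ι (sep n)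
      -- Elements of the lower cut of the power may be negative; then q < b z < 0 with b > 0.
      decide (no z≱0) _ = <-≤-trans (<-trans q<bz (subst (b * z <_) (*-zeroʳ b)
        (*-monoʳ-<-pos b {{positive (<-trans (frac-<⁺ 0 0 1 κ (ℕ.s≤s ℕ.z≤n)) c<b)}} (≰⇒> z≱0)))) (0≤ι (sep n))
      decide (yes z≥0) (J , ≤n , n< , z≤Y) = <-≤-trans q<az (≤-trans (*-mono-≤ˡ z z≥0 (<⇒≤ a<c))
        (≤-trans (*-mono-≤ʳ (frac 1 κ) (<⇒≤ (frac-<⁺ 0 0 1 κ (ℕ.s≤s ℕ.z≤n))) z≤Y)
          (≮⇒≥ (λ h → ℕₚ.<⇒≱ (frac-<⁻ (sep n) 0 (1 ℕ.* Y₀) (0 ℕ.+ κ ℕ.* 1) (subst (ι (sep n) <_) (frac-* 1 κ Y₀ 0) h)) bound))))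
        where
        T Y₀ : ℕ
        T  = 2 ℕ.^ (D ℕ.* g J)
        Y₀ = 2 ℕ.^ (D ℕ.* g J ℕ.+ 1 ℕ.+ E₀)
        open ℕₚ.≤-Reasoning
        bound : 1 ℕ.* Y₀ ℕ.* 1 ℕ.≤ sep n ℕ.* suc (0 ℕ.+ κ ℕ.* 1)
        bound = begin
          1 ℕ.* Y₀ ℕ.* 1  ≡⟨ trans (ℕₚ.*-identityʳ _) (ℕₚ.*-identityˡ Y₀) ⟩
          Y₀  ≡⟨ trans (cong (2 ℕ.^_) (ℕₚ.+-assoc (D ℕ.* g J) 1 E₀)) (ℕₚ.^-distribˡ-+-* 2 (D ℕ.* g J) (1 ℕ.+ E₀)) ⟩
          T ℕ.* 2 ℕ.^ (1 ℕ.+ E₀)  ≤⟨ ℕₚ.*-monoˡ-≤ (2 ℕ.^ (1 ℕ.+ E₀)) (sep-≥ n J n< ≤n) ⟩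
          c₀ ℕ.* sep n ℕ.* 2 ℕ.^ (1 ℕ.+ E₀)  ≡⟨ eq c₀ (sep n) (2 ℕ.^ (1 ℕ.+ E₀)) ⟩
          sep n ℕ.* (0 ℕ.+ κ ℕ.* 1)  ≤⟨ ℕₚ.*-monoʳ-≤ (sep n) (ℕₚ.n≤1+n _) ⟩
          sep n ℕ.* suc (0 ℕ.+ κ ℕ.* 1)  ∎
          where
          eq : ∀ a b c → a ℕ.* b ℕ.* c ≡ b ℕ.* (0 ℕ.+ a ℕ.* c ℕ.* 1)
          eq = solve-∀

    upper-bound : ∀ n .{{_ : NonZero n}} → ∣V∣ (Γ 1) ℕ.≤ n →
      lower (fromℕ (sep n)) ≼ lower (fromℚ (ι (suc C₁)) ⊛ n ^ᴿ x)
    upper-bound n N≤n q q<s =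
      let J , J≥1 , ≤n , n< = scale n N≤n
          n≤ = n-≤ n J n<
          n≥ = ℕₚ.≤-trans (order-≥ J) ≤n
          T = 2 ℕ.^ (D ℕ.* g J)
          Q , T≤Q , up = pow-upper n x (frac 2 0) 2 refl upper-x-2 T
          z₀ = z J n n≤ J≥1 n≥
          C₁z : ι C₁ * z₀ ≡ ι (C₀ ℕ.* T)
          C₁z = trans (cong (_* z₀) (sym (ι-* C₀ v₀))) (trans (*-assoc (ι C₀) (ι v₀) z₀)
            (trans (cong (ι C₀ *_) (trans (*-comm (ι v₀) z₀) (z*B J n n≤ J≥1 n≥))) (ι-* C₀ T)))
      in ⊛-lower (ι C₁) (ι (2 ℕ.+ C₁)) z₀ (ι Q)
        (ι-mono-< (ℕₚ.n<1+n C₁)) (ι-mono-< (ℕₚ.n<1+n (suc C₁))) (power-> J n n≤ J≥1 n≥) up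
        (0≤ι C₁) (ι-mono-≤ (ℕₚ.m≤n+m C₁ 2)) (0≤z J n n≤ J≥1 n≥)
        (≤-trans (z≤ J n n≤ J≥1 n≥) (ι-mono-≤ T≤Q))
        (<-≤-trans q<s (≤-trans (ι-mono-≤ (sep-≤ n J n<)) (≤-reflexive (sym C₁z))))

    sep-Θ : IsΘPow sep x
    sep-Θ = real (fromℚ (frac 1 κ)) (isReal-fromℚ (frac 1 κ)) , real (fromℚ (ι (suc C₁))) (isReal-fromℚ (ι (suc C₁))) ,
      frac-<⁺ 0 0 1 κ (ℕ.s≤s ℕ.z≤n) , ι-mono-< {0} {suc C₁} (ℕ.s≤s ℕ.z≤n) ,
      ∣V∣ (Γ 1) , λ n N≤n → lower-bound n N≤n , upper-bound n N≤n

-- The density of shallow minors grows more slowly than r^b.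

module DensityGrowth where

  open GridFamily
  open Fractions
  open ExponentSequence
  open SeparationGrowth
  open import Data.Nat as ℕ using (ℕ; zero; suc; NonZero)
  import Data.Nat.Properties as ℕₚ
  open import Data.Nat.Tactic.RingSolver using (solve-∀)
  open import Data.Integer as ℤ using (ℤ; +_)
  open import Data.Rational as ℚ using (ℚ; 0ℚ; 1ℚ; _+_; _*_; _/_; _<_; _≤_; ↥_; ↧ₙ_)
  open import Data.Rational.Properties
  open import Data.Rational.Base using (+-*-rawSemiring)
  open import Algebra.Definitions.RawSemiring +-*-rawSemiring using (_^_)
  open import Data.Product using (∃-syntax; _×_; _,_; proj₁; proj₂)
  open import Data.Sum using (inj₂)
  open import Relation.Nullary using (¬_)
  open import Relation.Binary.PropositionalEquality

  density-< : ∀ B E n .{{_ : NonZero n}} → ι B < + E / n → B ℕ.* n ℕ.< E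
  density-< B E (suc n) h = subst (B ℕ.* suc n ℕ.<_) (ℕₚ.*-identityʳ E) (frac-<⁻ B 0 E n h)

  m+n≤2^m*n : ∀ m n .{{_ : NonZero n}} → m ℕ.+ n ℕ.≤ 2 ℕ.^ m ℕ.* n
  m+n≤2^m*n m n = begin
    m ℕ.+ n  ≤⟨ ℕₚ.+-monoˡ-≤ n (ℕₚ.m≤m*n m n) ⟩
    m ℕ.* n ℕ.+ n  ≡⟨ ℕₚ.+-comm (m ℕ.* n) n ⟩
    suc m ℕ.* n  ≤⟨ ℕₚ.*-monoˡ-≤ n (n<2^n m) ⟩
    2 ℕ.^ m ℕ.* n  ∎
    where open ℕₚ.≤-Reasoning

  halve : ∀ x → ∃[ ρ ] x ℕ.≤ ρ ℕ.+ ρ × ρ ℕ.+ ρ ℕ.≤ suc x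
  halve zero          = 0 , ℕ.z≤n , ℕ.z≤n
  halve (suc zero)    = 1 , ℕ.s≤s ℕ.z≤n , ℕₚ.≤-refl
  halve (suc (suc x)) with ρ , l , u ← halve x = suc ρ ,
    subst (suc (suc x) ℕ.≤_) (cong suc (sym (ℕₚ.+-suc ρ ρ))) (ℕ.s≤s (ℕ.s≤s l)) ,
    subst (ℕ._≤ suc (suc (suc x))) (cong suc (sym (ℕₚ.+-suc ρ ρ))) (ℕ.s≤s (ℕ.s≤s u))

  power-attained : ∀ (c b : ℝ) n .{{_ : NonZero n}} {c₁ q} Z β → lower ⌊ c ⌋ c₁ → 0ℚ < c₁ → lower ⌊ b ⌋ q → 0ℚ < q →
    ι Z ^ ↧ₙ q < n ^ℤ (↥ q) → ι β < c₁ * ι Z → lower (⌊ c ⌋ ⊛ n ^ᴿ ⌊ b ⌋) (ι β)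
  power-attained c b n {c₁} {q} Z β lc₁ 0<c₁ b>q q>0 power small =
    let c₂ , uc₂ = Cuts.upper-inhabited (isReal c)
        p , up = Cuts.upper-inhabited (isReal b)
        m , ↥p , _ = as-frac p (<-trans q>0 (Cuts.lower<upper (isReal b) b>q up))
        R , Z≤R , uR = pow-upper n ⌊ b ⌋ p (suc m) ↥p up Z
    in ⊛-lower c₁ c₂ (ι Z) (ι R) lc₁ uc₂ (q , b>q , inj₂ power) uR
         (<⇒≤ 0<c₁) (<⇒≤ (Cuts.lower<upper (isReal c) lc₁ uc₂)) (0≤ι Z) (ι-mono-≤ Z≤R) small

  -- q = P / Q and A / B < ε with (2q + 1) · A / B > 1; the grid dimension is 2PB + 1.
  module Omega (ε : ℝ) (ε>0 : Positive ε) (ε≤1 : lower ⌊ ε ⌋ ≼ lower (fromℚ 1ℚ))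
    (b : ℝ) (q : ℚ) (P′ : ℕ) (↥q : ↥ q ≡ + suc P′) (b>q : lower ⌊ b ⌋ q) (q>0 : 0ℚ < q)
    (A b₀ : ℕ) (ε>A/B : lower ⌊ ε ⌋ (frac A b₀))
    (gap : suc b₀ ℕ.* ↧ₙ q ℕ.< A ℕ.* (2 ℕ.* suc P′ ℕ.+ ↧ₙ q)) where

    private
      P Q B D : ℕ
      P = suc P′
      Q = ↧ₙ q
      B = suc b₀
      D = 2 ℕ.* P ℕ.* B

      A≥1 : 1 ℕ.≤ A
      A≥1 = ℕₚ.n≢0⇒n>0 (λ { refl → ℕₚ.n≮0 gap })

      2B≤dA : 2 ℕ.* B ℕ.≤ suc D ℕ.* A
      2B≤dA = begin
        2 ℕ.* B  ≤⟨ ℕₚ.*-monoˡ-≤ B (ℕₚ.m≤m*n 2 P) ⟩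
        D  ≤⟨ ℕₚ.n≤1+n D ⟩
        suc D  ≤⟨ ℕₚ.m≤m*n (suc D) A {{ℕ.>-nonZero A≥1}} ⟩
        suc D ℕ.* A  ∎
        where open ℕₚ.≤-Reasoning

      steep : ∀ a b → upper ⌊ ε ⌋ (frac a b) → 2 ℕ.* suc b ℕ.≤ suc D ℕ.* a
      steep a b up = ℕₚ.*-cancelʳ-≤ (2 ℕ.* suc b) (suc D ℕ.* a) B (begin
        2 ℕ.* suc b ℕ.* B  ≡⟨ eq₁ (suc b) B ⟩
        2 ℕ.* B ℕ.* suc b  ≤⟨ ℕₚ.*-monoˡ-≤ (suc b) 2B≤dA ⟩
        suc D ℕ.* A ℕ.* suc b  ≡⟨ ℕₚ.*-assoc (suc D) A (suc b) ⟩
        suc D ℕ.* (A ℕ.* suc b)  ≤⟨ ℕₚ.*-monoʳ-≤ (suc D) (ℕₚ.<⇒≤ (frac-<⁻ A b₀ a b (Cuts.lower<upper (isReal ε) ε>A/B up))) ⟩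
        suc D ℕ.* (a ℕ.* B)  ≡⟨ ℕₚ.*-assoc (suc D) a B ⟨
        suc D ℕ.* a ℕ.* B  ∎)
        where
        open ℕₚ.≤-Reasoning
        eq₁ : ∀ s B → 2 ℕ.* s ℕ.* B ≡ 2 ℕ.* B ℕ.* s
        eq₁ = solve-∀

    open Theta ε ε>0 ε≤1 D steep
      using (d; g; above; g-approximates; M; 𝒢; hereditary; sep; sep-isSeparationFunction; sep-Θ; shallow-density)

    private
      -- The numerator of d (A / B) - 1, which stands for the denominator d ε - 1 of λ.
      κ₁ : ℕ
      κ₁ = d ℕ.* A ℕ.∸ B

      κ₁≡ : B ℕ.+ κ₁ ≡ d ℕ.* A
      κ₁≡ = ℕₚ.m+[n∸m]≡n (ℕₚ.≤-trans (ℕₚ.m≤n*m B 2) 2B≤dA)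

    module _ (K : ℕ) where

      -- Collects all terms in the comparison of `growth` that do not depend on i.
      threshold : ℕ
      threshold = 2 ℕ.* B ℕ.* d ℕ.+ B ℕ.* d ℕ.* d ℕ.+ κ₁ ℕ.* K

      -- If it failed, eliminating y = d g j from `above` would give d i (A(2P + Q) - BQ) ≤ 2PB i +
      -- `threshold`. The bracket is at least 1 by `gap`, so d = 2PB + 1 forces i ≤ `threshold`:
      -- this is the origin of the dimension.
      growth : ∀ i → threshold ℕ.< i → d ℕ.* g (2 ℕ.+ Q ℕ.* i) ℕ.+ K ℕ.≤ 2 ℕ.* P ℕ.* i
      growth i large = ℕₚ.≮⇒≥ (λ h → ℕₚ.<⇒≱ large (ℕₚ.+-cancelʳ-≤ (D ℕ.* i) i threshold (conclude (ℕₚ.<⇒≤ h))))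
        where
        open ℕₚ.≤-Reasoning
        j = 2 ℕ.+ Q ℕ.* i
        y = d ℕ.* g j
        W = 2 ℕ.* P ℕ.* i
        step₁ : A ℕ.* d ℕ.* y ℕ.+ A ℕ.* d ℕ.* j ℕ.≤ B ℕ.* y ℕ.+ B ℕ.* d ℕ.* j ℕ.+ B ℕ.* d ℕ.* d
        step₁ = begin
          A ℕ.* d ℕ.* y ℕ.+ A ℕ.* d ℕ.* j  ≡⟨ eq₁ A d y j ⟩
          d ℕ.* (A ℕ.* (y ℕ.+ j))  ≤⟨ ℕₚ.*-monoʳ-≤ d (above (g-approximates j) A b₀ ε>A/B) ⟩
          d ℕ.* ((g j ℕ.+ j ℕ.+ d) ℕ.* B)  ≡⟨ eq₂ d (g j) j B ⟩
          B ℕ.* y ℕ.+ B ℕ.* d ℕ.* j ℕ.+ B ℕ.* d ℕ.* d  ∎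
          where
          eq₁ : ∀ A d y j → A ℕ.* d ℕ.* y ℕ.+ A ℕ.* d ℕ.* j ≡ d ℕ.* (A ℕ.* (y ℕ.+ j))
          eq₁ = solve-∀
          eq₂ : ∀ d g j B → d ℕ.* ((g ℕ.+ j ℕ.+ d) ℕ.* B) ≡ B ℕ.* (d ℕ.* g) ℕ.+ B ℕ.* d ℕ.* j ℕ.+ B ℕ.* d ℕ.* d
          eq₂ = solve-∀
        step₂ : κ₁ ℕ.* y ℕ.+ A ℕ.* d ℕ.* j ℕ.≤ B ℕ.* d ℕ.* j ℕ.+ B ℕ.* d ℕ.* d
        step₂ = ℕₚ.+-cancelˡ-≤ (B ℕ.* y) _ _ (begin
          B ℕ.* y ℕ.+ (κ₁ ℕ.* y ℕ.+ A ℕ.* d ℕ.* j)  ≡⟨ eq₁ B κ₁ y (A ℕ.* d ℕ.* j) ⟩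
          (B ℕ.+ κ₁) ℕ.* y ℕ.+ A ℕ.* d ℕ.* j  ≡⟨ cong (λ t → t ℕ.* y ℕ.+ A ℕ.* d ℕ.* j) (trans κ₁≡ (ℕₚ.*-comm d A)) ⟩
          A ℕ.* d ℕ.* y ℕ.+ A ℕ.* d ℕ.* j  ≤⟨ step₁ ⟩
          B ℕ.* y ℕ.+ B ℕ.* d ℕ.* j ℕ.+ B ℕ.* d ℕ.* d  ≡⟨ ℕₚ.+-assoc (B ℕ.* y) (B ℕ.* d ℕ.* j) (B ℕ.* d ℕ.* d) ⟩
          B ℕ.* y ℕ.+ (B ℕ.* d ℕ.* j ℕ.+ B ℕ.* d ℕ.* d)  ∎)
          where
          eq₁ : ∀ B κ y c → B ℕ.* y ℕ.+ (κ ℕ.* y ℕ.+ c) ≡ (B ℕ.+ κ) ℕ.* y ℕ.+ c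
          eq₁ = solve-∀
        conclude : W ℕ.≤ y ℕ.+ K → i ℕ.+ D ℕ.* i ℕ.≤ threshold ℕ.+ D ℕ.* i
        conclude h = ℕₚ.+-cancelˡ-≤ (B ℕ.* d ℕ.* (Q ℕ.* i)) _ _ (begin
          B ℕ.* d ℕ.* (Q ℕ.* i) ℕ.+ (i ℕ.+ D ℕ.* i)  ≡⟨ eq₁ B Q D i ⟩
          suc (B ℕ.* Q) ℕ.* d ℕ.* i  ≤⟨ ℕₚ.*-monoˡ-≤ i (ℕₚ.*-monoˡ-≤ d gap) ⟩
          A ℕ.* (2 ℕ.* P ℕ.+ Q) ℕ.* d ℕ.* i  ≡⟨ eq₂ A P Q d i ⟩
          d ℕ.* A ℕ.* W ℕ.+ A ℕ.* d ℕ.* (Q ℕ.* i)  ≡⟨ cong (λ t → t ℕ.* W ℕ.+ A ℕ.* d ℕ.* (Q ℕ.* i)) κ₁≡ ⟨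
          (B ℕ.+ κ₁) ℕ.* W ℕ.+ A ℕ.* d ℕ.* (Q ℕ.* i)  ≡⟨ cong (ℕ._+ A ℕ.* d ℕ.* (Q ℕ.* i)) (ℕₚ.*-distribʳ-+ W B κ₁) ⟩
          B ℕ.* W ℕ.+ κ₁ ℕ.* W ℕ.+ A ℕ.* d ℕ.* (Q ℕ.* i)  ≤⟨ ℕₚ.+-mono-≤ (ℕₚ.+-monoʳ-≤ (B ℕ.* W) (ℕₚ.*-monoʳ-≤ κ₁ h))
                                                                              (ℕₚ.*-monoʳ-≤ (A ℕ.* d) (ℕₚ.m≤n+m (Q ℕ.* i) 2)) ⟩
          B ℕ.* W ℕ.+ κ₁ ℕ.* (y ℕ.+ K) ℕ.+ A ℕ.* d ℕ.* j  ≡⟨ eq₃ (B ℕ.* W) κ₁ y K (A ℕ.* d ℕ.* j) ⟩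
          B ℕ.* W ℕ.+ κ₁ ℕ.* K ℕ.+ (κ₁ ℕ.* y ℕ.+ A ℕ.* d ℕ.* j)  ≤⟨ ℕₚ.+-monoʳ-≤ (B ℕ.* W ℕ.+ κ₁ ℕ.* K) step₂ ⟩
          B ℕ.* W ℕ.+ κ₁ ℕ.* K ℕ.+ (B ℕ.* d ℕ.* j ℕ.+ B ℕ.* d ℕ.* d)  ≡⟨ eq₄ B P Q d i κ₁ K ⟩
          B ℕ.* d ℕ.* (Q ℕ.* i) ℕ.+ (threshold ℕ.+ D ℕ.* i)  ∎)
          where
          eq₁ : ∀ B Q D i → B ℕ.* suc D ℕ.* (Q ℕ.* i) ℕ.+ (i ℕ.+ D ℕ.* i) ≡ suc (B ℕ.* Q) ℕ.* suc D ℕ.* i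
          eq₁ = solve-∀
          eq₂ : ∀ A P Q d i → A ℕ.* (2 ℕ.* P ℕ.+ Q) ℕ.* d ℕ.* i ≡ d ℕ.* A ℕ.* (2 ℕ.* P ℕ.* i) ℕ.+ A ℕ.* d ℕ.* (Q ℕ.* i)
          eq₂ = solve-∀
          eq₃ : ∀ w κ y K c → w ℕ.+ κ ℕ.* (y ℕ.+ K) ℕ.+ c ≡ w ℕ.+ κ ℕ.* K ℕ.+ (κ ℕ.* y ℕ.+ c)
          eq₃ = solve-∀
          eq₄ : ∀ B P Q d i κ K → B ℕ.* (2 ℕ.* P ℕ.* i) ℕ.+ κ ℕ.* K ℕ.+ (B ℕ.* d ℕ.* (2 ℕ.+ Q ℕ.* i) ℕ.+ B ℕ.* d ℕ.* d)
            ≡ B ℕ.* d ℕ.* (Q ℕ.* i) ℕ.+ (2 ℕ.* B ℕ.* d ℕ.+ B ℕ.* d ℕ.* d ℕ.+ κ ℕ.* K ℕ.+ 2 ℕ.* P ℕ.* B ℕ.* i)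
          eq₄ = solve-∀

    module _ (N : ℕ) where

      -- With r = 2^(Q i) the power r^(P / Q) = 2^(P i) is an integer. The slack K absorbs the
      -- constant `M` + 4 of the density bound, the denominator bd + 1 of the constant c₁, and the
      -- rounding of ρ.
      K index r : ℕ → ℕ
      K bd = 2 ℕ.* (M ℕ.+ 4 ℕ.+ suc bd) ℕ.+ d ℕ.+ 4
      index bd = suc (threshold (K bd) ℕ.+ N)
      r bd = 2 ℕ.^ (Q ℕ.* index bd)
      r≢0 : ∀ bd → NonZero (r bd)
      r≢0 bd = ℕₚ.m^n≢0 2 (Q ℕ.* index bd)

      -- The number 2^m is half of r^q, which makes it strictly smaller. As ρ is about y / 2,
      -- `growth` puts 2^ρ below 2^m by any prescribed constant factor.
      choose : ∀ bd → N ℕ.≤ r bd × (∃[ m ] ∃[ ρ ] d ℕ.* g (2 ℕ.+ Q ℕ.* index bd) ℕ.+ suc d ℕ.≤ ρ ℕ.+ ρ ×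
        (M ℕ.+ (4 ℕ.+ 2 ℕ.^ ρ)) ℕ.* suc bd ℕ.< 2 ℕ.^ m × suc m ≡ P ℕ.* index bd)
      choose bd = N≤ , m , ρ , ρ≥ , bound , refl
        where
        open ℕₚ.≤-Reasoning
        half = halve (d ℕ.* g (2 ℕ.+ Q ℕ.* index bd) ℕ.+ suc d)
        ρ = proj₁ half
        ρ≥ = proj₁ (proj₂ half)
        ρ≤ = proj₂ (proj₂ half)
        i = index bd
        y = d ℕ.* g (2 ℕ.+ Q ℕ.* i)
        γ = suc bd
        m = threshold (K bd) ℕ.+ N ℕ.+ P′ ℕ.* i
        N≤ : N ℕ.≤ r bd
        N≤ = begin
          N  ≤⟨ ℕₚ.m≤n+m N (suc (threshold (K bd))) ⟩
          i  ≤⟨ ℕₚ.m≤n*m i Q ⟩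
          Q ℕ.* i  ≤⟨ ℕₚ.<⇒≤ (n<2^n (Q ℕ.* i)) ⟩
          r bd  ∎
        exps : M ℕ.+ 4 ℕ.+ γ ℕ.+ ρ ℕ.≤ m
        exps = ℕₚ.*-cancelˡ-≤ 2 (ℕₚ.+-cancelʳ-≤ 2 _ _ (begin
          2 ℕ.* (M ℕ.+ 4 ℕ.+ γ ℕ.+ ρ) ℕ.+ 2  ≡⟨ eq₁ (M ℕ.+ 4 ℕ.+ γ) ρ ⟩
          2 ℕ.* (M ℕ.+ 4 ℕ.+ γ) ℕ.+ 2 ℕ.+ (ρ ℕ.+ ρ)  ≤⟨ ℕₚ.+-monoʳ-≤ (2 ℕ.* (M ℕ.+ 4 ℕ.+ γ) ℕ.+ 2) ρ≤ ⟩
          2 ℕ.* (M ℕ.+ 4 ℕ.+ γ) ℕ.+ 2 ℕ.+ suc (y ℕ.+ suc d)  ≡⟨ eq₂ (2 ℕ.* (M ℕ.+ 4 ℕ.+ γ)) y d ⟩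
          y ℕ.+ K bd  ≤⟨ growth (K bd) i (ℕ.s≤s (ℕₚ.m≤m+n (threshold (K bd)) N)) ⟩
          2 ℕ.* P ℕ.* i  ≡⟨ ℕₚ.*-assoc 2 P i ⟩
          2 ℕ.* suc m  ≡⟨ eq₃ m ⟩
          2 ℕ.* m ℕ.+ 2  ∎))
          where
          eq₁ : ∀ a ρ → 2 ℕ.* (a ℕ.+ ρ) ℕ.+ 2 ≡ 2 ℕ.* a ℕ.+ 2 ℕ.+ (ρ ℕ.+ ρ)
          eq₁ = solve-∀
          eq₂ : ∀ a y d → a ℕ.+ 2 ℕ.+ suc (y ℕ.+ suc d) ≡ y ℕ.+ (a ℕ.+ d ℕ.+ 4)
          eq₂ = solve-∀
          eq₃ : ∀ m → 2 ℕ.* suc m ≡ 2 ℕ.* m ℕ.+ 2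
          eq₃ = solve-∀
        bound : (M ℕ.+ (4 ℕ.+ 2 ℕ.^ ρ)) ℕ.* γ ℕ.< 2 ℕ.^ m
        bound = begin-strict
          (M ℕ.+ (4 ℕ.+ 2 ℕ.^ ρ)) ℕ.* γ  ≡⟨ cong (ℕ._* γ) (ℕₚ.+-assoc M 4 (2 ℕ.^ ρ)) ⟨
          (M ℕ.+ 4 ℕ.+ 2 ℕ.^ ρ) ℕ.* γ  ≤⟨ ℕₚ.*-monoˡ-≤ γ (m+n≤2^m*n (M ℕ.+ 4) (2 ℕ.^ ρ) {{ℕₚ.m^n≢0 2 ρ}}) ⟩
          2 ℕ.^ (M ℕ.+ 4) ℕ.* 2 ℕ.^ ρ ℕ.* γ  ≡⟨ cong (ℕ._* γ) (ℕₚ.^-distribˡ-+-* 2 (M ℕ.+ 4) ρ) ⟨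
          2 ℕ.^ (M ℕ.+ 4 ℕ.+ ρ) ℕ.* γ  <⟨ ℕₚ.*-monoʳ-< (2 ℕ.^ (M ℕ.+ 4 ℕ.+ ρ)) {{ℕₚ.m^n≢0 2 (M ℕ.+ 4 ℕ.+ ρ)}} (n<2^n γ) ⟩
          2 ℕ.^ (M ℕ.+ 4 ℕ.+ ρ) ℕ.* 2 ℕ.^ γ  ≡⟨ ℕₚ.^-distribˡ-+-* 2 (M ℕ.+ 4 ℕ.+ ρ) γ ⟨
          2 ℕ.^ (M ℕ.+ 4 ℕ.+ ρ ℕ.+ γ)  ≡⟨ cong (2 ℕ.^_) (eq (M ℕ.+ 4) ρ γ) ⟩
          2 ℕ.^ (M ℕ.+ 4 ℕ.+ γ ℕ.+ ρ)  ≤⟨ 2^-mono exps ⟩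
          2 ℕ.^ m  ∎
          where
          eq : ∀ a b c → a ℕ.+ b ℕ.+ c ≡ a ℕ.+ c ℕ.+ b
          eq = solve-∀

      scaled : ∀ m₁ bd m β → β ℕ.* suc bd ℕ.< 2 ℕ.^ m →
        β ℕ.* suc (0 ℕ.+ bd ℕ.* 1) ℕ.< suc m₁ ℕ.* 2 ℕ.^ m ℕ.* 1
      scaled m₁ bd m β h = begin-strict
        β ℕ.* suc (0 ℕ.+ bd ℕ.* 1)  ≡⟨ cong (λ t → β ℕ.* suc t) (ℕₚ.*-identityʳ bd) ⟩
        β ℕ.* suc bd  <⟨ h ⟩
        2 ℕ.^ m  ≤⟨ ℕₚ.m≤n*m (2 ℕ.^ m) (suc m₁) ⟩
        suc m₁ ℕ.* 2 ℕ.^ m  ≡⟨ ℕₚ.*-identityʳ (suc m₁ ℕ.* 2 ℕ.^ m) ⟨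
        suc m₁ ℕ.* 2 ℕ.^ m ℕ.* 1  ∎
        where open ℕₚ.≤-Reasoning

      power-< : ∀ bd m → suc m ≡ P ℕ.* index bd → ι (2 ℕ.^ m) ^ Q < _^ℤ_ (r bd) {{r≢0 bd}} (↥ q)
      power-< bd m e = subst₂ _<_ (sym (ι-^ (2 ℕ.^ m) Q)) (cong (_^ℤ_ (r bd) {{r≢0 bd}}) (sym ↥q)) (ι-mono-< {(2 ℕ.^ m) ℕ.^ Q} {r bd ℕ.^ P} (begin-strict
        (2 ℕ.^ m) ℕ.^ Q  ≡⟨ ℕₚ.^-*-assoc 2 m Q ⟩
        2 ℕ.^ (m ℕ.* Q)  <⟨ ℕₚ.^-monoʳ-< 2 (ℕ.s≤s (ℕ.s≤s ℕ.z≤n)) (ℕₚ.*-monoˡ-< Q (ℕₚ.n<1+n m)) ⟩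
        2 ℕ.^ (suc m ℕ.* Q)  ≡⟨ cong (2 ℕ.^_) (trans (cong (ℕ._* Q) e) (eq P (index bd) Q)) ⟩
        2 ℕ.^ (Q ℕ.* index bd ℕ.* P)  ≡⟨ ℕₚ.^-*-assoc 2 (Q ℕ.* index bd) P ⟨
        r bd ℕ.^ P  ∎))
        where
        open ℕₚ.≤-Reasoning
        eq : ∀ P i Q → P ℕ.* i ℕ.* Q ≡ Q ℕ.* i ℕ.* P
        eq = solve-∀

      dense-impossible : ∀ bd ρ → d ℕ.* g (2 ℕ.+ Q ℕ.* index bd) ℕ.+ suc d ℕ.≤ ρ ℕ.+ ρ →
        ¬ ∇ᶜ 𝒢 (r bd) (ι (M ℕ.+ (4 ℕ.+ 2 ℕ.^ ρ)))
      dense-impossible bd ρ ρ≥ ((G , mem) , (H , nz , minor) , dense) =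
        ℕₚ.<⇒≱ (density-< (M ℕ.+ (4 ℕ.+ 2 ℕ.^ ρ)) (∣E∣ H) (∣V∣ H) {{nz}} dense)
          (shallow-density (Q ℕ.* index bd) ρ ρ≥ {G} mem {H} minor)

      module _ (c : ℝ) (c₁ : ℚ) (m₁ bd : ℕ) (c₁≡ : c₁ ≡ frac (suc m₁) bd) (0<c₁ : 0ℚ < c₁) (lc₁ : lower ⌊ c ⌋ c₁) where

        attained : ∀ m β → β ℕ.* suc bd ℕ.< 2 ℕ.^ m → suc m ≡ P ℕ.* index bd →
          lower (⌊ c ⌋ ⊛ _^ᴿ_ (r bd) {{r≢0 bd}} ⌊ b ⌋) (ι β)
        attained m β bound powers = power-attained c b (r bd) {{r≢0 bd}} (2 ℕ.^ m) β lc₁ 0<c₁ b>q q>0 (power-< bd m powers) small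
          where
          small : ι β < c₁ * ι (2 ℕ.^ m)
          small = subst (λ t → ι β < t * ι (2 ℕ.^ m)) (sym c₁≡) (subst (ι β <_) (sym (frac-* (suc m₁) bd (2 ℕ.^ m) 0))
            (frac-<⁺ β 0 (suc m₁ ℕ.* 2 ℕ.^ m) (0 ℕ.+ bd ℕ.* 1) (scaled m₁ bd m β bound)))

    -- With β = `M` + 4 + 2^ρ one has β < c₁ 2^m and 2^m < r^q, so β lies below c r^b; but no
    -- r-shallow minor has density above β.
    not-Ω : ¬ IsΩPow (∇ᶜ 𝒢) ⌊ b ⌋
    not-Ω (c , c>0 , N , Ω) =
      let c₁ , 0<c₁ , lc₁ = Cuts.lower-up (isReal c) c>0
          m₁ , _ , c₁≡ = as-frac c₁ 0<c₁
          bd = ℚ.denominator-1 c₁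
          N≤r , m , ρ , ρ≥ , bound , powers = choose N bd
      in dense-impossible N bd ρ ρ≥ (Ω (r N bd) {{r≢0 N bd}} N≤r (ι (M ℕ.+ (4 ℕ.+ 2 ℕ.^ ρ)))
           (attained N c c₁ m₁ bd c₁≡ 0<c₁ lc₁ m (M ℕ.+ (4 ℕ.+ 2 ℕ.^ ρ)) bound powers))

    not-forced : ¬ ForcesDensity ε b
    not-forced force = not-Ω (force 𝒢 hereditary sep sep-isSeparationFunction sep-Θ)

-- From the rational estimates to the inequality between cuts.

module Conclusion where

  open Fractions
  open ExponentSequence
  open DensityGrowth
  open import Data.Nat as ℕ using (ℕ; suc)
  import Data.Nat.Properties as ℕₚ
  open import Data.Nat.Tactic.RingSolver using (solve-∀)
  open import Data.Integer as ℤ using (+_)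
  open import Data.Rational as ℚ using (ℚ; 0ℚ; 1ℚ; ½; _+_; _*_; _-_; -_; _<_; _≤_; _<?_; _⊔_; ↥_)
  open import Data.Rational.Properties
  open import Data.Rational.Solver using (module +-*-Solver)
  open import Data.Product using (_,_)
  open import Data.Sum using (inj₁; inj₂; [_,_]′)
  open import Data.Empty using (⊥-elim)
  open import Relation.Nullary using (¬_; Dec; yes; no)
  open import Relation.Nullary.Decidable using (toWitness)
  open import Relation.Binary.PropositionalEquality

  2ℚ ¼ : ℚ
  2ℚ = frac 2 0
  ¼  = frac 1 3

  0<2 : 0ℚ < 2ℚ
  0<2 = toWitness {a? = 0ℚ <? 2ℚ} _

  0<* : ∀ {p q} → 0ℚ < p → 0ℚ < q → 0ℚ < p * q
  0<* {p} {q} 0<p 0<q = subst (_< p * q) (*-zeroˡ q) (*-mono-<ˡ q 0<q 0<p)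

  module _ (ε : ℝ) (ε>0 : Positive ε) where
    open Cuts (isReal ε)

    -- In essence q + 1/2 ≤ w < 1 / (2e) < 1 / (2ε). Product, reciprocal and difference each need
    -- strict room, which repeated use of `mul-dense` and density provides.
    bound-from-upper : ∀ q w e → upper ⌊ ε ⌋ e → q + ½ ≤ w → 0ℚ < w → w * (2ℚ * e) < 1ℚ →
      lower (recip (fromℕ 2 ⊛ ⌊ ε ⌋) ⊖ fromℚ ½) q
    bound-from-upper q w e up q+½≤w 0<w h =
      let 0<e = lower<upper ε>0 up
          0<2e = 0<* 0<2 0<e
          a , w<a , a2e<1 = mul-dense {w} 0<2e h
          0<a = <-trans 0<w w<a
          u , 2e<u , ua<1 = mul-dense {2ℚ * e} 0<a (subst (_< 1ℚ) (*-comm a (2ℚ * e)) a2e<1)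
          t , 2<t , te<u = mul-dense {2ℚ} 0<e 2e<u
          0<u = <-trans 0<2e 2e<u
          zeroʳ<u = λ s → subst (_< u) (sym (*-zeroʳ s)) 0<u
          m , w<m , m<a = <-dense w<a
      in a , ½ + (a - m) ,
         (u , (0ℚ , t , 0ℚ , e , (0<2 , 2<t , ε>0 , up) ,
                (zeroʳ<u 0ℚ , subst (_< u) (sym (*-zeroˡ e)) 0<u , zeroʳ<u t , te<u)) ,
              subst (_< 1ℚ) (*-comm u a) ua<1) ,
         subst (_< ½ + (a - m)) (+-identityʳ ½) (+-monoʳ-< ½ (subst (_< a - m) (+-inverseʳ m) (+-monoˡ-< (- m) m<a))) ,
         subst₂ _<_ (solve 1 (λ q → q :+ con ½ :+ (:- con ½) := q) refl q)
                    (solve 2 (λ a m → m :+ (:- con ½) := a :- (con ½ :+ (a :- m))) refl a m)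
                    (+-monoˡ-< (- ½) (≤-<-trans q+½≤w w<m))
      where open +-*-Solver

    -- The failure of e < ε does not put e in the upper cut, but the strict inequality survives for
    -- some e′ > e, and locatedness puts e′ there.
    bound-from-dichotomy : ∀ q w e → q + ½ ≤ w → 0ℚ < w → w * (2ℚ * e) < 1ℚ → ¬ lower ⌊ ε ⌋ e →
      lower (recip (fromℕ 2 ⊛ ⌊ ε ⌋) ⊖ fromℚ ½) q
    bound-from-dichotomy q w e q+½≤w 0<w h ¬lower =
      let e′ , e<e′ , h′ = mul-dense {e} (0<* 0<2 0<w) (subst (_< 1ℚ) (swap w e) h)
      in [ (λ l → ⊥-elim (¬lower l)) ,
           (λ up → bound-from-upper q w e′ up q+½≤w 0<w (subst (_< 1ℚ) (sym (swap w e′)) h′)) ]′ (located e e′ e<e′)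
      where
      open +-*-Solver
      swap : ∀ w e → w * (2ℚ * e) ≡ e * (2ℚ * w)
      swap = solve 2 (λ w e → w :* (con 2ℚ :* e) := e :* (con 2ℚ :* w)) refl

  -- With q = P / Q, the number Q / (2P + Q) is 1 / (2q + 1).
  inverse-identity : ∀ P′ s → (frac (suc P′) s + ½) * (2ℚ * frac (suc s) (2 ℕ.* suc P′ ℕ.+ s)) ≡ 1ℚ
  inverse-identity P′ s = begin
    (frac P s + frac 1 1) * (frac 2 0 * frac S N)  ≡⟨ cong₂ _*_ (frac-+ P s 1 1) (frac-* 2 0 S N) ⟩
    frac (P ℕ.* 2 ℕ.+ 1 ℕ.* S) (1 ℕ.+ s ℕ.* 2) * frac (2 ℕ.* S) (N ℕ.+ 0 ℕ.* suc N)
      ≡⟨ frac-* (P ℕ.* 2 ℕ.+ 1 ℕ.* S) (1 ℕ.+ s ℕ.* 2) (2 ℕ.* S) (N ℕ.+ 0 ℕ.* suc N) ⟩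
    frac ((P ℕ.* 2 ℕ.+ 1 ℕ.* S) ℕ.* (2 ℕ.* S)) (N ℕ.+ 0 ℕ.* suc N ℕ.+ (1 ℕ.+ s ℕ.* 2) ℕ.* suc (N ℕ.+ 0 ℕ.* suc N))
      ≡⟨ frac-≡ ((P ℕ.* 2 ℕ.+ 1 ℕ.* S) ℕ.* (2 ℕ.* S)) (N ℕ.+ 0 ℕ.* suc N ℕ.+ (1 ℕ.+ s ℕ.* 2) ℕ.* suc (N ℕ.+ 0 ℕ.* suc N)) 1 0 (eq P′ s) ⟩
    1ℚ  ∎
    where
    open ≡-Reasoning
    P = suc P′
    S = suc s
    N = 2 ℕ.* P ℕ.+ s
    eq : ∀ P′ s → (suc P′ ℕ.* 2 ℕ.+ 1 ℕ.* suc s) ℕ.* (2 ℕ.* suc s) ℕ.* 1 ≡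
      1 ℕ.* suc (2 ℕ.* suc P′ ℕ.+ s ℕ.+ 0 ℕ.* suc (2 ℕ.* suc P′ ℕ.+ s) ℕ.+ (1 ℕ.+ s ℕ.* 2) ℕ.* suc (2 ℕ.* suc P′ ℕ.+ s ℕ.+ 0 ℕ.* suc (2 ℕ.* suc P′ ℕ.+ s)))
    eq = solve-∀

  module _ (ε : ℝ) (ε>0 : Positive ε) (ε≤1 : lower ⌊ ε ⌋ ≼ lower (fromℚ 1ℚ))
    (b : ℝ) (force : ForcesDensity ε b) where

    -- If Q / (2P + Q) were below ε, roundedness would yield a rational A / B strictly between them,
    -- as the counterexample requires.
    exponent-small : ∀ q P′ → ↥ q ≡ + suc P′ → q ≡ frac (suc P′) (ℚ.denominator-1 q) → lower ⌊ b ⌋ q →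
      ¬ lower ⌊ ε ⌋ (frac (suc (ℚ.denominator-1 q)) (2 ℕ.* suc P′ ℕ.+ ℚ.denominator-1 q))
    exponent-small q P′ ↥q q≡ b>q l =
      let s = ℚ.denominator-1 q
          N = 2 ℕ.* suc P′ ℕ.+ s
          e , e′<e , l′ = Cuts.lower-up (isReal ε) l
          A′ , _ , e≡ = as-frac e (<-trans (frac-<⁺ 0 0 (suc s) N (ℕ.s≤s ℕ.z≤n)) e′<e)
          b₀ = ℚ.denominator-1 e
          gap = frac-<⁻ (suc s) N (suc A′) b₀ (subst (frac (suc s) N <_) e≡ e′<e)
      in Omega.not-forced ε ε>0 ε≤1 b q P′ ↥q b>q (subst (0ℚ <_) (sym q≡) (frac-<⁺ 0 0 (suc P′) s (ℕ.s≤s ℕ.z≤n)))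
           (suc A′) b₀ (subst (lower ⌊ ε ⌋) e≡ l′)
           (subst₂ ℕ._<_ (ℕₚ.*-comm (suc s) (suc b₀)) (cong (suc A′ ℕ.*_) (sym (ℕₚ.+-suc (2 ℕ.* suc P′) s))) gap) force

    ForcedBound : ℚ → Set
    ForcedBound = lower (recip (fromℕ 2 ⊛ ⌊ ε ⌋) ⊖ fromℚ ½)

    -- The quarter keeps the candidate value for 1 / (2 ε) positive.
    forced-bound : ∀ q → lower ⌊ b ⌋ q → ForcedBound q
    forced-bound q b>q =
      let q₁ , q<q₁ , b>q₁ = Cuts.lower-up (isReal b) b>q
      in cases q₁ q<q₁ b>q₁ (0ℚ <? q₁)
      where
      w = (q + ½) ⊔ ¼
      0<w : 0ℚ < w
      0<w = <-≤-trans (toWitness {a? = 0ℚ <? ¼} _) (p≤q⊔p (q + ½) ¼)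
      w< : ∀ {t} → q + ½ < t → ¼ < t → w < t
      w< {t} h₁ h₂ with ⊔-sel (q + ½) ¼
      ... | inj₁ e = subst (_< t) (sym e) h₁
      ... | inj₂ e = subst (_< t) (sym e) h₂
      cases : ∀ q₁ → q < q₁ → lower ⌊ b ⌋ q₁ → Dec (0ℚ < q₁) → ForcedBound q
      cases q₁ q<q₁ b>q₁ (no q₁≤0) = bound-from-dichotomy ε ε>0 q w 1ℚ (p≤p⊔q (q + ½) ¼) 0<w
        (*-mono-<ˡ (2ℚ * 1ℚ) (0<* 0<2 (toWitness {a? = 0ℚ <? 1ℚ} _))
          (w< (+-monoˡ-< ½ (<-≤-trans q<q₁ (≮⇒≥ q₁≤0))) (toWitness {a? = ¼ <? ½} _)))
        (λ l → <-irrefl refl (ε≤1 1ℚ l))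
      cases q₁ q<q₁ b>q₁ (yes 0<q₁) =
        let P′ , ↥q₁ , q₁≡ = as-frac q₁ 0<q₁
            s = ℚ.denominator-1 q₁
            e = frac (suc s) (2 ℕ.* suc P′ ℕ.+ s)
        in bound-from-dichotomy ε ε>0 q w e (p≤p⊔q (q + ½) ¼) 0<w
             (subst (w * (2ℚ * e) <_) (trans (cong (λ t → (t + ½) * (2ℚ * e)) q₁≡) (inverse-identity P′ s))
               (*-mono-<ˡ (2ℚ * e) (0<* 0<2 (frac-<⁺ 0 0 (suc s) (2 ℕ.* suc P′ ℕ.+ s) (ℕ.s≤s ℕ.z≤n)))
                 (w< (+-monoˡ-< ½ q<q₁) (<-trans (toWitness {a? = ¼ <? ½} _)
                   (subst (_< q₁ + ½) (+-identityˡ ½) (+-monoˡ-< ½ 0<q₁))))))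
             (exponent-small q₁ P′ ↥q₁ q₁≡ b>q₁)

open Conclusion using (forced-bound)

lemma10 : (ε : ℝ) → Positive ε → lower ⌊ ε ⌋ ≼ lower (fromℚ 1ℚ) →
    bSup ε ≼ lower (recip (fromℕ 2 ⊛ ⌊ ε ⌋) ⊖ fromℚ ½)
lemma10 ε ε>0 ε≤1 q ((b , force) , b>q) = forced-bound ε ε>0 ε≤1 b force q b>q
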